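{- Let $n$ be a positive integer, $0\le m\le\lfloor n/2\rfloor$ and $0\le k\le m$. Let $M^{(n-m,m)}$ be the complex vector space with basis $\{e_\sigma\}$ indexed by the $m$-element subsets $\sigma$ of $\{1,\dots,n\}$, let $b_0,\dots,b_m$ be complex numbers and let $B=B_{(n-m,m)}$ be the matrix (in the basis $\{e_\sigma\}$) whose $(\sigma,\tau)$ entry is $b_{\#(\sigma\cap\tau)}$. Let $\Omega=\{n-m+1,\dots,n\}$ and define the linear map $\pi:\mathbb{C}[S_n]\to M^{(n-m,m)}$ by $\pi(g)=e_{g(\Omega)}$ for $g\in S_n$. Let $T_k$ be the Young tableau of shape $(n-k,k)$ whose first row contains $1,\dots,n-k$ and whose second row contains $n-k+1,\dots,n$, with row subgroup $R(T_k)$ and column subgroup $C(T_k)$, and let $c_k=\big(\sum_{q\in C(T_k)}\operatorname{sgn}(q)q\big)\big(\sum_{p\in R(T_k)}p\big)\in\mathbb{C}[S_n]$. Then $\pi(c_k)$ is an eigenvector of $B$ with eigenvalue $$\lambda_k=\sum_{j=0}^{k}\sum_{p=0}^{m-k}(-1)^{k-j}\binom{k}{j}\binom{m-j}{p}\binom{n-m-k+j}{m-k-p}\,b_{j+p},$$ and, for generic $b_0,\dots,b_m$, the multiplicity of $\lambda_k$ as an eigenvalue of $B$ is $$f^{(n-k,k)}=\frac{n!\,(n-2k+1)}{k!\,(n-k+1)!}.$$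
   Context: $\#X$ denotes the cardinality of a finite set $X$. The row subgroup $R(T_k)$ (resp. column subgroup $C(T_k)$) consists of the permutations of $\{1,\dots,n\}$ preserving each row (resp. each column) of $T_k$ as a set. Products in the group ring are composition of permutations, $qp=q\circ p$. -}

module Defs where

open import Level using (Lift; 0ℓ; _⊔_)
open import Algebra.Bundles using (CommutativeRing; Semiring)
open import Algebra.Apartness.Bundles using (HeytingField; HeytingCommutativeRing)
import Algebra.Properties.CommutativeMonoid.Sum
open import Data.Bool.Base using (Bool; true; false; if_then_else_)
import Data.Bool.Properties as Bool
open import Data.Empty using (⊥-elim)
open import Data.Fin.Base using (Fin; zero; suc; toℕ; fromℕ<)
import Data.Fin.Base as Fin
open import Data.Fin.Permutation as Perm using (Permutation′; _⟨$⟩ʳ_; _⟨$⟩ˡ_; _∘ₚ_)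
import Data.Fin.Properties as Fin
open import Data.Fin.Properties using (toℕ≤pred[n])
open import Data.Fin.Subset using (Subset; inside; outside; _∩_) renaming (∣_∣ to ∣_∣ₛ)
open import Data.Fin.Subset.Properties using (∣p∩q∣≤∣p∣)
open import Data.List.Base as List using (List; []; _∷_; _++_)
open import Data.List.Membership.Propositional using (_∈_)
open import Data.List.Membership.Propositional.Properties using (∈-map⁺; ∈-map⁻; ∈-++⁺ˡ; ∈-++⁺ʳ; ∈-allFin)
open import Data.List.Relation.Unary.All as All using ([])
import Data.List.Relation.Unary.All.Properties as All
open import Data.List.Relation.Unary.AllPairs as AllPairs using (AllPairs; []; _∷_)
import Data.List.Relation.Unary.AllPairs.Properties as AllPairs
open import Data.List.Relation.Unary.Any as Any using (Any; here)
import Data.List.Relation.Unary.Any.Properties as Any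
open import Data.List.Relation.Unary.Unique.Propositional using (Unique)
import Data.List.Relation.Unary.Unique.Propositional.Properties as Unique
open import Data.Nat.Base as ℕ using (ℕ; zero; suc; _∸_; _≤ᵇ_; _<ᵇ_; s≤s; ⌊_/2⌋)
open import Data.Nat.Combinatorics using () renaming (_C_ to _choose_)
open import Data.Nat.GeneralisedArithmetic using (fold)
import Data.Nat.Properties as ℕ
open import Data.Product.Base using (Σ; ∃-syntax; _×_; _,_; proj₁; proj₂)
import Data.Rational.Base
open import Data.Rational.Base as ℚ using (ℚ; 0ℚ; 1ℚ; ½; ∣_∣; positive; nonNegative)
import Data.Rational.Properties as ℚ
open import Data.Rational.Solver using (module +-*-Solver)
open import Data.Sum.Base as Sum using (_⊎_; inj₁; inj₂)
open import Data.Vec.Base as Vec using ([]; _∷_)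
import Data.Vec.Properties as Vec
open import Data.Vec.Properties using (lookup∘tabulate; tabulate-cong)
open import Function.Base using (_∘_)
open import Relation.Binary.PropositionalEquality using (_≡_; _≢_; refl; sym; trans; cong; cong₂; subst; subst₂)
open import Relation.Nullary using (¬_; Dec; yes; no; does; _×-dec_)

-- ℝ is the setoid of Cauchy sequences of rationals, and ℂ = ℝ × ℝ.  Both carry
-- their setoid equality _≈_ and the apartness _#_, the positive form of ≠.

Eventually : (ℕ → Set) → Set
Eventually P = ∃[ N ] (∀ i → N ℕ.≤ i → P i)

Cauchy : (ℕ → ℚ) → Set
Cauchy s = ∀ ε → 0ℚ ℚ.< ε → ∃[ N ] (∀ i j → N ℕ.≤ i → N ℕ.≤ j → ∣ s i ℚ.- s j ∣ ℚ.< ε)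

record ℝ : Set where
  no-eta-equality
  constructor mkℝ
  field
    seq    : ℕ → ℚ
    cauchy : Cauchy seq
open ℝ public

private module Identity where
  open Data.Rational.Base using (_+_; _*_; _-_; -_)
  open +-*-Solver using (solve; _:=_; _:+_; _:*_; :-_; _:-_; con)

  swap : ∀ a b c → a * (b * c) ≡ b * (a * c)
  swap = solve 3 (λ a b c → a :* (b :* c) := b :* (a :* c)) refl

  minus-swap : ∀ a b → a - b ≡ - (b - a)
  minus-swap = solve 2 (λ a b → a :- b := :- (b :- a)) refl

  telescope : ∀ a b c → (a - b) + (b - c) ≡ a - c
  telescope = solve 3 (λ a b c → (a :- b) :+ (b :- c) := a :- c) refl

  cancel : ∀ a b → (a - b) + b ≡ a
  cancel = solve 2 (λ a b → (a :- b) :+ b := a) refl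

  cancel′ : ∀ a b → (a + b) - b ≡ a
  cancel′ = solve 2 (λ a b → (a :+ b) :- b := a) refl

  neg-minus : ∀ a b → b - a ≡ (- a) - (- b)
  neg-minus = solve 2 (λ a b → b :- a := (:- a) :- (:- b)) refl

  neg-square : ∀ a → (- a) * (- a) ≡ a * a
  neg-square = solve 1 (λ a → (:- a) :* (:- a) := a :* a) refl

  sum-minus : ∀ a b c d → (a - c) + (b - d) ≡ (a + b) - (c + d)
  sum-minus = solve 4 (λ a b c d → (a :- c) :+ (b :- d) := (a :+ b) :- (c :+ d)) refl

  minus-minus : ∀ a b c d → (a - c) + (d - b) ≡ (a - b) - (c - d)
  minus-minus = solve 4 (λ a b c d → (a :- c) :+ (d :- b) := (a :- b) :- (c :- d)) refl

  product-minus : ∀ a b c d → a * (b - d) + d * (a - c) ≡ a * b - c * d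
  product-minus = solve 4 (λ a b c d → a :* (b :- d) :+ d :* (a :- c) := a :* b :- c :* d) refl

  recip-minus : ∀ p q r s → r * (s * (q - p)) ≡ r * (q * s) - s * (p * r)
  recip-minus = solve 4 (λ p q r s → r :* (s :* (q :- p)) := r :* (q :* s) :- s :* (p :* r)) refl

  three-halves : ∀ h a → h * a + (h * a + h * a) ≡ h * (a + a + a)
  three-halves = solve 2 (λ h a → h :* a :+ (h :* a :+ h :* a) := h :* (a :+ a :+ a)) refl

  three-quarters : ∀ h a → h * (h * a) + h * (h * a) + h * (h * a) ≡ h * (h * a + h * a + h * a)
  three-quarters = solve 2 (λ h a → h :* (h :* a) :+ h :* (h :* a) :+ h :* (h :* a) := h :* (h :* a :+ h :* a :+ h :* a)) refl

  four-quarters : ∀ h a → h * (h * a + h * a + h * a) + h * (h * a) ≡ h * (h * a) + h * (h * a) + (h * (h * a) + h * (h * a))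
  four-quarters = solve 2 (λ h a → h :* (h :* a :+ h :* a :+ h :* a) :+ h :* (h :* a)
    := h :* (h :* a) :+ h :* (h :* a) :+ (h :* (h :* a) :+ h :* (h :* a))) refl

  re-assoc : ∀ a b c d e f → (a * c - b * d) * e - (a * d + b * c) * f ≡ a * (c * e - d * f) - b * (c * f + d * e)
  re-assoc = solve 6 (λ a b c d e f → (a :* c :- b :* d) :* e :- (a :* d :+ b :* c) :* f := a :* (c :* e :- d :* f) :- b :* (c :* f :+ d :* e)) refl

  im-assoc : ∀ a b c d e f → (a * c - b * d) * f + (a * d + b * c) * e ≡ a * (c * f + d * e) + b * (c * e - d * f)
  im-assoc = solve 6 (λ a b c d e f → (a :* c :- b :* d) :* f :+ (a :* d :+ b :* c) :* e := a :* (c :* f :+ d :* e) :+ b :* (c :* e :- d :* f)) refl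

  re-comm : ∀ a b c d → a * c - b * d ≡ c * a - d * b
  re-comm = solve 4 (λ a b c d → a :* c :- b :* d := c :* a :- d :* b) refl

  im-comm : ∀ a b c d → a * d + b * c ≡ c * b + d * a
  im-comm = solve 4 (λ a b c d → a :* d :+ b :* c := c :* b :+ d :* a) refl

  re-identity : ∀ a b → 1ℚ * a - 0ℚ * b ≡ a
  re-identity = solve 2 (λ a b → con 1ℚ :* a :- con 0ℚ :* b := a) refl

  im-identity : ∀ a b → 1ℚ * b + 0ℚ * a ≡ b
  im-identity = solve 2 (λ a b → con 1ℚ :* b :+ con 0ℚ :* a := b) refl

  re-distrib : ∀ a b c d e f → a * (c + e) - b * (d + f) ≡ (a * c - b * d) + (a * e - b * f)
  re-distrib = solve 6 (λ a b c d e f → a :* (c :+ e) :- b :* (d :+ f) := (a :* c :- b :* d) :+ (a :* e :- b :* f)) refl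

  im-distrib : ∀ a b c d e f → a * (d + f) + b * (c + e) ≡ (a * d + b * c) + (a * f + b * e)
  im-distrib = solve 6 (λ a b c d e f → a :* (d :+ f) :+ b :* (c :+ e) := (a :* d :+ b :* c) :+ (a :* f :+ b :* e)) refl

  re-inverse : ∀ a b n → a * (a * n) - b * (- (b * n)) ≡ (a * a + b * b) * n
  re-inverse = solve 3 (λ a b n → a :* (a :* n) :- b :* (:- (b :* n)) := (a :* a :+ b :* b) :* n) refl

  im-inverse : ∀ a b n → a * (- (b * n)) + b * (a * n) ≡ 0ℚ
  im-inverse = solve 3 (λ a b n → a :* (:- (b :* n)) :+ b :* (a :* n) := con 0ℚ) refl

module Real where

  infix 4 _≈_ _#_

  record _≈_ (x y : ℝ) : Set where
    constructor close
    field within : ∀ ε → 0ℚ ℚ.< ε → Eventually (λ i → ∣ seq x i ℚ.- seq y i ∣ ℚ.< ε)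
  open _≈_ public

  record _#_ (x y : ℝ) : Set where
    constructor apart
    field
      gap     : ℚ
      gap-pos : 0ℚ ℚ.< gap
      beyond  : Eventually (λ i → gap ℚ.≤ ∣ seq x i ℚ.- seq y i ∣)

  private
    open Data.Rational.Base using (_+_; _*_; _-_; -_; _<_; _≤_)

    ev-map : ∀ {P Q : ℕ → Set} → (∀ i → P i → Q i) → Eventually P → Eventually Q
    ev-map f (N , p) = N , λ i h → f i (p i h)

    ev-zip : ∀ {P Q R : ℕ → Set} → (∀ i → P i → Q i → R i) → Eventually P → Eventually Q → Eventually R
    ev-zip f (N , p) (M , q) = N ℕ.⊔ M , λ i h →
      f i (p i (ℕ.≤-trans (ℕ.m≤m⊔n N M) h)) (q i (ℕ.≤-trans (ℕ.m≤n⊔m N M) h))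

    half : ℚ → ℚ
    half ε = ½ * ε

    opaque
      half-pos : ∀ {ε} → 0ℚ < ε → 0ℚ < half ε
      half-pos {ε} 0<ε = subst (_< half ε) (ℚ.*-zeroʳ ½) (ℚ.*-monoʳ-<-pos ½ 0<ε)

    opaque
      half+half : ∀ ε → half ε + half ε ≡ ε
      half+half ε = trans (sym (ℚ.*-distribʳ-+ ε ½ ½)) (ℚ.*-identityˡ ε)

    opaque
      0<1 : 0ℚ < 1ℚ
      0<1 = ℚ.positive⁻¹ 1ℚ

    opaque
      *-pos : ∀ {p q} → 0ℚ < p → 0ℚ < q → 0ℚ < p * q
      *-pos {p} {q} 0<p 0<q = subst (_< p * q) (ℚ.*-zeroʳ p) (ℚ.*-monoʳ-<-pos p {{positive 0<p}} 0<q)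

    opaque
      split : ∀ K ε → 0ℚ < K → 0ℚ < ε → ∃[ δ ] (0ℚ < δ × K * δ ≡ ε)
      split K ε 0<K 0<ε = ε * K⁻¹ , *-pos 0<ε (ℚ.positive⁻¹ K⁻¹ {{ℚ.1/pos⇒pos K {{positive 0<K}}}}) ,
        trans (Identity.swap K ε K⁻¹) (trans (cong (ε *_) (ℚ.*-inverseʳ K {{K≢0}})) (ℚ.*-identityʳ ε))
        where
        K≢0 : ℚ.NonZero K
        K≢0 = ℚ.pos⇒nonZero K {{positive 0<K}}
        K⁻¹ : ℚ
        K⁻¹ = (ℚ.1/ K) {{K≢0}}

    opaque
      ∣-∣-sym : ∀ p q → ∣ p - q ∣ ≡ ∣ q - p ∣
      ∣-∣-sym p q = trans (cong ∣_∣ (Identity.minus-swap p q)) (ℚ.∣-p∣≡∣p∣ (q - p))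

    opaque
      triangle : ∀ p q r → ∣ p - r ∣ ≤ ∣ p - q ∣ + ∣ q - r ∣
      triangle p q r = subst (λ t → ∣ t ∣ ≤ ∣ p - q ∣ + ∣ q - r ∣)
        (Identity.telescope p q r)
        (ℚ.∣p+q∣≤∣p∣+∣q∣ (p - q) (q - r))

    opaque
      triangle-< : ∀ p q r {ε δ} → ∣ p - q ∣ < ε → ∣ q - r ∣ < δ → ∣ p - r ∣ < ε + δ
      triangle-< p q r h k = ℚ.≤-<-trans (triangle p q r) (ℚ.+-mono-< h k)

    opaque
      p-p : ∀ p → ∣ p - p ∣ ≡ 0ℚ
      p-p p = cong ∣_∣ (ℚ.+-inverseʳ p)

    opaque
      <-half : ∀ {p ε} → p < half ε + half ε → p < ε
      <-half {p} {ε} = subst (p <_) (half+half ε)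

    opaque
      ∣*∣-< : ∀ p q {K δ} → 0ℚ < K → ∣ p ∣ ≤ K → ∣ q ∣ < δ → ∣ p * q ∣ < K * δ
      ∣*∣-< p q {K} 0<K p≤K q<δ = subst (_< _) (sym (ℚ.∣p*q∣≡∣p∣*∣q∣ p q))
        (ℚ.≤-<-trans (ℚ.*-monoʳ-≤-nonNeg ∣ q ∣ {{ℚ.∣-∣-nonNeg q}} p≤K) (ℚ.*-monoʳ-<-pos K {{positive 0<K}} q<δ))

    opaque
      sum-< : ∀ a b c d ε → ∣ a - c ∣ < half ε → ∣ b - d ∣ < half ε → ∣ (a + b) - (c + d) ∣ < ε
      sum-< a b c d ε h k = subst₂ (λ s t → ∣ s ∣ < t) (Identity.sum-minus a b c d) (half+half ε)
        (ℚ.≤-<-trans (ℚ.∣p+q∣≤∣p∣+∣q∣ (a - c) (b - d)) (ℚ.+-mono-< h k))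

    opaque
      product-< : ∀ a b c d ε {K L δ η} → 0ℚ < K → 0ℚ < L → K * δ ≡ half ε → L * η ≡ half ε →
        ∣ a ∣ ≤ K → ∣ d ∣ ≤ L → ∣ b - d ∣ < δ → ∣ a - c ∣ < η → ∣ a * b - c * d ∣ < ε
      product-< a b c d ε {K} {L} {δ} {η} 0<K 0<L Kδ Lη a≤ d≤ b< a< = subst₂ (λ s t → ∣ s ∣ < t) (Identity.product-minus a b c d) (half+half ε)
        (ℚ.≤-<-trans (ℚ.∣p+q∣≤∣p∣+∣q∣ (a * (b - d)) (d * (a - c))) (ℚ.+-mono-< t₁ t₂))
        where
        t₁ : ∣ a * (b - d) ∣ < half ε
        t₁ = subst (∣ a * (b - d) ∣ <_) Kδ (∣*∣-< a (b - d) 0<K a≤ b<)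
        t₂ : ∣ d * (a - c) ∣ < half ε
        t₂ = subst (∣ d * (a - c) ∣ <_) Lη (∣*∣-< d (a - c) 0<L d≤ a<)

  opaque
    bounded : ∀ x → ∃[ K ] (0ℚ ℚ.< K × Eventually (λ i → ∣ seq x i ∣ ℚ.≤ K))
    bounded x with cauchy x 1ℚ 0<1
    ... | N , c = K , 0<K , N , λ i h → ℚ.<⇒≤ (bound i h)
      where
      K : ℚ
      K = 1ℚ + ∣ seq x N ∣
      0<K : 0ℚ < K
      0<K = ℚ.+-mono-<-≤ 0<1 (ℚ.0≤∣p∣ (seq x N))
      bound : ∀ i → N ℕ.≤ i → ∣ seq x i ∣ < K
      bound i h = subst (λ t → ∣ t ∣ < K)
        (Identity.cancel (seq x i) (seq x N))
        (ℚ.≤-<-trans (ℚ.∣p+q∣≤∣p∣+∣q∣ (seq x i - seq x N) (seq x N))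
          (ℚ.+-monoˡ-< ∣ seq x N ∣ (c i N h ℕ.≤-refl)))

  private
   opaque
    const-cauchy : ∀ q → Cauchy (λ _ → q)
    const-cauchy q ε 0<ε = 0 , λ _ _ _ _ → subst (_< ε) (sym (p-p q)) 0<ε

   opaque
    ⊕-cauchy : ∀ x y → Cauchy (λ i → seq x i + seq y i)
    ⊕-cauchy x y ε 0<ε with cauchy x (half ε) (half-pos 0<ε) | cauchy y (half ε) (half-pos 0<ε)
    ... | N , p | M , q = N ℕ.⊔ M , λ i j hi hj → sum-< (seq x i) (seq y i) (seq x j) (seq y j) ε
      (p i j (ℕ.m⊔n≤o⇒m≤o N M hi) (ℕ.m⊔n≤o⇒m≤o N M hj)) (q i j (ℕ.m⊔n≤o⇒n≤o N M hi) (ℕ.m⊔n≤o⇒n≤o N M hj))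

   opaque
    ⊖-cauchy : ∀ x → Cauchy (λ i → - seq x i)
    ⊖-cauchy x ε 0<ε = proj₁ (cauchy x ε 0<ε) , λ i j hi hj →
      subst (_< ε) (trans (∣-∣-sym (seq x i) (seq x j))
        (cong ∣_∣ (Identity.neg-minus (seq x i) (seq x j)))) (proj₂ (cauchy x ε 0<ε) i j hi hj)

   opaque
    ⊛-cauchy : ∀ x y → Cauchy (λ i → seq x i * seq y i)
    ⊛-cauchy x y ε 0<ε with bounded x | bounded y
    ... | K , 0<K , N₁ , kx | L , 0<L , N₂ , ly with split K (half ε) 0<K (half-pos 0<ε) | split L (half ε) 0<L (half-pos 0<ε)
    ...   | δ , 0<δ , Kδ | η , 0<η , Lη with cauchy y δ 0<δ | cauchy x η 0<η
    ...     | N₃ , cy | N₄ , cx = (N₁ ℕ.⊔ N₂) ℕ.⊔ (N₃ ℕ.⊔ N₄) , λ i j hi hj →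
      let i₁ = ℕ.m⊔n≤o⇒m≤o N₁ N₂ (ℕ.m⊔n≤o⇒m≤o (N₁ ℕ.⊔ N₂) (N₃ ℕ.⊔ N₄) hi)
          j₂ = ℕ.m⊔n≤o⇒n≤o N₁ N₂ (ℕ.m⊔n≤o⇒m≤o (N₁ ℕ.⊔ N₂) (N₃ ℕ.⊔ N₄) hj)
          i₃ = ℕ.m⊔n≤o⇒m≤o N₃ N₄ (ℕ.m⊔n≤o⇒n≤o (N₁ ℕ.⊔ N₂) (N₃ ℕ.⊔ N₄) hi)
          j₃ = ℕ.m⊔n≤o⇒m≤o N₃ N₄ (ℕ.m⊔n≤o⇒n≤o (N₁ ℕ.⊔ N₂) (N₃ ℕ.⊔ N₄) hj)
          i₄ = ℕ.m⊔n≤o⇒n≤o N₃ N₄ (ℕ.m⊔n≤o⇒n≤o (N₁ ℕ.⊔ N₂) (N₃ ℕ.⊔ N₄) hi)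
          j₄ = ℕ.m⊔n≤o⇒n≤o N₃ N₄ (ℕ.m⊔n≤o⇒n≤o (N₁ ℕ.⊔ N₂) (N₃ ℕ.⊔ N₄) hj)
      in product-< (seq x i) (seq y i) (seq x j) (seq y j) ε 0<K 0<L Kδ Lη (kx i i₁) (ly j j₂) (cy i j i₃ j₃) (cx i j i₄ j₄)

  infixl 6 _⊕_
  infixl 7 _⊛_

  fromℚ : ℚ → ℝ
  fromℚ q = mkℝ (λ _ → q) (const-cauchy q)

  _⊕_ _⊛_ : ℝ → ℝ → ℝ
  x ⊕ y = mkℝ (λ i → seq x i ℚ.+ seq y i) (⊕-cauchy x y)
  x ⊛ y = mkℝ (λ i → seq x i ℚ.* seq y i) (⊛-cauchy x y)

  ⊖_ : ℝ → ℝ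
  ⊖ x = mkℝ (λ i → ℚ.- seq x i) (⊖-cauchy x)

  opaque
    pointwise : ∀ {x y} → (∀ i → seq x i ≡ seq y i) → x ≈ y
    pointwise {x} {y} e .within ε 0<ε = 0 , λ i _ →
      subst (_< ε) (sym (trans (cong (λ t → ∣ t - seq y i ∣) (e i)) (p-p (seq y i)))) 0<ε

  opaque
    ≈-refl : ∀ {x} → x ≈ x
    ≈-refl {x} = pointwise {x} {x} λ _ → refl

  opaque
    ≈-sym : ∀ {x y} → x ≈ y → y ≈ x
    ≈-sym {x} {y} p .within ε 0<ε = ev-map (λ i → subst (_< ε) (∣-∣-sym (seq x i) (seq y i))) (within p ε 0<ε)

  opaque
    ≈-trans : ∀ {x y z} → x ≈ y → y ≈ z → x ≈ z
    ≈-trans {x} {y} {z} p q .within ε 0<ε = ev-zip (λ i h k → <-half (triangle-< (seq x i) (seq y i) (seq z i) h k))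
      (within p (half ε) (half-pos 0<ε)) (within q (half ε) (half-pos 0<ε))

  opaque
    ⊕-cong : ∀ {x y u v} → x ≈ y → u ≈ v → x ⊕ u ≈ y ⊕ v
    ⊕-cong {x} {y} {u} {v} p q .within ε 0<ε = ev-zip (λ i → sum-< (seq x i) (seq u i) (seq y i) (seq v i) ε)
      (within p (half ε) (half-pos 0<ε)) (within q (half ε) (half-pos 0<ε))

  opaque
    ⊖-cong : ∀ {x y} → x ≈ y → ⊖ x ≈ ⊖ y
    ⊖-cong {x} {y} p .within ε 0<ε = ev-map (λ i → subst (_< ε) (trans (∣-∣-sym (seq x i) (seq y i))
        (cong ∣_∣ (Identity.neg-minus (seq x i) (seq y i))))) (within p ε 0<ε)

  opaque
    ⊛-cong : ∀ {x y u v} → x ≈ y → u ≈ v → x ⊛ u ≈ y ⊛ v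
    ⊛-cong {x} {y} {u} {v} p q .within ε 0<ε with bounded x | bounded v
    ... | K , 0<K , kx | L , 0<L , lv with split K (half ε) 0<K (half-pos 0<ε) | split L (half ε) 0<L (half-pos 0<ε)
    ...   | δ , 0<δ , Kδ | η , 0<η , Lη =
      ev-zip (λ i (kx , ly) (cy , cx) → product-< (seq x i) (seq u i) (seq y i) (seq v i) ε 0<K 0<L Kδ Lη kx ly cy cx)
        (ev-zip (λ _ → _,_) kx lv) (ev-zip (λ _ → _,_) (within q δ 0<δ) (within p η 0<η))

  opaque
    #-irrefl : ∀ {x y} → x ≈ y → ¬ (x # y)
    #-irrefl p (apart ε 0<ε (N , h)) with within p ε 0<ε
    ... | M , k = ℚ.<-irrefl refl
      (ℚ.≤-<-trans (h (N ℕ.⊔ M) (ℕ.m≤m⊔n N M)) (k (N ℕ.⊔ M) (ℕ.m≤n⊔m N M)))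

  opaque
    #-sym : ∀ {x y} → x # y → y # x
    #-sym {x} {y} (apart ε 0<ε h) = apart ε 0<ε (ev-map (λ i → subst (ε ≤_) (∣-∣-sym (seq x i) (seq y i))) h)

  private
    Far Near : ℝ → ℝ → ℚ → Set
    Far  x y ε = Eventually λ i → half ε ≤ ∣ seq x i - seq y i ∣
    Near x y ε = Eventually λ i → ∣ seq x i - seq y i ∣ < half (ε + ε + ε)

    opaque
      decide : ∀ x y ε → 0ℚ < ε → Far x y ε ⊎ Near x y ε
      decide x y ε 0<ε with cauchy x (half (half ε)) (half-pos (half-pos 0<ε)) | cauchy y (half (half ε)) (half-pos (half-pos 0<ε))
      ... | N , cx | M , cy = go (ε ℚ.≤? ∣ seq x P - seq y P ∣)
        where
        P : ℕ
        P = N ℕ.⊔ M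
        step : ∀ i → P ℕ.≤ i → ∣ (seq x P - seq y P) - (seq x i - seq y i) ∣ < half ε
        step i h = <-half (subst (λ t → ∣ t ∣ < half (half ε) + half (half ε))
          (Identity.minus-minus (seq x P) (seq y P) (seq x i) (seq y i))
          (ℚ.≤-<-trans (ℚ.∣p+q∣≤∣p∣+∣q∣ (seq x P - seq x i) (seq y i - seq y P))
            (ℚ.+-mono-< (cx P i (ℕ.m≤m⊔n N M) (ℕ.m⊔n≤o⇒m≤o N M h)) (cy i P (ℕ.m⊔n≤o⇒n≤o N M h) (ℕ.m≤n⊔m N M)))))
        abs≤ : ∀ p q → ∣ p ∣ ≤ ∣ p - q ∣ + ∣ q ∣
        abs≤ p q = subst (λ t → ∣ t ∣ ≤ ∣ p - q ∣ + ∣ q ∣) (Identity.cancel p q) (ℚ.∣p+q∣≤∣p∣+∣q∣ (p - q) q)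
        go : Dec (ε ≤ ∣ seq x P - seq y P ∣) → Far x y ε ⊎ Near x y ε
        go (yes ε≤) = inj₁ (P , λ i h → ℚ.≮⇒≥ λ lt → ℚ.<-irrefl refl
          (ℚ.≤-<-trans (ℚ.≤-trans ε≤ (abs≤ (seq x P - seq y P) (seq x i - seq y i)))
            (<-half (ℚ.+-mono-< (step i h) lt))))
        go (no ε≰) = inj₂ (P , λ i h → subst (∣ seq x i - seq y i ∣ <_)
          (trans (cong (half ε +_) (sym (half+half ε))) (Identity.three-halves ½ ε))
          (ℚ.≤-<-trans (abs≤ (seq x i - seq y i) (seq x P - seq y P))
            (ℚ.+-mono-< (subst (_< half ε) (∣-∣-sym (seq x P - seq y P) (seq x i - seq y i)) (step i h)) (ℚ.≰⇒> ε≰))))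

  opaque
    #-tight : ∀ x y → ¬ (x # y) → x ≈ y
    #-tight x y ¬# .within ε 0<ε with decide x y (half ε) (half-pos 0<ε)
    ... | inj₁ h = ⊥-elim (¬# (apart (half (half ε)) (half-pos (half-pos 0<ε)) h))
    ... | inj₂ h = ev-map (λ i → λ lt → ℚ.<-trans lt bound) h
      where
      bound : half (half ε + half ε + half ε) < ε
      bound = subst (half (half ε + half ε + half ε) <_) (half+half ε) (subst (_< half ε + half ε)
        (trans (cong (_+ half (half ε)) (sym (half+half (half ε)))) (Identity.three-quarters ½ ε))
        (ℚ.+-monoʳ-< (half ε) (halve< (half-pos 0<ε))))
        where
        halve< : ∀ {p} → 0ℚ < p → half p < p
        halve< {p} 0<p = subst₂ _<_ (ℚ.+-identityʳ (half p)) (half+half p) (ℚ.+-monoʳ-< (half p) (half-pos 0<p))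

  opaque
    #-cotrans : ∀ {x y} → x # y → ∀ z → x # z ⊎ z # y
    #-cotrans {x} {y} (apart ε 0<ε h) z with decide x z (half ε) (half-pos 0<ε)
    ... | inj₁ k = inj₁ (apart (half (half ε)) (half-pos (half-pos 0<ε)) k)
    ... | inj₂ k = inj₂ (apart (half (half ε)) (half-pos (half-pos 0<ε)) (ev-zip (λ i e≤ lt → ℚ.≮⇒≥ λ lt′ →
        ℚ.<-irrefl refl (ℚ.≤-<-trans e≤ (subst (∣ seq x i - seq y i ∣ <_) eq (triangle-< (seq x i) (seq z i) (seq y i) lt lt′)))) h k))
      where
      eq : half (half ε + half ε + half ε) + half (half ε) ≡ ε
      eq = trans (Identity.four-quarters ½ ε)
             (trans (cong₂ _+_ (half+half (half ε)) (half+half (half ε))) (half+half ε))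

  private
    opaque
      recip : ℚ → ℚ
      recip p with p ℚ.≟ 0ℚ
      ... | yes _  = 0ℚ
      ... | no p≢0 = (ℚ.1/ p) {{ℚ.≢-nonZero p≢0}}

    opaque
      unfolding recip
      recip-inverse : ∀ p → p ≢ 0ℚ → p * recip p ≡ 1ℚ
      recip-inverse p p≢0 with p ℚ.≟ 0ℚ
      ... | yes p≡0 = ⊥-elim (p≢0 p≡0)
      ... | no p≢0′ = ℚ.*-inverseʳ p {{ℚ.≢-nonZero p≢0′}}

    opaque
      bound⇒≢ : ∀ {p ε} → 0ℚ < ε → ε ≤ ∣ p ∣ → p ≢ 0ℚ
      bound⇒≢ 0<ε ε≤ refl = ℚ.<-irrefl refl (ℚ.<-≤-trans 0<ε ε≤)

    opaque
      ∣recip∣≤ : ∀ p {ε K} → 0ℚ < ε → ε * K ≡ 1ℚ → ε ≤ ∣ p ∣ → ∣ recip p ∣ ≤ K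
      ∣recip∣≤ p {ε} {K} 0<ε εK ε≤ = ℚ.*-cancelˡ-≤-pos ε {{positive 0<ε}} (subst (ε * ∣ recip p ∣ ≤_)
        (trans (sym (ℚ.∣p*q∣≡∣p∣*∣q∣ p (recip p))) (trans (cong ∣_∣ (recip-inverse p (bound⇒≢ 0<ε ε≤))) (sym εK)))
        (ℚ.*-monoʳ-≤-nonNeg ∣ recip p ∣ {{ℚ.∣-∣-nonNeg (recip p)}} ε≤))

    opaque
      recip-diff : ∀ p q → p ≢ 0ℚ → q ≢ 0ℚ → recip p * (recip q * (q - p)) ≡ recip p - recip q
      recip-diff p q p≢0 q≢0 = trans
        (Identity.recip-minus p q (recip p) (recip q))
        (cong₂ _-_ (trans (cong (recip p *_) (recip-inverse q q≢0)) (ℚ.*-identityʳ (recip p)))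
                   (trans (cong (recip q *_) (recip-inverse p p≢0)) (ℚ.*-identityʳ (recip q))))

    opaque
      p-0≡p : ∀ p → p - 0ℚ ≡ p
      p-0≡p = ℚ.+-identityʳ

  opaque
    #0⇒inverse : ∀ x → x # fromℚ 0ℚ → ∃[ y ] x ⊛ y ≈ fromℚ 1ℚ
    #0⇒inverse x (apart ε 0<ε (N , h)) = mkℝ (recip ∘ seq x) c , close inv
      where
      h′ : ∀ i → N ℕ.≤ i → ε ≤ ∣ seq x i ∣
      h′ i l = subst (λ t → ε ≤ ∣ t ∣) (p-0≡p (seq x i)) (h i l)
      inv : ∀ δ → 0ℚ < δ → Eventually (λ i → ∣ seq x i * recip (seq x i) - 1ℚ ∣ < δ)
      inv δ 0<δ = N , λ i l → subst (_< δ)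
        (sym (trans (cong (λ t → ∣ t - 1ℚ ∣) (recip-inverse (seq x i) (bound⇒≢ 0<ε (h′ i l)))) (p-p 1ℚ))) 0<δ
      c : ∀ δ → 0ℚ < δ → ∃[ M ] (∀ i j → M ℕ.≤ i → M ℕ.≤ j → ∣ recip (seq x i) - recip (seq x j) ∣ < δ)
      c δ 0<δ with split ε 1ℚ 0<ε 0<1
      ... | K , 0<K , εK with split K δ 0<K 0<δ
      ...   | δ₁ , 0<δ₁ , Kδ₁ with split K δ₁ 0<K 0<δ₁
      ...     | δ₂ , 0<δ₂ , Kδ₂ with cauchy x δ₂ 0<δ₂
      ...       | M , cx = N ℕ.⊔ M , λ i j hi hj →
        let p = seq x i ; q = seq x j
            ep = h′ i (ℕ.m⊔n≤o⇒m≤o N M hi)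
            eq = h′ j (ℕ.m⊔n≤o⇒m≤o N M hj)
            s₁ = subst (∣ recip q * (q - p) ∣ <_) Kδ₂
                   (∣*∣-< (recip q) (q - p) 0<K (∣recip∣≤ q 0<ε εK eq) (cx j i (ℕ.m⊔n≤o⇒n≤o N M hj) (ℕ.m⊔n≤o⇒n≤o N M hi)))
            s₂ = subst (∣ recip p * (recip q * (q - p)) ∣ <_) Kδ₁
                   (∣*∣-< (recip p) (recip q * (q - p)) 0<K (∣recip∣≤ p 0<ε εK ep) s₁)
        in subst (λ t → ∣ t ∣ < δ) (recip-diff p q (bound⇒≢ 0<ε ep) (bound⇒≢ 0<ε eq)) s₂

  opaque
    inverse⇒#0 : ∀ x y → x ⊛ y ≈ fromℚ 1ℚ → x # fromℚ 0ℚ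
    inverse⇒#0 x y xy≈1 with bounded y
    ... | K , 0<K , ky with split K ½ 0<K (ℚ.positive⁻¹ ½)
    ...   | δ , 0<δ , Kδ = apart δ 0<δ (ev-zip (λ i k lt → subst (λ t → δ ≤ ∣ t ∣) (sym (p-0≡p (seq x i)))
        (ℚ.≮⇒≥ λ x<δ → ℚ.<-irrefl refl (ℚ.≤-<-trans (one≤ i) (ℚ.+-mono-< lt
          (subst (_< ½) (cong ∣_∣ (ℚ.*-comm (seq y i) (seq x i))) (subst (∣ seq y i * seq x i ∣ <_) Kδ (∣*∣-< (seq y i) (seq x i) 0<K k x<δ)))))))
        ky (within xy≈1 ½ (ℚ.positive⁻¹ ½)))
      where
      one≤ : ∀ i → 1ℚ ≤ ∣ seq x i * seq y i - 1ℚ ∣ + ∣ seq x i * seq y i ∣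
      one≤ i = let p = seq x i * seq y i in subst (1ℚ ≤_) (cong (_+ ∣ p ∣) (∣-∣-sym 1ℚ p))
        (subst (λ t → ∣ t ∣ ≤ ∣ 1ℚ - p ∣ + ∣ p ∣) (Identity.cancel 1ℚ p) (ℚ.∣p+q∣≤∣p∣+∣q∣ (1ℚ - p) p))

  opaque
    square-#0 : ∀ x y → x # fromℚ 0ℚ → x ⊛ x ⊕ y ⊛ y # fromℚ 0ℚ
    square-#0 x y (apart ε 0<ε h) = apart (ε * ε) (*-pos 0<ε 0<ε) (ev-map (λ i e≤ →
        subst (λ t → ε * ε ≤ ∣ t ∣) (sym (p-0≡p _)) (bound (seq x i) (seq y i) (subst (λ t → ε ≤ ∣ t ∣) (p-0≡p (seq x i)) e≤))) h)
      where
      sq : ∀ p → ∣ p ∣ * ∣ p ∣ ≡ p * p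
      sq p with ℚ.∣p∣≡p∨∣p∣≡-p p
      ... | inj₁ e = cong₂ _*_ e e
      ... | inj₂ e = trans (cong₂ _*_ e e) (Identity.neg-square p)
      0≤sq : ∀ p → 0ℚ ≤ p * p
      0≤sq p = subst₂ _≤_ (ℚ.*-zeroʳ ∣ p ∣) (sq p) (ℚ.*-monoˡ-≤-nonNeg ∣ p ∣ {{ℚ.∣-∣-nonNeg p}} (ℚ.0≤∣p∣ p))
      ≤∣∣ : ∀ p → p ≤ ∣ p ∣
      ≤∣∣ p with ℚ.≤-total 0ℚ p
      ... | inj₁ 0≤p = ℚ.≤-reflexive (sym (ℚ.0≤p⇒∣p∣≡p 0≤p))
      ... | inj₂ p≤0 = ℚ.≤-trans p≤0 (ℚ.0≤∣p∣ p)
      bound : ∀ p q → ε ≤ ∣ p ∣ → ε * ε ≤ ∣ p * p + q * q ∣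
      bound p q e≤ = ℚ.≤-trans
        (subst₂ _≤_ (ℚ.+-identityʳ (ε * ε)) (cong (_+ q * q) (sq p)) (ℚ.+-mono-≤
          (ℚ.≤-trans (ℚ.*-monoˡ-≤-nonNeg ε {{nonNegative (ℚ.<⇒≤ 0<ε)}} e≤) (ℚ.*-monoʳ-≤-nonNeg ∣ p ∣ {{ℚ.∣-∣-nonNeg p}} e≤))
          (0≤sq q)))
        (≤∣∣ (p * p + q * q))

  opaque
    ⊕-#0 : ∀ x y → x ⊕ y # fromℚ 0ℚ → x # fromℚ 0ℚ ⊎ y # fromℚ 0ℚ
    ⊕-#0 x y p with #-cotrans p y
    ... | inj₂ q = inj₂ q
    ... | inj₁ (apart ε 0<ε h) = inj₁ (apart ε 0<ε (ev-map (λ i → subst (λ t → ε ≤ ∣ t ∣)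
        (trans (Identity.cancel′ (seq x i) (seq y i)) (sym (p-0≡p (seq x i))))) h))

  opaque
    ⊛-#0 : ∀ x y → x ⊛ y # fromℚ 0ℚ → x # fromℚ 0ℚ
    ⊛-#0 x y p = let (t , q) = #0⇒inverse (x ⊛ y) p in
      inverse⇒#0 x (y ⊛ t) (≈-trans {x ⊛ (y ⊛ t)} {(x ⊛ y) ⊛ t} (pointwise λ i → sym (ℚ.*-assoc (seq x i) (seq y i) (seq t i))) q)

  opaque
    #-congˡ : ∀ {x y z} → x ≈ y → x # z → y # z
    #-congˡ {y = y} p q with #-cotrans q y
    ... | inj₁ r = ⊥-elim (#-irrefl p r)
    ... | inj₂ r = r

  opaque
    1#0 : fromℚ 1ℚ # fromℚ 0ℚ
    1#0 = inverse⇒#0 (fromℚ 1ℚ) (fromℚ 1ℚ) (pointwise λ _ → ℚ.*-identityˡ 1ℚ)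

  opaque
    #⇒-#0 : ∀ {x y} → x # y → x ⊕ (⊖ y) # fromℚ 0ℚ
    #⇒-#0 {x} {y} (apart ε 0<ε h) = apart ε 0<ε (ev-map (λ i → subst (λ t → ε ≤ ∣ t ∣) (sym (p-0≡p (seq x i - seq y i)))) h)

  opaque
    -#0⇒# : ∀ {x y} → x ⊕ (⊖ y) # fromℚ 0ℚ → x # y
    -#0⇒# {x} {y} (apart ε 0<ε h) = apart ε 0<ε (ev-map (λ i → subst (λ t → ε ≤ ∣ t ∣) (p-0≡p (seq x i - seq y i))) h)

record ℂ : Set where
  no-eta-equality
  constructor _+i_
  field
    re im : ℝ
open ℂ public

module Complex where

  open Real using (fromℚ; _⊕_; ⊖_; _⊛_; pointwise)

  infix  4 _≈_ _#_
  infixl 6 _+_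
  infixl 7 _*_
  infix  8 -_

  record _≈_ (z w : ℂ) : Set where
    constructor _,_
    field
      re≈ : re z Real.≈ re w
      im≈ : im z Real.≈ im w
  open _≈_ public

  data _#_ (z w : ℂ) : Set where
    re# : re z Real.# re w → z # w
    im# : im z Real.# im w → z # w

  _+_ _*_ : ℂ → ℂ → ℂ
  z + w = (re z ⊕ re w) +i (im z ⊕ im w)
  z * w = (re z ⊛ re w ⊕ (⊖ (im z ⊛ im w))) +i (re z ⊛ im w ⊕ im z ⊛ re w)

  -_ : ℂ → ℂ
  - z = (⊖ re z) +i (⊖ im z)

  0# 1# : ℂ
  0# = fromℚ 0ℚ +i fromℚ 0ℚ
  1# = fromℚ 1ℚ +i fromℚ 0ℚ

  private
    pointwise₂ : ∀ {z w} → (∀ i → seq (re z) i ≡ seq (re w) i) → (∀ i → seq (im z) i ≡ seq (im w) i) → z ≈ w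
    pointwise₂ p q = pointwise p , pointwise q

    infix 10 _ᵣ_ _ᵢ_
    _ᵣ_ _ᵢ_ : ℂ → ℕ → ℚ
    z ᵣ i = seq (re z) i
    z ᵢ i = seq (im z) i

  ≈-refl : ∀ {z} → z ≈ z
  ≈-refl = Real.≈-refl , Real.≈-refl

  ≈-sym : ∀ {z w} → z ≈ w → w ≈ z
  ≈-sym (p , q) = Real.≈-sym p , Real.≈-sym q

  ≈-trans : ∀ {z w v} → z ≈ w → w ≈ v → z ≈ v
  ≈-trans (p , q) (p′ , q′) = Real.≈-trans p p′ , Real.≈-trans q q′

  +-cong : ∀ {z w u v} → z ≈ w → u ≈ v → z + u ≈ w + v
  +-cong (p , q) (p′ , q′) = Real.⊕-cong p p′ , Real.⊕-cong q q′

  *-cong : ∀ {z w u v} → z ≈ w → u ≈ v → z * u ≈ w * v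
  *-cong (p , q) (p′ , q′) = Real.⊕-cong (Real.⊛-cong p p′) (Real.⊖-cong (Real.⊛-cong q q′)) , Real.⊕-cong (Real.⊛-cong p q′) (Real.⊛-cong q p′)

  -‿cong : ∀ {z w} → z ≈ w → - z ≈ - w
  -‿cong (p , q) = Real.⊖-cong p , Real.⊖-cong q

  +-assoc : ∀ x y z → (x + y) + z ≈ x + (y + z)
  +-assoc x y z = pointwise₂ (λ i → ℚ.+-assoc (x ᵣ i) (y ᵣ i) (z ᵣ i)) (λ i → ℚ.+-assoc (x ᵢ i) (y ᵢ i) (z ᵢ i))

  +-comm : ∀ x y → x + y ≈ y + x
  +-comm x y = pointwise₂ (λ i → ℚ.+-comm (x ᵣ i) (y ᵣ i)) (λ i → ℚ.+-comm (x ᵢ i) (y ᵢ i))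

  +-identityˡ : ∀ x → 0# + x ≈ x
  +-identityˡ x = pointwise₂ (λ i → ℚ.+-identityˡ (x ᵣ i)) (λ i → ℚ.+-identityˡ (x ᵢ i))

  -‿inverseˡ : ∀ x → - x + x ≈ 0#
  -‿inverseˡ x = pointwise₂ (λ i → ℚ.+-inverseˡ (x ᵣ i)) (λ i → ℚ.+-inverseˡ (x ᵢ i))

  *-assoc : ∀ x y z → (x * y) * z ≈ x * (y * z)
  *-assoc x y z = pointwise₂
    (λ i → Identity.re-assoc (x ᵣ i) (x ᵢ i) (y ᵣ i) (y ᵢ i) (z ᵣ i) (z ᵢ i))
    (λ i → Identity.im-assoc (x ᵣ i) (x ᵢ i) (y ᵣ i) (y ᵢ i) (z ᵣ i) (z ᵢ i))

  *-comm : ∀ x y → x * y ≈ y * x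
  *-comm x y = pointwise₂
    (λ i → Identity.re-comm (x ᵣ i) (x ᵢ i) (y ᵣ i) (y ᵢ i))
    (λ i → Identity.im-comm (x ᵣ i) (x ᵢ i) (y ᵣ i) (y ᵢ i))

  *-identityˡ : ∀ x → 1# * x ≈ x
  *-identityˡ x = pointwise₂ (λ i → Identity.re-identity (x ᵣ i) (x ᵢ i)) (λ i → Identity.im-identity (x ᵣ i) (x ᵢ i))

  distribˡ : ∀ x y z → x * (y + z) ≈ x * y + x * z
  distribˡ x y z = pointwise₂
    (λ i → Identity.re-distrib (x ᵣ i) (x ᵢ i) (y ᵣ i) (y ᵢ i) (z ᵣ i) (z ᵢ i))
    (λ i → Identity.im-distrib (x ᵣ i) (x ᵢ i) (y ᵣ i) (y ᵢ i) (z ᵣ i) (z ᵢ i))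

  #-irrefl : ∀ {z w} → z ≈ w → ¬ (z # w)
  #-irrefl (p , q) (re# r) = Real.#-irrefl p r
  #-irrefl (p , q) (im# r) = Real.#-irrefl q r

  #-sym : ∀ {z w} → z # w → w # z
  #-sym (re# r) = re# (Real.#-sym r)
  #-sym (im# r) = im# (Real.#-sym r)

  #-cotrans : ∀ {z w} → z # w → ∀ v → z # v ⊎ v # w
  #-cotrans (re# r) v = Sum.map re# re# (Real.#-cotrans r (re v))
  #-cotrans (im# r) v = Sum.map im# im# (Real.#-cotrans r (im v))

  #-tight : ∀ z w → ¬ (z # w) → z ≈ w
  #-tight z w ¬# = Real.#-tight _ _ (¬# ∘ re#) , Real.#-tight _ _ (¬# ∘ im#)

  private
    norm-#0 : ∀ {z w} → z # w → let d = z + (- w) in re d ⊛ re d ⊕ im d ⊛ im d Real.# fromℚ 0ℚ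
    norm-#0 (re# r) = Real.square-#0 _ _ (Real.#⇒-#0 r)
    norm-#0 {z} {w} (im# r) = let d = z + (- w) in
      Real.#-congˡ (pointwise λ i → ℚ.+-comm (d ᵢ i ℚ.* d ᵢ i) (d ᵣ i ℚ.* d ᵣ i)) (Real.square-#0 (im d) (re d) (Real.#⇒-#0 r))

  #⇒invertible : ∀ {z w} → z # w → ∃[ v ] (v * (z + (- w)) ≈ 1# × (z + (- w)) * v ≈ 1#)
  #⇒invertible {z} {w} z#w with Real.#0⇒inverse _ (norm-#0 z#w)
  ... | n , q = v , ≈-trans (*-comm v d) d*v , d*v
    where
    d v : ℂ
    d = z + (- w)
    v = (re d ⊛ n) +i (⊖ (im d ⊛ n))
    d*v : d * v ≈ 1#
    d*v = Real.≈-trans (pointwise λ i → Identity.re-inverse (d ᵣ i) (d ᵢ i) (seq n i)) q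
        , pointwise (λ i → Identity.im-inverse (d ᵣ i) (d ᵢ i) (seq n i))

  invertible⇒# : ∀ {z w} → ∃[ v ] (v * (z + (- w)) ≈ 1# × (z + (- w)) * v ≈ 1#) → z # w
  invertible⇒# {z} {w} (v , _ , d*v)
    with Real.⊕-#0 (re d ⊛ re v) (⊖ (im d ⊛ im v)) (Real.#-congˡ (Real.≈-sym (re≈ d*v)) Real.1#0)
    where
    d : ℂ
    d = z + (- w)
  ... | inj₁ r = re# (Real.-#0⇒# (Real.⊛-#0 _ (re v) r))
  ... | inj₂ r = im# (Real.-#0⇒# (Real.⊛-#0 _ (⊖ im v) (Real.#-congˡ
          (pointwise λ i → ℚ.neg-distribʳ-* ((z + (- w)) ᵢ i) (v ᵢ i)) r)))

  commutativeRing : CommutativeRing 0ℓ 0ℓ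
  commutativeRing = record
    { Carrier = ℂ ; _≈_ = _≈_ ; _+_ = _+_ ; _*_ = _*_ ; -_ = -_ ; 0# = 0# ; 1# = 1#
    ; isCommutativeRing = record
      { isRing = record
        { +-isAbelianGroup = record
          { isGroup = record
            { isMonoid = record
              { isSemigroup = record
                { isMagma = record
                  { isEquivalence = record { refl = ≈-refl ; sym = ≈-sym ; trans = ≈-trans }
                  ; ∙-cong = +-cong }
                ; assoc = +-assoc }
              ; identity = +-identityˡ , λ x → ≈-trans (+-comm x 0#) (+-identityˡ x) }
            ; inverse = -‿inverseˡ , λ x → ≈-trans (+-comm x (- x)) (-‿inverseˡ x)
            ; ⁻¹-cong = -‿cong }
          ; comm = +-comm }
        ; *-cong = *-cong
        ; *-assoc = *-assoc
        ; *-identity = *-identityˡ , λ x → ≈-trans (*-comm x 1#) (*-identityˡ x)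
        ; distrib = distribˡ , λ x y z → ≈-trans (*-comm (y + z) x)
            (≈-trans (distribˡ x y z) (+-cong (*-comm x y) (*-comm x z)))
        }
      ; *-comm = *-comm } }

ℂ-field : HeytingField 0ℓ 0ℓ 0ℓ
ℂ-field = record
  { Carrier = ℂ ; _≈_ = _≈_ ; _#_ = _#_ ; _+_ = _+_ ; _*_ = _*_ ; -_ = -_ ; 0# = 0# ; 1# = 1#
  ; isHeytingField = record
    { isHeytingCommutativeRing = record
      { isCommutativeRing = CommutativeRing.isCommutativeRing commutativeRing
      ; isApartnessRelation = record { irrefl = #-irrefl ; sym = #-sym ; cotrans = #-cotrans }
      ; #⇒invertible = #⇒invertible
      ; invertible⇒# = invertible⇒# }
    ; tight = λ z w → #-tight z w , #-irrefl } }
  where open Complex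

-- The set {1, …, n} is Fin n, the element i being represented by i - 1.

-- The m-element subsets of {1, …, n}.
MSubset : ℕ → ℕ → Set
MSubset n m = Σ (Subset n) (λ σ → ∣ σ ∣ₛ ≡ m)

mSubsets : ∀ n m → List (MSubset n m)
mSubsets zero    zero    = ([] , refl) ∷ []
mSubsets zero    (suc m) = []
mSubsets (suc n) zero    = List.map (λ (σ , e) → outside ∷ σ , e) (mSubsets n zero)
mSubsets (suc n) (suc m) = List.map (λ (σ , e) → inside ∷ σ , cong suc e) (mSubsets n m)
                        ++ List.map (λ (σ , e) → outside ∷ σ , e) (mSubsets n (suc m))

mSubsets-complete : ∀ {n m} (σ : MSubset n m) → σ ∈ mSubsets n m
mSubsets-complete {zero}  {zero}  ([] , refl) = here refl
mSubsets-complete {suc n} {zero}  (outside ∷ σ , e) = ∈-map⁺ _ (mSubsets-complete (σ , e))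
mSubsets-complete {suc n} {suc m} (inside ∷ σ , refl) = ∈-++⁺ˡ (∈-map⁺ _ (mSubsets-complete (σ , refl)))
mSubsets-complete {suc n} {suc m} (outside ∷ σ , e) =
  ∈-++⁺ʳ (List.map _ (mSubsets n m)) (∈-map⁺ _ (mSubsets-complete (σ , e)))

mSubsets-unique : ∀ n m → Unique (mSubsets n m)
mSubsets-unique zero    zero    = [] ∷ []
mSubsets-unique zero    (suc m) = []
mSubsets-unique (suc n) zero    = Unique.map⁺ outside-injective (mSubsets-unique n zero)
  where
  outside-injective : ∀ {m} {σ τ : MSubset n m} →
    _≡_ {A = MSubset (suc n) m} (outside ∷ proj₁ σ , proj₂ σ) (outside ∷ proj₁ τ , proj₂ τ) → σ ≡ τ
  outside-injective refl = refl
mSubsets-unique (suc n) (suc m) = Unique.++⁺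
  (Unique.map⁺ inside-injective (mSubsets-unique n m))
  (Unique.map⁺ outside-injective (mSubsets-unique n (suc m)))
  disjoint
  where
  outside-injective : ∀ {m} {σ τ : MSubset n m} →
    _≡_ {A = MSubset (suc n) m} (outside ∷ proj₁ σ , proj₂ σ) (outside ∷ proj₁ τ , proj₂ τ) → σ ≡ τ
  outside-injective refl = refl
  inside-injective : ∀ {m} {σ τ : MSubset n m} →
    _≡_ {A = MSubset (suc n) (suc m)} (inside ∷ proj₁ σ , cong suc (proj₂ σ)) (inside ∷ proj₁ τ , cong suc (proj₂ τ)) → σ ≡ τ
  inside-injective {σ = σ , refl} {τ = τ , e} eq with cong (Vec.tail ∘ proj₁) eq
  ... | refl = cong (σ ,_) (ℕ.≡-irrelevant refl e)
  disjoint : ∀ {σ} → ¬ (σ ∈ List.map _ (mSubsets n m) × σ ∈ List.map _ (mSubsets n (suc m)))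
  disjoint (p , q) with ∈-map⁻ _ p | ∈-map⁻ _ q
  ... | _ , _ , refl | _ , _ , ()

private
  indicator : Bool → ℕ
  indicator true  = 1
  indicator false = 0

  module Sum-ℕ = Algebra.Properties.CommutativeMonoid.Sum ℕ.+-0-commutativeMonoid

  ∣∣-sum : ∀ {n} (σ : Subset n) → ∣ σ ∣ₛ ≡ Sum-ℕ.sum (indicator ∘ Vec.lookup σ)
  ∣∣-sum []            = refl
  ∣∣-sum (inside ∷ σ)  = cong suc (∣∣-sum σ)
  ∣∣-sum (outside ∷ σ) = ∣∣-sum σ

-- i ∈ g(σ) iff g⁻¹(i) ∈ σ.
image : ∀ {n m} → Permutation′ n → MSubset n m → MSubset n m
image {n} g (σ , ∣σ∣≡m) = gσ , trans (∣∣-sum gσ) (trans (Sum-ℕ.sum-cong-≗ {n} {indicator ∘ Vec.lookup gσ} {indicator ∘ f} λ i → cong indicator (lookup∘tabulate f i))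
    (trans (sym (Sum-ℕ.sum-permute (indicator ∘ Vec.lookup σ) (Perm.flip g))) (trans (sym (∣∣-sum σ)) ∣σ∣≡m)))
  where
  f : Fin n → Bool
  f i = Vec.lookup σ (g ⟨$⟩ˡ i)
  gσ : Subset n
  gσ = Vec.tabulate f

-- Ω = {n - m + 1, …, n}
Ω : ∀ {n m} → m ℕ.≤ n → MSubset n m
Ω {n} {m} m≤n = Vec.tabulate (λ i → (n ∸ m) ≤ᵇ toℕ i) , trans (size n (n ∸ m)) (ℕ.m∸[m∸n]≡n m≤n)
  where
  size : ∀ n d → ∣ Vec.tabulate {n = n} (λ i → d ≤ᵇ toℕ i) ∣ₛ ≡ n ∸ d
  size zero    d       = sym (ℕ.0∸n≡0 d)
  size (suc n) zero    = cong suc (size n zero)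
  size (suc n) (suc d) = trans (cong ∣_∣ₛ (tabulate-cong {n = n} λ i → suc-≤ᵇ d (toℕ i))) (size n d)
    where
    suc-≤ᵇ : ∀ d i → (suc d ≤ᵇ suc i) ≡ (d ≤ᵇ i)
    suc-≤ᵇ zero    i = refl
    suc-≤ᵇ (suc d) i = refl

permutations : ∀ n → List (Permutation′ n)
permutations zero    = Perm.id ∷ []
permutations (suc n) = List.concatMap (λ j → List.map (Perm.insert zero j) (permutations n)) (List.allFin (suc n))

permutations-complete : ∀ {n} (g : Permutation′ n) → Any (Perm._≈ g) (permutations n)
permutations-complete {zero}  g = here λ ()
permutations-complete {suc n} g = Any.concatMap⁺ _ (Any.map
  (λ where refl → Any.map⁺ (Any.map (λ {h} p i → trans (insert-cong h p i) (Perm.insert-remove zero g i)) (permutations-complete (Perm.remove zero g))))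
  (∈-allFin (g ⟨$⟩ʳ zero)))
  where
  insert-cong : ∀ h → h Perm.≈ Perm.remove zero g →
    Perm.insert zero (g ⟨$⟩ʳ zero) h Perm.≈ Perm.insert zero (g ⟨$⟩ʳ zero) (Perm.remove zero g)
  insert-cong h p zero    = refl
  insert-cong h p (suc i) = cong (Fin.punchIn (g ⟨$⟩ʳ zero)) (p i)

permutations-unique : ∀ n → AllPairs (λ g h → ¬ (g Perm.≈ h)) (permutations n)
permutations-unique zero    = [] ∷ []
permutations-unique (suc n) = AllPairs.concat⁺
  (All.map⁺ (All.tabulate λ {j} _ → AllPairs.map⁺ (AllPairs.map (λ {g} {h} g≉h e → g≉h (insert-injective j g h e)) (permutations-unique n))))
  (AllPairs.map⁺ (AllPairs.map (λ i≢j → All.map⁺ (All.tabulate λ _ → All.map⁺ (All.tabulate λ _ e → i≢j (e zero)))) (allFin-unique (suc n))))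
  where
  insert-injective : ∀ j g h → Perm.insert zero j g Perm.≈ Perm.insert zero j h → g Perm.≈ h
  insert-injective j g h e i = Fin.punchIn-injective j _ _ (e (suc i))
  allFin-unique : ∀ n → Unique (List.allFin n)
  allFin-unique n = Unique.tabulate⁺ λ e → e

inversions : ∀ {n} → Permutation′ n → ℕ
inversions {n} g = List.length (List.filter
  (λ (i , j) → (i Fin.<? j) ×-dec ((g ⟨$⟩ʳ j) Fin.<? (g ⟨$⟩ʳ i)))
  (List.cartesianProduct (List.allFin n) (List.allFin n)))

-- The tableau T_k of shape (n - k, k), as the 0-based row and column of each
-- entry: 1, …, n - k fill the first row and n - k + 1, …, n the second.
module Tableau (n k : ℕ) where

  row col : Fin n → ℕ
  row i = if toℕ i <ᵇ (n ∸ k) then 0 else 1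
  col i = if toℕ i <ᵇ (n ∸ k) then toℕ i else toℕ i ∸ (n ∸ k)

  -- A permutation preserves each row as a set iff it maps every entry to an
  -- entry of the same row; similarly for columns.
  PreservesRows PreservesColumns : Permutation′ n → Set
  PreservesRows    g = ∀ i → row (g ⟨$⟩ʳ i) ≡ row i
  PreservesColumns g = ∀ i → col (g ⟨$⟩ʳ i) ≡ col i

  preservesRows? : ∀ g → Dec (PreservesRows g)
  preservesRows? g = Fin.all? λ i → row (g ⟨$⟩ʳ i) ℕ.≟ row i

  preservesColumns? : ∀ g → Dec (PreservesColumns g)
  preservesColumns? g = Fin.all? λ i → col (g ⟨$⟩ʳ i) ℕ.≟ col i

  R C : List (Permutation′ n)
  R = List.filter preservesRows?    (permutations n)
  C = List.filter preservesColumns? (permutations n)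

module OverField {c ℓ₁ ℓ₂} (F : HeytingField c ℓ₁ ℓ₂) where

  open HeytingField F hiding (zero; refl; sym; trans)
  private
    rawSemiring = Semiring.rawSemiring (CommutativeRing.semiring (HeytingCommutativeRing.commutativeRing heytingCommutativeRing))
  open import Algebra.Definitions.RawSemiring rawSemiring using (_^_) renaming (_×_ to _×ₙ_)

  ∑ : ∀ {a} {A : Set a} → List A → (A → Carrier) → Carrier
  ∑ xs f = List.foldr (λ x s → f x + s) 0# xs

  -- Linear algebra on the space with basis I, where enum lists the elements
  -- of I without repetition.
  module LinearAlgebra {I : Set} (enum : List I) where

    infix  4 _≋_
    infixl 6 _+ᵛ_
    infixr 7 _•_ _·_

    V Matrix : Set c
    V      = I → Carrier
    Matrix = I → I → Carrier

    _≋_ : V → V → Set ℓ₁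
    v ≋ w = ∀ i → v i ≈ w i

    0ᵛ : V
    0ᵛ _ = 0#

    _+ᵛ_ : V → V → V
    (v +ᵛ w) i = v i + w i

    _•_ : Carrier → V → V
    (a • v) i = a * v i

    _·_ : Matrix → V → V
    (A · v) i = ∑ enum (λ j → A i j * v j)

    combination : ∀ {d} → (Fin d → Carrier) → (Fin d → V) → V
    combination {d} a v i = ∑ (List.allFin d) (λ j → a j * v j i)

    IsEigenvector : Matrix → Carrier → V → Set (ℓ₁ ⊔ ℓ₂)
    IsEigenvector A μ v = (∃[ i ] v i # 0#) × A · v ≋ μ • v

    HasDimension : ∀ {ℓ} → (V → Set ℓ) → ℕ → Set (c ⊔ ℓ₁ ⊔ ℓ)
    HasDimension W d = Σ (Fin d → V) λ v →
        (∀ j → W (v j))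
      × (∀ a → combination a v ≋ 0ᵛ → ∀ j → a j ≈ 0#)
      × (∀ w → W w → ∃[ a ] w ≋ combination a v)

    _-scalar_ : Matrix → Carrier → V → V
    (A -scalar μ) v = A · v +ᵛ (- μ) • v

    Eigenspace GeneralizedEigenspace : Matrix → Carrier → V → Set ℓ₁
    Eigenspace            A μ v = A · v ≋ μ • v
    GeneralizedEigenspace A μ v = ∃[ r ] fold v (A -scalar μ) r ≋ 0ᵛ

    -- The geometric and the algebraic multiplicity of μ are both d.
    HasMultiplicity : Matrix → Carrier → ℕ → Set (c ⊔ ℓ₁)
    HasMultiplicity A μ d = HasDimension (Eigenspace A μ) d × HasDimension (GeneralizedEigenspace A μ) d

  open LinearAlgebra public using (IsEigenvector; HasMultiplicity)

  -- Polynomials in r variables; the list p₀ ∷ p₁ ∷ … stands for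
  -- p₀ + x₀ p₁ + x₀² p₂ + …, the pᵢ being polynomials in the other variables.
  Polynomial : ℕ → Set c
  Polynomial zero    = Carrier
  Polynomial (suc r) = List (Polynomial r)

  eval : ∀ r → Polynomial r → (Fin r → Carrier) → Carrier
  eval zero    a  b = a
  eval (suc r) ps b = List.foldr (λ p s → eval r p (b ∘ suc) + b zero * s) 0# ps

  NonzeroPolynomial : ∀ r → Polynomial r → Set (c ⊔ ℓ₂)
  NonzeroPolynomial zero    a  = Lift c (a # 0#)
  NonzeroPolynomial (suc r) ps = Any (NonzeroPolynomial r) ps

  -- P holds outside the zero set of some nonzero polynomial.
  Generically : ∀ {ℓ} r → ((Fin r → Carrier) → Set ℓ) → Set (c ⊔ ℓ₂ ⊔ ℓ)
  Generically r P = Σ (Polynomial r) λ p → NonzeroPolynomial r p × (∀ b → eval r p b # 0# → P b)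

  -- Elements of the group ring as formal linear combinations of permutations.
  GroupRing : ℕ → Set c
  GroupRing n = List (Carrier × Permutation′ n)

  _⋆_ : ∀ {n} → GroupRing n → GroupRing n → GroupRing n
  x ⋆ y = List.cartesianProductWith (λ (a , q) (b , p) → a * b , p ∘ₚ q) x y

  sgn : ∀ {n} → Permutation′ n → Carrier
  sgn g = (- 1#) ^ inversions g

  youngSymmetrizer : ∀ n k → GroupRing n
  youngSymmetrizer n k = List.map (λ q → sgn q , q) C ⋆ List.map (λ p → 1# , p) R
    where open Tableau n k

  module _ (n m : ℕ) where

    open LinearAlgebra (mSubsets n m)

    e : MSubset n m → V
    e (σ , _) (τ , _) = if does (Vec.≡-dec Bool._≟_ σ τ) then 1# else 0#

    π : m ℕ.≤ n → GroupRing n → V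
    π m≤n = List.foldr (λ (a , g) v → a • e (image g (Ω m≤n)) +ᵛ v) 0ᵛ

    B : (Fin (suc m) → Carrier) → Matrix
    B b (σ , ∣σ∣≡m) (τ , _) = b (fromℕ< (s≤s (subst (∣ σ ∩ τ ∣ₛ ℕ.≤_) ∣σ∣≡m (∣p∩q∣≤∣p∣ σ τ))))

  eigenvalue : ∀ n {m k} → k ℕ.≤ m → (Fin (suc m) → Carrier) → Carrier
  eigenvalue n {m} {k} k≤m b =
    ∑ (List.allFin (suc k)) λ j → ∑ (List.allFin (suc (m ∸ k))) λ p →
      (- 1#) ^ (k ∸ toℕ j)
        * (((k choose toℕ j) ℕ.* ((m ∸ toℕ j) choose toℕ p) ℕ.* ((n ∸ m ∸ k ℕ.+ toℕ j) choose (m ∸ k ∸ toℕ p)))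
            ×ₙ b (fromℕ< (s≤s (j+p≤m j p))))
    where
    j+p≤m : (j : Fin (suc k)) (p : Fin (suc (m ∸ k))) → toℕ j ℕ.+ toℕ p ℕ.≤ m
    j+p≤m j p = subst (toℕ j ℕ.+ toℕ p ℕ.≤_) (ℕ.m+[n∸m]≡n k≤m) (ℕ.+-mono-≤ (toℕ≤pred[n] j) (toℕ≤pred[n] p))

m≤⌊n/2⌋⇒m≤n : ∀ {n m} → m ℕ.≤ ⌊ n /2⌋ → m ℕ.≤ n
m≤⌊n/2⌋⇒m≤n {n} m≤ = ℕ.≤-trans m≤ (ℕ.⌊n/2⌋≤n n)

open OverField ℂ-field public

{-# OPTIONS --safe #-}
-- Functions on m-subsets are obtained from functions f on k-subsets by
-- (Z f) σ = Σ_{κ ⊆ σ} f κ.  If f is harmonic, i.e. annihilated by the operator D that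
-- sums f over the sets obtained by adding one element, then a sum Σ_κ g(#(σ ∩ κ)) f κ
-- is a scalar depending on g times (Z f) σ.  Counting the m-sets containing κ brings
-- (B (Z f)) σ into this form, and the scalar is λ_k.  The vector π(c_k) is a nonzero multiple of Z f
-- for the harmonic function f = Σ_q sgn(q) e_{q(row 2)}: exchanging the two entries of a
-- column shows D f = 0, and at Ω only q = id contributes.
--
-- For the multiplicity, harmonic functions are built by adding the points of {1, …, n}
-- one at a time, one function for every two-row standard tableau; those of shape
-- (n - k, k) with k ≤ m give under Z a basis of eigenvectors, because each step is an
-- invertible 2 × 2 change of basis.  The eigenvalues λ_0, …, λ_m are separated by the
-- polynomial ∏_{j ≠ k} (λ_j - λ_k), which does not vanish when B is the adjacency matrix
-- of the Johnson graph, and counting tableaux gives f^{(n-k,k)}.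

module Submission where

open import Level using (Level; _⊔_; lift)
open import Algebra.Apartness.Bundles using (HeytingField; HeytingCommutativeRing)
open import Algebra.Bundles using (CommutativeRing)
import Algebra.Properties.CommutativeMonoid.Sum
import Algebra.Properties.Semiring.Sum
open import Data.Bool.Base using (Bool; true; false; if_then_else_; _∧_; _xor_; not)
import Data.Bool.Properties as Bool
open import Data.Empty using (⊥-elim)
open import Data.Fin.Base as Fin using (Fin; zero; suc; toℕ; fromℕ<)
open import Data.Fin.Permutation as Perm using (Permutation′; _⟨$⟩ʳ_; _⟨$⟩ˡ_; _∘ₚ_)
import Data.Fin.Permutation.Components as PC
import Data.Fin.Properties as Fin
open import Data.Fin.Properties using (toℕ≤pred[n]; toℕ-fromℕ<; toℕ<n; fromℕ<-cong)
open import Data.Fin.Subset using (Subset; inside; outside; _∩_; ∁; ∣_∣)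
open import Data.Fin.Subset.Properties using (∣p∩q∣≤∣p∣)
open import Data.List.Base as List using (List; []; _∷_; _++_; map; allFin)
import Data.List.Properties as List
open import Data.List.Membership.Propositional using (_∈_; find; lose)
open import Data.List.Membership.Propositional.Properties using (∈-filter⁺; ∈-filter⁻; ∈-lookup; ∈-allFin)
import Data.List.Relation.Unary.All as All
import Data.List.Relation.Unary.All.Properties as All
open import Data.List.Relation.Unary.AllPairs as AllPairs using (AllPairs; []; _∷_)
import Data.List.Relation.Unary.AllPairs.Properties as AllPairs
open import Data.List.Relation.Unary.Any using (Any; here; there)
open import Data.List.Relation.Unary.Unique.Propositional using (Unique)
import Data.List.Relation.Unary.Unique.Propositional.Properties as Unique
open import Data.Nat.Base as ℕ using (ℕ; zero; suc; _∸_; _≤_; _<_; _≤ᵇ_; _<ᵇ_; _≡ᵇ_; s≤s; z≤n; _!; ⌊_/2⌋)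
open import Data.Nat.Combinatorics using (nCk+nC[k+1]≡[n+1]C[k+1]; nCn≡1; nC1≡n; nCk≡nC[n∸k]; k>n⇒nCk≡0) renaming (_C_ to _choose_)
open import Data.Nat.GeneralisedArithmetic using (fold)
open import Data.Nat.ListAction using () renaming (sum to listSum)
import Data.Nat.Properties as ℕ
open import Data.Nat.Tactic.RingSolver using (solve-∀)
open import Data.Product.Base using (Σ; ∃-syntax; _×_; _,_; proj₁; proj₂)
open import Data.Rational.Base as ℚ using (0ℚ; 1ℚ)
import Data.Rational.Properties as ℚ
open import Data.Sum.Base using (_⊎_; inj₁; inj₂)
open import Data.Vec.Base as Vec using ([]; _∷_; lookup; tabulate; _[_]≔_)
import Data.Vec.Properties as Vec
open import Data.Vec.Properties using (lookup∘tabulate; tabulate-cong; tabulate∘lookup)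
open import Function.Base using (_∘_; id)
open import Function.Bundles using (mk⇔)
open import Relation.Binary.Definitions using (DecidableEquality; tri<; tri≈; tri>)
open import Relation.Binary.PropositionalEquality as ≡ using (_≡_; _≢_)
open import Relation.Nullary using (¬_; Dec; yes; no; does)
open import Relation.Nullary.Decidable using (dec-true; dec-false; does-⇔)
open import Relation.Unary using (Pred; Decidable)
open import Defs using (module OverField; module Tableau; MSubset; mSubsets; Ω; image; inversions; permutations; permutations-complete; permutations-unique)

-- Every space therefore gets an explicit basis, and both multiplicities are read off the same
-- eigenbasis. Apart from differences of eigenvalues, the scalars inverted are positive integers,
-- whence the assumption of characteristic zero. On functions on subsets D and U satisfy the sl2
-- relation DU - UD = n - 2#τ. A harmonic function of degree k is an extremal vector, and Z gives it
-- a copy on the sets of each size from k to n - k, vanishing at all other sizes. This range decides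
-- which walks contribute at size m. The sign and the first binomial coefficient of λ_k come from
-- one recursion. Let E_c be the sum of f over the κ with c points outside σ. Harmonicity gives (k -
-- c) E_c + (c + 1) E_(c+1) = 0, hence E_c = (-1)^c binom(k,c) (Z f) σ, and j = k - c indexes the
-- outer sum. The inner sum runs over the number p of further points in σ of an m-set containing
-- such a κ.

-- Binomial coefficients and cardinalities of intersections.

nC0≡1 : ∀ n → n choose 0 ≡ 1
nC0≡1 n = ≡.trans (nCk≡nC[n∸k] {0} {n} z≤n) (nCn≡1 n)

-- Induction on k with Pascal's rule. The identity solves the recursion `E-step`; truncated
-- subtraction keeps it true for c ≥ k, where both sides are 0.
absorption : ∀ k c → suc c ℕ.* (k choose suc c) ≡ (k ∸ c) ℕ.* (k choose c)
absorption zero c = ≡.trans (≡.cong (suc c ℕ.*_) (k>n⇒nCk≡0 {0} {suc c} (s≤s z≤n))) (≡.trans (ℕ.*-zeroʳ (suc c)) (≡.cong (ℕ._* (0 choose c)) (≡.sym (ℕ.0∸n≡0 c))))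
absorption (suc k) zero = ≡.trans (ℕ.*-identityˡ (suc k choose 1)) (≡.trans (nC1≡n (suc k)) (≡.sym (≡.trans (≡.cong (suc k ℕ.*_) (nC0≡1 (suc k))) (ℕ.*-identityʳ (suc k)))))
absorption (suc k) (suc c) = begin
  suc (suc c) ℕ.* (suc k choose suc (suc c))
    ≡⟨ ≡.cong (suc (suc c) ℕ.*_) (nCk+nC[k+1]≡[n+1]C[k+1] k (suc c)) ⟨
  suc (suc c) ℕ.* (y ℕ.+ z)
    ≡⟨ ℕ.*-distribˡ-+ (suc (suc c)) y z ⟩
  suc (suc c) ℕ.* y ℕ.+ suc (suc c) ℕ.* z
    ≡⟨ ≡.cong (suc (suc c) ℕ.* y ℕ.+_) (absorption k (suc c)) ⟩
  suc (suc c) ℕ.* y ℕ.+ (k ∸ suc c) ℕ.* y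
    ≡⟨ shift (suc c ℕ.≤? k) ⟩
  (k ∸ c) ℕ.* y ℕ.+ suc c ℕ.* y
    ≡⟨ ≡.cong ((k ∸ c) ℕ.* y ℕ.+_) (absorption k c) ⟩
  (k ∸ c) ℕ.* y ℕ.+ (k ∸ c) ℕ.* x
    ≡⟨ ≡.trans (≡.sym (ℕ.*-distribˡ-+ (k ∸ c) y x)) (≡.cong ((k ∸ c) ℕ.*_) (≡.trans (ℕ.+-comm y x) (nCk+nC[k+1]≡[n+1]C[k+1] k c))) ⟩
  (k ∸ c) ℕ.* (suc k choose suc c) ∎
  where
  open ≡.≡-Reasoning
  x = k choose c
  y = k choose suc c
  z = k choose suc (suc c)
  identity : ∀ c d y → suc (suc c) ℕ.* y ℕ.+ d ℕ.* y ≡ suc d ℕ.* y ℕ.+ suc c ℕ.* y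
  identity = solve-∀
  shift : Dec (suc c ≤ k) → suc (suc c) ℕ.* y ℕ.+ (k ∸ suc c) ℕ.* y ≡ (k ∸ c) ℕ.* y ℕ.+ suc c ℕ.* y
  shift (yes c<k) = ≡.trans (identity c (k ∸ suc c) y) (≡.cong (λ t → t ℕ.* y ℕ.+ suc c ℕ.* y) (≡.sym (ℕ.+-∸-assoc 1 c<k)))
  shift (no c≮k) rewrite k>n⇒nCk≡0 {k} {suc c} (ℕ.≰⇒> c≮k) =
    ≡.trans (≡.cong₂ ℕ._+_ (ℕ.*-zeroʳ (suc (suc c))) (ℕ.*-zeroʳ (k ∸ suc c))) (≡.sym (≡.cong₂ ℕ._+_ (ℕ.*-zeroʳ (k ∸ c)) (ℕ.*-zeroʳ (suc c))))

≡ᵇ-refl : ∀ x → (x ≡ᵇ x) ≡ true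
≡ᵇ-refl zero    = ≡.refl
≡ᵇ-refl (suc x) = ≡ᵇ-refl x

≢⇒≡ᵇ-false : ∀ {x y} → x ≢ y → (x ≡ᵇ y) ≡ false
≢⇒≡ᵇ-false {zero}  {zero}  p = ⊥-elim (p ≡.refl)
≢⇒≡ᵇ-false {zero}  {suc y} p = ≡.refl
≢⇒≡ᵇ-false {suc x} {zero}  p = ≡.refl
≢⇒≡ᵇ-false {suc x} {suc y} p = ≢⇒≡ᵇ-false (p ∘ ≡.cong suc)

∣∩∣+∣∁∩∣ : ∀ {n} (σ κ : Subset n) → ∣ σ ∩ κ ∣ ℕ.+ ∣ ∁ σ ∩ κ ∣ ≡ ∣ κ ∣
∣∩∣+∣∁∩∣ []            []            = ≡.refl
∣∩∣+∣∁∩∣ (inside  ∷ σ) (inside  ∷ κ) = ≡.cong suc (∣∩∣+∣∁∩∣ σ κ)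
∣∩∣+∣∁∩∣ (inside  ∷ σ) (outside ∷ κ) = ∣∩∣+∣∁∩∣ σ κ
∣∩∣+∣∁∩∣ (outside ∷ σ) (inside  ∷ κ) = ≡.trans (ℕ.+-suc _ _) (≡.cong suc (∣∩∣+∣∁∩∣ σ κ))
∣∩∣+∣∁∩∣ (outside ∷ σ) (outside ∷ κ) = ∣∩∣+∣∁∩∣ σ κ

∣∩∁∣+∣∩∣ : ∀ {n} (σ κ : Subset n) → ∣ σ ∩ ∁ κ ∣ ℕ.+ ∣ σ ∩ κ ∣ ≡ ∣ σ ∣
∣∩∁∣+∣∩∣ []            []            = ≡.refl
∣∩∁∣+∣∩∣ (inside  ∷ σ) (inside  ∷ κ) = ≡.trans (ℕ.+-suc _ _) (≡.cong suc (∣∩∁∣+∣∩∣ σ κ))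
∣∩∁∣+∣∩∣ (inside  ∷ σ) (outside ∷ κ) = ≡.cong suc (∣∩∁∣+∣∩∣ σ κ)
∣∩∁∣+∣∩∣ (outside ∷ σ) (_       ∷ κ) = ∣∩∁∣+∣∩∣ σ κ

∣∁∣+∣∣ : ∀ {n} (σ : Subset n) → ∣ ∁ σ ∣ ℕ.+ ∣ σ ∣ ≡ n
∣∁∣+∣∣ []            = ≡.refl
∣∁∣+∣∣ (inside  ∷ σ) = ≡.trans (ℕ.+-suc _ _) (≡.cong suc (∣∁∣+∣∣ σ))
∣∁∣+∣∣ (outside ∷ σ) = ≡.cong suc (∣∁∣+∣∣ σ)

-- Two-row standard tableaux and their number.

-- The standard Young tableaux of shape (k + d, k): the entry i lies in the second
-- row iff the i-th step is down.
data Path : ℕ → ℕ → ℕ → Set where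
  start : Path 0 0 0
  up    : ∀ {n k d} → Path n k d → Path (suc n) k (suc d)
  down  : ∀ {n k d} → Path n k (suc d) → Path (suc n) (suc k) d

path-size : ∀ {n k d} → Path n k d → n ≡ k ℕ.+ k ℕ.+ d
path-size start = ≡.refl
path-size {k = k} {suc d} (up P) = ≡.trans (≡.cong suc (path-size P)) (≡.sym (ℕ.+-suc (k ℕ.+ k) d))
path-size {k = suc k} {d} (down P) = ≡.cong suc (≡.trans (path-size P) (identity k d))
  where
  identity : ∀ k d → k ℕ.+ k ℕ.+ suc d ≡ k ℕ.+ suc k ℕ.+ d
  identity = solve-∀

Walk : ℕ → Set
Walk n = Σ ℕ λ k → Σ ℕ λ d → Path n k d

children : ∀ {n} → Walk n → List (Walk (suc n))
children (k , zero  , P) = (k , 1 , up P) ∷ []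
children (k , suc d , P) = (k , suc (suc d) , up P) ∷ (suc k , d , down P) ∷ []

walks : ∀ n → List (Walk n)
walks zero    = (0 , 0 , start) ∷ []
walks (suc n) = List.concatMap children (walks n)

_≟ʷ_ : ∀ {n} → DecidableEquality (Walk n)
(_ , _ , start) ≟ʷ (_ , _ , start) = yes ≡.refl
(k , suc d , up P) ≟ʷ (l , suc e , up Q) with (k , d , P) ≟ʷ (l , e , Q)
... | yes ≡.refl = yes ≡.refl
... | no ¬p      = no λ where ≡.refl → ¬p ≡.refl
(_ , _ , up P) ≟ʷ (_ , _ , down Q) = no λ ()
(_ , _ , down P) ≟ʷ (_ , _ , up Q) = no λ ()
(suc k , d , down P) ≟ʷ (suc l , e , down Q) with (k , suc d , P) ≟ʷ (l , suc e , Q)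
... | yes ≡.refl = yes ≡.refl
... | no ¬p      = no λ where ≡.refl → ¬p ≡.refl

parent : ∀ {n} → Walk (suc n) → Walk n
parent (_ , _ , up P)   = _ , _ , P
parent (_ , _ , down P) = _ , _ , P

parent-children : ∀ {n} (w : Walk n) → All.All (λ w′ → parent w′ ≡ w) (children w)
parent-children (k , zero  , P) = ≡.refl All.∷ All.[]
parent-children (k , suc d , P) = ≡.refl All.∷ ≡.refl All.∷ All.[]

-- Different walks have disjoint lists of children, since `parent` recovers a walk from any of its
-- children.
walks-unique : ∀ n → Unique (walks n)
walks-unique zero    = All.[] ∷ []
walks-unique (suc n) = AllPairs.concat⁺
  (All.map⁺ (All.universal children-unique (walks n)))
  (AllPairs.map⁺ (AllPairs.map (λ {w} {w′} w≢w′ → All.map (λ p → All.map (λ q e → w≢w′ (≡.trans (≡.sym p) (≡.trans (≡.cong parent e) q))) (parent-children w′)) (parent-children w)) (walks-unique n)))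
  where
  children-unique : ∀ {n} (w : Walk n) → Unique (children w)
  children-unique (k , zero  , P) = All.[] ∷ []
  children-unique (k , suc d , P) = ((λ ()) All.∷ All.[]) ∷ All.[] ∷ []

module Tallies where

  open ≡ using (refl; sym; trans; cong; cong₂; subst)
  open import Data.Nat.Base using (_+_; _*_)

  tally : ∀ {n} → ℕ → List (Walk n) → ℕ
  tally k ws = List.length (List.filter (λ w → proj₁ w ℕ.≟ k) ws)

  tally-++ : ∀ {n} k (ws ws′ : List (Walk n)) → tally k (ws ++ ws′) ≡ tally k ws + tally k ws′
  tally-++ k ws ws′ = trans (cong List.length (List.filter-++ _ ws ws′)) (List.length-++ (List.filter _ ws))

  tally-yes : ∀ {n} {k} (w : Walk n) ws → proj₁ w ≡ k → tally k (w ∷ ws) ≡ suc (tally k ws)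
  tally-yes {k = k} w ws e = cong List.length (List.filter-accept (λ w → proj₁ w ℕ.≟ k) {x = w} {xs = ws} e)

  tally-no : ∀ {n} {k} (w : Walk n) ws → proj₁ w ≢ k → tally k (w ∷ ws) ≡ tally k ws
  tally-no {k = k} w ws e = cong List.length (List.filter-reject (λ w → proj₁ w ℕ.≟ k) {x = w} {xs = ws} e)

  tally-singleton : ∀ {n n′} k (w : Walk n) (w′ : Walk n′) → proj₁ w ≡ proj₁ w′ → tally k (w ∷ []) ≡ tally k (w′ ∷ [])
  tally-singleton k w w′ e with proj₁ w′ ℕ.≟ k
  ... | yes p = trans (tally-yes w [] (trans e p)) (sym (tally-yes w′ [] p))
  ... | no ¬p = trans (tally-no w [] (λ q → ¬p (trans (sym e) q))) (sym (tally-no w′ [] ¬p))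

  tally-zero : ∀ {n} (ws : List (Walk n)) → tally 0 (List.concatMap children ws) ≡ tally 0 ws
  tally-zero []       = refl
  tally-zero (w ∷ ws) = trans (tally-++ 0 (children w) _) (trans (cong₂ _+_ (go w) (tally-zero ws)) (sym (tally-++ 0 (w ∷ []) ws)))
    where
    go : ∀ w → tally 0 (children w) ≡ tally 0 (w ∷ [])
    go (k , zero  , P) = tally-singleton 0 (k , 1 , up P) _ refl
    go (k , suc d , P) = trans (tally-++ 0 ((k , _ , up P) ∷ []) _) (trans (cong₂ _+_ (tally-singleton 0 (k , _ , up P) (k , suc d , P) refl) (tally-no {k = 0} (suc k , d , down P) [] λ ())) (ℕ.+-identityʳ _))

  -- The branching rule: the last step is up or down. The assumption n > 2k puts the walks with k
  -- down steps at positive height, so that each of them has a down child.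
  tally-suc : ∀ {n k d} → n ≡ k + k + suc d → (ws : List (Walk n)) → tally (suc k) (List.concatMap children ws) ≡ tally (suc k) ws + tally k ws
  tally-suc e [] = refl
  tally-suc {n} {k} {d} e (w ∷ ws) = begin
    tally (suc k) (children w ++ List.concatMap children ws)                        ≡⟨ tally-++ (suc k) (children w) _ ⟩
    tally (suc k) (children w) + tally (suc k) (List.concatMap children ws)         ≡⟨ cong₂ _+_ (go w) (tally-suc e ws) ⟩
    (tally (suc k) (w ∷ []) + tally k (w ∷ [])) + (tally (suc k) ws + tally k ws)   ≡⟨ interchange (tally (suc k) (w ∷ [])) _ _ _ ⟩
    (tally (suc k) (w ∷ []) + tally (suc k) ws) + (tally k (w ∷ []) + tally k ws)   ≡⟨ cong₂ _+_ (tally-++ (suc k) (w ∷ []) ws) (tally-++ k (w ∷ []) ws) ⟨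
    tally (suc k) (w ∷ ws) + tally k (w ∷ ws)                                       ∎
    where
    open ≡.≡-Reasoning
    interchange : ∀ a b c d → (a + b) + (c + d) ≡ (a + c) + (b + d)
    interchange = solve-∀
    go : ∀ w → tally (suc k) (children w) ≡ tally (suc k) (w ∷ []) + tally k (w ∷ [])
    go (l , zero , P) = trans (tally-singleton (suc k) (l , 1 , up P) (l , 0 , P) refl) (sym (trans (cong (tally (suc k) ((l , 0 , P) ∷ []) +_) (tally-no (l , 0 , P) [] l≢k)) (ℕ.+-identityʳ _)))
      where
      l≢k : l ≢ k
      l≢k refl = ℕ.m≢1+m+n (k + k) (trans (sym (trans (path-size P) (ℕ.+-identityʳ _))) (trans e (ℕ.+-suc (k + k) d)))
    go (l , suc d′ , P) = trans (tally-++ (suc k) ((l , _ , up P) ∷ []) _) (cong₂ _+_ (tally-singleton (suc k) (l , _ , up P) (l , suc d′ , P) refl) shift)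
      where
      shift : tally (suc k) ((suc l , d′ , down P) ∷ []) ≡ tally k ((l , suc d′ , P) ∷ [])
      shift with l ℕ.≟ k
      ... | yes p = trans (tally-yes (suc l , d′ , down P) [] (cong suc p)) (sym (tally-yes (l , suc d′ , P) [] p))
      ... | no ¬p = trans (tally-no (suc l , d′ , down P) [] (λ q → ¬p (ℕ.suc-injective q))) (sym (tally-no (l , suc d′ , P) [] ¬p))

  tally-empty : ∀ {n k} → n < k + k → (ws : List (Walk n)) → tally k ws ≡ 0
  tally-empty l [] = refl
  tally-empty {n} {k} l (w@(κ , d , P) ∷ ws) = trans (tally-no w ws λ where refl → ℕ.<-irrefl refl (ℕ.≤-<-trans (subst (κ + κ ≤_) (sym (path-size P)) (ℕ.m≤m+n _ d)) l)) (tally-empty l ws)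

  -- Induction on n by the branching rule, with d = n - 2k the difference of the row lengths, so
  -- that (k + d + 1)! is (n - k + 1)!. The quotient is cross-multiplied to stay in the natural
  -- numbers; for k = 0 and for d = 0 there is only one predecessor shape.
  hook-formula : ∀ n k d → n ≡ k + k + d → tally k (walks n) * (k ! * (k + d + 1) !) ≡ n ! * (d + 1)
  hook-formula zero zero zero refl = refl
  hook-formula (suc n) zero (suc d) e with ℕ.suc-injective e
  ... | refl = begin
    tally 0 (walks (suc n)) * (1 * (suc n + 1) !)  ≡⟨ cong₂ (λ s t → s * (1 * t !)) (tally-zero (walks n)) (ℕ.+-comm (suc n) 1) ⟩
    c * (1 * (suc (suc n) * (suc n) !))            ≡⟨ pull c (suc (suc n)) ((suc n) !) ⟩
    suc (suc n) * (c * (1 * (suc n) !))            ≡⟨ cong (suc (suc n) *_) (trans (cong (λ t → c * (1 * t !)) (ℕ.+-comm 1 n)) (hook-formula n zero n refl)) ⟩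
    suc (suc n) * (n ! * (n + 1))                  ≡⟨ finish n (n !) ⟩
    (suc n) ! * (suc n + 1)                        ∎
    where
    open ≡.≡-Reasoning
    c = tally 0 (walks n)
    pull : ∀ c x y → c * (1 * (x * y)) ≡ x * (c * (1 * y))
    pull = solve-∀
    finish : ∀ n x → suc (suc n) * (x * (n + 1)) ≡ (suc n * x) * (suc n + 1)
    finish = solve-∀
  -- The last step must be down: n = 2k + 1 leaves no room for k + 1 down steps.
  hook-formula (suc n) (suc k) zero e = begin
    tally (suc k) (walks (suc n)) * ((suc k) ! * (suc k + 0 + 1) !)   ≡⟨ cong (_* ((suc k) ! * (suc k + 0 + 1) !)) (trans (tally-suc n≡ (walks n)) (cong (_+ c) (tally-empty (ℕ.≤-reflexive (trans (cong suc n≡) (bound k))) (walks n)))) ⟩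
    c * ((suc k * k !) * (suc k + 0 + 1) !)                           ≡⟨ pull c (suc k) (k !) _ ⟩
    suc k * (c * (k ! * (suc k + 0 + 1) !))                           ≡⟨ cong (λ t → suc k * (c * (k ! * t !))) (index k) ⟩
    suc k * (c * (k ! * (k + 1 + 1) !))                               ≡⟨ cong (suc k *_) (hook-formula n k 1 n≡) ⟩
    suc k * (n ! * 2)                                                 ≡⟨ finish k (n !) ⟩
    (suc k + suc k + 0) * n ! * 1                                     ≡⟨ cong (λ t → t * n ! * 1) (sym e) ⟩
    (suc n) ! * (0 + 1)                                               ∎
    where
    open ≡.≡-Reasoning
    c = tally k (walks n)
    n≡ : n ≡ k + k + 1
    n≡ = ℕ.suc-injective (trans e (eq k))
      where
      eq : ∀ k → suc k + suc k + 0 ≡ suc (k + k + 1)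
      eq = solve-∀
    bound : ∀ k → suc (k + k + 1) ≡ suc k + suc k
    bound = solve-∀
    pull : ∀ c x y z → c * ((x * y) * z) ≡ x * (c * (y * z))
    pull = solve-∀
    index : ∀ k → suc k + 0 + 1 ≡ k + 1 + 1
    index = solve-∀
    finish : ∀ k x → suc k * (x * 2) ≡ (suc k + suc k + 0) * x * 1
    finish = solve-∀
  hook-formula (suc n) (suc k) (suc d) e = begin
    tally (suc k) (walks (suc n)) * ((suc k) ! * (suc k + suc d + 1) !)  ≡⟨ cong₂ _*_ (tally-suc n≡′ (walks n)) (cong (λ t → (suc k) ! * t !) (index k d)) ⟩
    (a + b) * ((suc k * K) * (suc (k + d + 2) * Q))                      ≡⟨ expand a b (suc k) K (suc (k + d + 2)) Q ⟩
    suc (k + d + 2) * (a * ((suc k * K) * Q)) + suc k * (b * (K * (suc (k + d + 2) * Q)))  ≡⟨ cong₂ (λ s t → suc (k + d + 2) * s + suc k * t) ih-a ih-b ⟩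
    suc (k + d + 2) * (N * (d + 1)) + suc k * (N * (suc (suc d) + 1))    ≡⟨ finish k d N ⟩
    (suc k + suc k + suc d) * N * (suc d + 1)                            ≡⟨ cong (λ t → t * N * (suc d + 1)) (sym e) ⟩
    (suc n) ! * (suc d + 1)                                              ∎
    where
    open ≡.≡-Reasoning
    a = tally (suc k) (walks n)
    b = tally k (walks n)
    K = k !
    Q = (k + d + 2) !
    N = n !
    n≡ : n ≡ suc k + suc k + d
    n≡ = ℕ.suc-injective (trans e (eq k d))
      where
      eq : ∀ k d → suc k + suc k + suc d ≡ suc (suc k + suc k + d)
      eq = solve-∀
    n≡′ : n ≡ k + k + suc (suc d)
    n≡′ = trans n≡ (eq k d)
      where
      eq : ∀ k d → suc k + suc k + d ≡ k + k + suc (suc d)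
      eq = solve-∀
    index : ∀ k d → suc k + suc d + 1 ≡ suc (k + d + 2)
    index = solve-∀
    expand : ∀ a b x K y Q → (a + b) * ((x * K) * (y * Q)) ≡ y * (a * ((x * K) * Q)) + x * (b * (K * (y * Q)))
    expand = solve-∀
    ih-a : a * ((suc k * K) * Q) ≡ N * (d + 1)
    ih-a = trans (cong (λ t → a * ((suc k * K) * t !)) (eq k d)) (hook-formula n (suc k) d n≡)
      where
      eq : ∀ k d → k + d + 2 ≡ suc k + d + 1
      eq = solve-∀
    ih-b : b * (K * (suc (k + d + 2) * Q)) ≡ N * (suc (suc d) + 1)
    ih-b = trans (cong (λ t → b * (K * t !)) (eq k d)) (hook-formula n k (suc (suc d)) n≡′)
      where
      eq : ∀ k d → suc (k + d + 2) ≡ k + suc (suc d) + 1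
      eq = solve-∀
    finish : ∀ k d N → suc (k + d + 2) * (N * (d + 1)) + suc k * (N * (suc (suc d) + 1)) ≡ (suc k + suc k + suc d) * N * (suc d + 1)
    finish = solve-∀

  walks-count : ∀ n k → k + k ≤ n → tally k (walks n) * (k ! * (n ∸ k + 1) !) ≡ n ! * (n ∸ 2 * k + 1)
  walks-count n k 2k≤n = trans (cong (λ t → tally k (walks n) * (k ! * (t + 1) !)) n∸k≡) (trans (hook-formula n k d n≡) (cong (λ t → n ! * (t + 1)) d≡))
    where
    d = n ∸ (k + k)
    n≡ : n ≡ k + k + d
    n≡ = sym (ℕ.m+[n∸m]≡n 2k≤n)
    n∸k≡ : n ∸ k ≡ k + d
    n∸k≡ = trans (cong (_∸ k) (trans n≡ (ℕ.+-assoc k k d))) (ℕ.m+n∸m≡n k (k + d))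
    d≡ : d ≡ n ∸ 2 * k
    d≡ = cong (n ∸_) (cong (k +_) (sym (ℕ.+-identityʳ k)))

-- Parity of permutations and their action on subsets.

module Permutations where

  open ≡ using (refl; sym; trans; cong; cong₂; subst)
  open import Data.Nat.Base using (_+_; _*_)
  open Algebra.Properties.Semiring.Sum ℕ.+-*-semiring using (sum; sum-cong-≗; ∑-distrib-+; ∑-comm; sum-permute; *-distribˡ-sum; sum-replicate-zero)

  𝟙 : Bool → ℕ
  𝟙 true  = 1
  𝟙 false = 0

  sum₂ : ∀ {n} → (Fin n → Fin n → ℕ) → ℕ
  sum₂ f = sum (λ i → sum (f i))

  sum₂-cong : ∀ {n} {f g : Fin n → Fin n → ℕ} → (∀ i j → f i j ≡ g i j) → sum₂ f ≡ sum₂ g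
  sum₂-cong {n} e = sum-cong-≗ {n} λ i → sum-cong-≗ {n} (e i)

  sum₂-+ : ∀ {n} (f g : Fin n → Fin n → ℕ) → sum₂ (λ i j → f i j + g i j) ≡ sum₂ f + sum₂ g
  sum₂-+ {n} f g = trans (sum-cong-≗ {n} λ i → ∑-distrib-+ (f i) (g i)) (∑-distrib-+ (sum ∘ f) (sum ∘ g))

  sum₂-permute : ∀ {n} (f : Fin n → Fin n → ℕ) (p : Permutation′ n) → sum₂ f ≡ sum₂ (λ i j → f (p ⟨$⟩ʳ i) (p ⟨$⟩ʳ j))
  sum₂-permute {n} f p = trans (sum-permute (sum ∘ f) p) (sum-cong-≗ {n} λ i → sum-permute (f (p ⟨$⟩ʳ i)) p)

  sum₂-swap : ∀ {n} (f : Fin n → Fin n → ℕ) → sum₂ f ≡ sum₂ (λ i j → f j i)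
  sum₂-swap f = ∑-comm f

  length-filter-cartesianProduct : ∀ {a b p} {A : Set a} {B : Set b} {P : Pred (A × B) p} (P? : Decidable P) xs ys →
    List.length (List.filter P? (List.cartesianProduct xs ys)) ≡ listSum (List.map (λ x → listSum (List.map (λ y → 𝟙 (does (P? (x , y)))) ys)) xs)
  length-filter-cartesianProduct P? []       ys = refl
  length-filter-cartesianProduct P? (x ∷ xs) ys = trans (cong List.length (List.filter-++ P? (List.map (x ,_) ys) _))
    (trans (List.length-++ (List.filter P? (List.map (x ,_) ys))) (cong₂ _+_ (row ys) (length-filter-cartesianProduct P? xs ys)))
    where
    row : ∀ ys → List.length (List.filter P? (List.map (x ,_) ys)) ≡ listSum (List.map (λ y → 𝟙 (does (P? (x , y)))) ys)
    row [] = refl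
    row (y ∷ ys) with does (P? (x , y))
    ... | true  = cong suc (row ys)
    ... | false = row ys

  sum-allFin : ∀ n (f : Fin n → ℕ) → listSum (List.map f (allFin n)) ≡ sum f
  sum-allFin n f = trans (cong listSum (List.map-tabulate id f)) (go n f)
    where
    go : ∀ n (f : Fin n → ℕ) → listSum (List.tabulate f) ≡ sum f
    go zero    f = refl
    go (suc n) f = cong (f zero +_) (go n (f ∘ suc))

  _<?ᵇ_ : ∀ {n} → Fin n → Fin n → Bool
  i <?ᵇ j = does (i Fin.<? j)

  <?ᵇ-true : ∀ {n} {i j : Fin n} → i Fin.< j → (i <?ᵇ j) ≡ true
  <?ᵇ-true {i = i} {j} = dec-true (i Fin.<? j)

  <?ᵇ-false : ∀ {n} {i j : Fin n} → ¬ (i Fin.< j) → (i <?ᵇ j) ≡ false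
  <?ᵇ-false {i = i} {j} = dec-false (i Fin.<? j)

  inversions-sum : ∀ {n} (g : Permutation′ n) → inversions g ≡ sum₂ (λ i j → 𝟙 ((i <?ᵇ j) ∧ ((g ⟨$⟩ʳ j) <?ᵇ (g ⟨$⟩ʳ i))))
  inversions-sum {n} g = trans (length-filter-cartesianProduct _ (allFin n) (allFin n))
    (trans (sum-allFin n _) (sum-cong-≗ {n} λ i → sum-allFin n _))

  -- Unlike the inversion indicator, this is symmetric in i and j and additive modulo 2 under
  -- composition; the price is that every inversion is counted twice.
  flips : ∀ {n} → Permutation′ n → Fin n → Fin n → Bool
  flips g i j = (i <?ᵇ j) xor ((g ⟨$⟩ʳ i) <?ᵇ (g ⟨$⟩ʳ j))

  perm-injective : ∀ {n} (g : Permutation′ n) {i j} → g ⟨$⟩ʳ i ≡ g ⟨$⟩ʳ j → i ≡ j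
  perm-injective g {i} {j} e = trans (sym (Perm.inverseˡ g)) (trans (cong (g ⟨$⟩ˡ_) e) (Perm.inverseˡ g))

  <?ᵇ-irrefl : ∀ {n} (i : Fin n) → (i <?ᵇ i) ≡ false
  <?ᵇ-irrefl i = <?ᵇ-false {i = i} {i} (ℕ.<-irrefl refl)

  <?ᵇ-flip : ∀ {n} {i j : Fin n} → i ≢ j → (j <?ᵇ i) ≡ not (i <?ᵇ j)
  <?ᵇ-flip {i = i} {j} i≢j with Fin.<-cmp i j
  ... | tri< l _ ¬r rewrite <?ᵇ-true l = <?ᵇ-false ¬r
  ... | tri≈ _ e _  = ⊥-elim (i≢j e)
  ... | tri> ¬l _ r rewrite <?ᵇ-false ¬l = <?ᵇ-true r

  flips-diagonal : ∀ {n} (g : Permutation′ n) i → flips g i i ≡ false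
  flips-diagonal g i rewrite <?ᵇ-irrefl i | <?ᵇ-irrefl (g ⟨$⟩ʳ i) = refl

  flips-sym : ∀ {n} (g : Permutation′ n) i j → flips g i j ≡ flips g j i
  flips-sym g i j with i Fin.≟ j
  ... | yes refl = refl
  ... | no i≢j rewrite <?ᵇ-flip i≢j | <?ᵇ-flip (i≢j ∘ perm-injective g) = xor-not (i <?ᵇ j) ((g ⟨$⟩ʳ i) <?ᵇ (g ⟨$⟩ʳ j))
    where
    xor-not : ∀ a b → (a xor b) ≡ (not a xor not b)
    xor-not true  true  = refl
    xor-not true  false = refl
    xor-not false true  = refl
    xor-not false false = refl

  flips-inversions : ∀ {n} (g : Permutation′ n) → sum₂ (λ i j → 𝟙 (flips g i j)) ≡ inversions g + inversions g
  flips-inversions {n} g = trans (sum₂-cong split) (trans (sum₂-+ inverted (λ i j → inverted j i))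
    (cong₂ _+_ (sym (inversions-sum g)) (trans (sum₂-swap (λ i j → inverted j i)) (sym (inversions-sum g)))))
    where
    inverted : Fin n → Fin n → ℕ
    inverted i j = 𝟙 ((i <?ᵇ j) ∧ ((g ⟨$⟩ʳ j) <?ᵇ (g ⟨$⟩ʳ i)))
    cases : ∀ a b → 𝟙 (a xor b) ≡ 𝟙 (a ∧ not b) + 𝟙 (not a ∧ b)
    cases true  true  = refl
    cases true  false = refl
    cases false true  = refl
    cases false false = refl
    split : ∀ i j → 𝟙 (flips g i j) ≡ inverted i j + inverted j i
    split i j with i Fin.≟ j
    ... | yes refl rewrite <?ᵇ-irrefl i | <?ᵇ-irrefl (g ⟨$⟩ʳ i) = refl
    ... | no i≢j rewrite <?ᵇ-flip i≢j | <?ᵇ-flip (i≢j ∘ perm-injective g) = cases (i <?ᵇ j) ((g ⟨$⟩ʳ i) <?ᵇ (g ⟨$⟩ʳ j))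

  -- The entries at (i , j) and (j , i) pair up, so M is the sum over i < j.
  even-sum : ∀ {n} (f : Fin n → Fin n → Bool) → (∀ i → f i i ≡ false) → (∀ i j → f i j ≡ f j i) → ∃[ M ] sum₂ (λ i j → 𝟙 (f i j)) ≡ M + M
  even-sum f diagonal symmetric = sum₂ (λ i j → 𝟙 ((i <?ᵇ j) ∧ f i j)) ,
    trans (sum₂-cong split) (trans (sum₂-+ (λ i j → 𝟙 ((i <?ᵇ j) ∧ f i j)) (λ i j → 𝟙 ((j <?ᵇ i) ∧ f i j))) (cong (sum₂ (λ i j → 𝟙 ((i <?ᵇ j) ∧ f i j)) +_) (trans (sum₂-swap (λ i j → 𝟙 ((j <?ᵇ i) ∧ f i j))) (sum₂-cong λ i j → cong (λ t → 𝟙 ((i <?ᵇ j) ∧ t)) (symmetric j i)))))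
    where
    cases : ∀ a b → 𝟙 b ≡ 𝟙 (a ∧ b) + 𝟙 (not a ∧ b)
    cases true  b = sym (ℕ.+-identityʳ _)
    cases false b = refl
    split : ∀ i j → 𝟙 (f i j) ≡ 𝟙 ((i <?ᵇ j) ∧ f i j) + 𝟙 ((j <?ᵇ i) ∧ f i j)
    split i j with i Fin.≟ j
    ... | yes refl rewrite diagonal i | Bool.∧-zeroʳ (i <?ᵇ i) = refl
    ... | no i≢j rewrite <?ᵇ-flip i≢j = cases (i <?ᵇ j) (f i j)

  -- Twice the claim is the sum of a pointwise identity. If a, b, c record the order of a pair
  -- before p, between p and q and after q, then a xor c is (a xor b) + (b xor c) minus twice their
  -- conjunction. The conjunction is symmetric with zero diagonal, so its sum is even, and M is half
  -- of it.
  inversions-∘ : ∀ {n} (p q : Permutation′ n) → ∃[ M ] inversions (p ∘ₚ q) + (M + M) ≡ inversions p + inversions q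
  inversions-∘ {n} p q = M , halve I M (inversions p) (inversions q) (begin
    (I + I) + ((M + M) + (M + M))                                          ≡⟨ cong₂ (λ s t → s + (t + t)) (sym (flips-inversions (p ∘ₚ q))) (sym (proj₂ even)) ⟩
    sum₂ (λ i j → 𝟙 (flips (p ∘ₚ q) i j)) + (sum₂ W + sum₂ W)              ≡⟨ cong (sum₂ (λ i j → 𝟙 (flips (p ∘ₚ q) i j)) +_) (sum₂-+ W W) ⟨
    sum₂ (λ i j → 𝟙 (flips (p ∘ₚ q) i j)) + sum₂ (λ i j → W i j + W i j)   ≡⟨ sum₂-+ (λ i j → 𝟙 (flips (p ∘ₚ q) i j)) (λ i j → W i j + W i j) ⟨
    sum₂ (λ i j → 𝟙 (flips (p ∘ₚ q) i j) + (W i j + W i j))                ≡⟨ sum₂-cong (λ i j → split (i <?ᵇ j) ((p ⟨$⟩ʳ i) <?ᵇ (p ⟨$⟩ʳ j)) _) ⟩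
    sum₂ (λ i j → 𝟙 (flips p i j) + 𝟙 (flips q (p ⟨$⟩ʳ i) (p ⟨$⟩ʳ j)))     ≡⟨ sum₂-+ (λ i j → 𝟙 (flips p i j)) (λ i j → 𝟙 (flips q (p ⟨$⟩ʳ i) (p ⟨$⟩ʳ j))) ⟩
    sum₂ (λ i j → 𝟙 (flips p i j)) + sum₂ (λ i j → 𝟙 (flips q (p ⟨$⟩ʳ i) (p ⟨$⟩ʳ j)))  ≡⟨ cong₂ _+_ (flips-inversions p) (trans (sym (sum₂-permute (λ i j → 𝟙 (flips q i j)) p)) (flips-inversions q)) ⟩
    (inversions p + inversions p) + (inversions q + inversions q)          ∎)
    where
    open ≡.≡-Reasoning
    I = inversions (p ∘ₚ q)
    w : Fin n → Fin n → Bool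
    w i j = flips p i j ∧ flips q (p ⟨$⟩ʳ i) (p ⟨$⟩ʳ j)
    W : Fin n → Fin n → ℕ
    W i j = 𝟙 (w i j)
    even = even-sum w (λ i → cong (_∧ flips q (p ⟨$⟩ʳ i) (p ⟨$⟩ʳ i)) (flips-diagonal p i)) (λ i j → cong₂ _∧_ (flips-sym p i j) (flips-sym q (p ⟨$⟩ʳ i) (p ⟨$⟩ʳ j)))
    M = proj₁ even
    split : ∀ a b c → 𝟙 (a xor c) + (𝟙 ((a xor b) ∧ (b xor c)) + 𝟙 ((a xor b) ∧ (b xor c))) ≡ 𝟙 (a xor b) + 𝟙 (b xor c)
    split true  true  true  = refl
    split true  true  false = refl
    split true  false true  = refl
    split true  false false = refl
    split false true  true  = refl
    split false true  false = refl
    split false false true  = refl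
    split false false false = refl
    halve : ∀ x y a b → (x + x) + ((y + y) + (y + y)) ≡ (a + a) + (b + b) → x + (y + y) ≡ a + b
    halve x y a b e = ℕ.*-cancelˡ-≡ _ _ 2 (trans (lhs x y) (trans e (sym (rhs a b))))
      where
      lhs : ∀ x y → 2 * (x + (y + y)) ≡ (x + x) + ((y + y) + (y + y))
      lhs = solve-∀
      rhs : ∀ a b → 2 * (a + b) ≡ (a + a) + (b + b)
      rhs = solve-∀

  inversions-cong : ∀ {n} {g h : Permutation′ n} → g Perm.≈ h → inversions g ≡ inversions h
  inversions-cong {g = g} {h} e = trans (inversions-sum g) (trans (sum₂-cong λ i j → cong₂ (λ s t → 𝟙 ((i <?ᵇ j) ∧ (s <?ᵇ t))) (e j) (e i)) (sym (inversions-sum h)))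

  inversions-id : ∀ n → inversions {n} Perm.id ≡ 0
  inversions-id n = trans (inversions-sum {n} Perm.id) (trans (sum₂-cong {n} {g = λ _ _ → 0} zero′) (trans (sum-cong-≗ {n} λ i → sum-replicate-zero n) (sum-replicate-zero n)))
    where
    cases : ∀ a → 𝟙 (a ∧ not a) ≡ 0
    cases true  = refl
    cases false = refl
    zero′ : ∀ (i j : Fin n) → 𝟙 ((i <?ᵇ j) ∧ (j <?ᵇ i)) ≡ 0
    zero′ i j with i Fin.≟ j
    ... | yes refl rewrite <?ᵇ-irrefl i = refl
    ... | no i≢j rewrite <?ᵇ-flip i≢j = cases (i <?ᵇ j)

  transpose-left : ∀ {n} (x y : Fin n) → PC.transpose x y x ≡ y
  transpose-left x y with x Fin.≟ x
  ... | yes _ = refl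
  ... | no ¬p = ⊥-elim (¬p refl)

  transpose-right : ∀ {n} (x y : Fin n) → PC.transpose x y y ≡ x
  transpose-right x y with y Fin.≟ x
  ... | yes p = p
  ... | no _ with y Fin.≟ y
  ...   | yes _ = refl
  ...   | no ¬p = ⊥-elim (¬p refl)

  transpose-other : ∀ {n} (x y : Fin n) {i} → i ≢ x → i ≢ y → PC.transpose x y i ≡ i
  transpose-other x y {i} i≢x i≢y with i Fin.≟ x
  ... | yes p = ⊥-elim (i≢x p)
  ... | no _ with i Fin.≟ y
  ...   | yes p = ⊥-elim (i≢y p)
  ...   | no _  = refl

  module _ {n} (x y : Fin n) (x≢y : x ≢ y) where

    private
      t : Permutation′ n
      t = Perm.transpose x y

      ε : Fin n → Fin n → ℕ
      ε i j = 𝟙 (does (i Fin.≟ j))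

      -- A matrix supported on the rows and columns x and y is the sum of these rows and columns,
      -- except that the entries (x , y) and (y , x) lie in a row and in a column at once; the ε
      -- terms on the left supply their second copy.
      decompose : ∀ (e : Fin n → Fin n → ℕ) → (∀ i → e i i ≡ 0) → e x y ≡ 1 → e y x ≡ 1 →
        (∀ {i j} → i ≢ x → i ≢ y → j ≢ x → j ≢ y → e i j ≡ 0) → ∀ i j → e i j + (ε i x * ε j y + ε i y * ε j x) ≡ (ε i x * e x j + ε i y * e y j) + (ε j x * e i x + ε j y * e i y)
      decompose e e-diagonal e-xy e-yx e-fixed i j with i Fin.≟ x | i Fin.≟ y | j Fin.≟ x | j Fin.≟ y
      ... | yes refl | yes p    | _        | _        = ⊥-elim (x≢y p)
      ... | _        | _        | yes refl | yes p    = ⊥-elim (x≢y p)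
      ... | yes refl | no _     | yes refl | no _     rewrite e-diagonal i = refl
      ... | yes refl | no _     | no _     | yes refl rewrite e-xy = refl
      ... | yes refl | no _     | no _     | no _     = shape (e i j)
        where
        shape : ∀ a → a + 0 ≡ (a + 0 + 0) + 0
        shape = solve-∀
      ... | no _     | yes refl | yes refl | no _     rewrite e-yx = refl
      ... | no _     | yes refl | no _     | yes refl rewrite e-diagonal i = refl
      ... | no _     | yes refl | no _     | no _     = shape (e i j)
        where
        shape : ∀ a → a + 0 ≡ (a + 0) + 0
        shape = solve-∀
      ... | no _     | no _     | yes refl | no _     = shape (e i j)
        where
        shape : ∀ a → a + 0 ≡ a + 0 + 0
        shape = solve-∀
      ... | no _     | no _     | no _     | yes refl = refl
      ... | no ix    | no iy    | no jx    | no jy    rewrite e-fixed ix iy jx jy = refl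

      e : Fin n → Fin n → ℕ
      e i j = 𝟙 (flips t i j)

      row : Fin n → ℕ
      row i = sum (e i)

      sum-ε : ∀ {n} (z : Fin n) (f : Fin n → ℕ) → sum (λ i → 𝟙 (does (i Fin.≟ z)) * f i) ≡ f z
      sum-ε {suc n} zero    f = trans (cong₂ _+_ (ℕ.*-identityˡ (f zero)) (sum-replicate-zero n)) (ℕ.+-identityʳ _)
      sum-ε {suc n} (suc z) f = sum-ε z (f ∘ suc)

      e-sym : ∀ i j → e i j ≡ e j i
      e-sym i j = cong 𝟙 (flips-sym t i j)

      t-involutive : ∀ i → t ⟨$⟩ʳ (t ⟨$⟩ʳ i) ≡ i
      t-involutive i with i Fin.≟ x
      ... | yes refl = transpose-right x y
      ... | no i≢x with i Fin.≟ y
      ...   | yes refl = transpose-left x y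
      ...   | no i≢y = transpose-other x y i≢x i≢y

      e-t : ∀ i j → e (t ⟨$⟩ʳ i) (t ⟨$⟩ʳ j) ≡ e i j
      e-t i j = cong 𝟙 (trans (cong₂ (λ a b → ((t ⟨$⟩ʳ i) <?ᵇ (t ⟨$⟩ʳ j)) xor (a <?ᵇ b)) (t-involutive i) (t-involutive j)) (Bool.xor-comm ((t ⟨$⟩ʳ i) <?ᵇ (t ⟨$⟩ʳ j)) (i <?ᵇ j)))

      -- Applying the involution t to both indices preserves the matrix e and exchanges x with y.
      row-y : row y ≡ row x
      row-y = trans (sum-permute (e y) t) (sum-cong-≗ {n} λ j → trans (cong (λ a → e a (t ⟨$⟩ʳ j)) (sym (transpose-left x y))) (e-t x j))

      e-xy : e x y ≡ 1
      e-xy rewrite transpose-left x y | transpose-right x y | <?ᵇ-flip x≢y = cases (x <?ᵇ y)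
        where
        cases : ∀ a → 𝟙 (a xor not a) ≡ 1
        cases true  = refl
        cases false = refl

      e-diagonal : ∀ i → e i i ≡ 0
      e-diagonal i = cong 𝟙 (flips-diagonal t i)

      e-fixed : ∀ {i j} → i ≢ x → i ≢ y → j ≢ x → j ≢ y → e i j ≡ 0
      e-fixed {i} {j} ix iy jx jy rewrite transpose-other x y ix iy | transpose-other x y jx jy = cong 𝟙 (Bool.xor-same (i <?ᵇ j))

      sum₂-εˡ : ∀ z (f : Fin n → Fin n → ℕ) → sum₂ (λ i j → ε i z * f i j) ≡ sum (f z)
      sum₂-εˡ z f = trans (sum-cong-≗ {n} λ i → sym (*-distribˡ-sum (ε i z) (f i))) (sum-ε z (sum ∘ f))

      sum₂-εʳ : ∀ z (f : Fin n → Fin n → ℕ) → sum₂ (λ i j → ε j z * f i j) ≡ sum (λ i → f i z)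
      sum₂-εʳ z f = sum-cong-≗ {n} λ i → sum-ε z (f i)

      total : (inversions t + inversions t) + 2 ≡ (row x + row x) + (row x + row x)
      total = begin
        (inversions t + inversions t) + 2
          ≡⟨ cong₂ _+_ (flips-inversions t) (cong₂ _+_ (unit x y) (unit y x)) ⟨
        _ ≡⟨ cong₂ _+_ refl (sum₂-+ (λ i j → ε i x * ε j y) (λ i j → ε i y * ε j x)) ⟨
        _ ≡⟨ sum₂-+ e (λ i j → ε i x * ε j y + ε i y * ε j x) ⟨
        sum₂ (λ i j → e i j + (ε i x * ε j y + ε i y * ε j x))
          ≡⟨ sum₂-cong (decompose e e-diagonal e-xy (trans (e-sym y x) e-xy) e-fixed) ⟩
        sum₂ (λ i j → (ε i x * e x j + ε i y * e y j) + (ε j x * e i x + ε j y * e i y))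
          ≡⟨ trans (sum₂-+ (λ i j → ε i x * e x j + ε i y * e y j) _) (cong₂ _+_ (sum₂-+ (λ i j → ε i x * e x j) _) (sum₂-+ (λ i j → ε j x * e i x) _)) ⟩
        (sum₂ (λ i j → ε i x * e x j) + sum₂ (λ i j → ε i y * e y j)) + (sum₂ (λ i j → ε j x * e i x) + sum₂ (λ i j → ε j y * e i y))
          ≡⟨ cong₂ _+_ (cong₂ _+_ (sum₂-εˡ x (λ i j → e x j)) (trans (sum₂-εˡ y (λ i j → e y j)) row-y))
               (cong₂ _+_ (trans (sum₂-εʳ x (λ i j → e i x)) (column x)) (trans (sum₂-εʳ y (λ i j → e i y)) (trans (column y) row-y))) ⟩
        (row x + row x) + (row x + row x) ∎
        where
        open ≡.≡-Reasoning
        unit : ∀ a b → sum₂ (λ i j → ε i a * ε j b) ≡ 1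
        unit a b = trans (sum₂-εˡ a (λ i j → ε j b)) (trans (sum-cong-≗ {n} λ j → sym (ℕ.*-identityʳ (ε j b))) (sum-ε b (λ _ → 1)))
        column : ∀ z → sum (λ i → e i z) ≡ row z
        column z = sum-cong-≗ {n} λ i → e-sym i z

    -- Summing `decompose` over all pairs gives 2 inv + 2 = 4 row x, since the rows and columns of x
    -- and y all have the same sum.
    inversions-transpose-odd : ∃[ M ] inversions (Perm.transpose x y) + 1 ≡ M + M
    inversions-transpose-odd = row x , ℕ.*-cancelˡ-≡ _ _ 2 (trans (lhs (inversions t)) (trans total (rhs (row x))))
      where
      lhs : ∀ a → 2 * (a + 1) ≡ (a + a) + 2
      lhs = solve-∀
      rhs : ∀ a → (a + a) + (a + a) ≡ 2 * (a + a)
      rhs = solve-∀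

  -- The underlying set of `image`, freed from the proof of its size.
  img : ∀ {n} → Permutation′ n → Subset n → Subset n
  img g σ = tabulate (λ i → lookup σ (g ⟨$⟩ˡ i))

  lookup-img : ∀ {n} (g : Permutation′ n) σ i → lookup (img g σ) i ≡ lookup σ (g ⟨$⟩ˡ i)
  lookup-img g σ i = lookup∘tabulate _ i

  lookup-ext : ∀ {n} {σ τ : Subset n} → (∀ i → lookup σ i ≡ lookup τ i) → σ ≡ τ
  lookup-ext {σ = σ} {τ} e = trans (sym (tabulate∘lookup σ)) (trans (tabulate-cong e) (tabulate∘lookup τ))

  img-∘ : ∀ {n} (p q : Permutation′ n) σ → img (p ∘ₚ q) σ ≡ img q (img p σ)
  img-∘ p q σ = tabulate-cong λ i → sym (lookup-img p σ (q ⟨$⟩ˡ i))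

  img-flip : ∀ {n} (g : Permutation′ n) σ → img (Perm.flip g) (img g σ) ≡ σ
  img-flip g σ = lookup-ext λ i → trans (lookup-img (Perm.flip g) (img g σ) i) (trans (lookup-img g σ _) (cong (lookup σ) (Perm.inverseˡ g)))

  flip-img : ∀ {n} (g : Permutation′ n) σ → img g (img (Perm.flip g) σ) ≡ σ
  flip-img g σ = lookup-ext λ i → trans (lookup-img g (img (Perm.flip g) σ) i) (trans (lookup-img (Perm.flip g) σ _) (cong (lookup σ) (Perm.inverseʳ g)))

  flip-cong : ∀ {n} {g h : Permutation′ n} → g Perm.≈ h → ∀ i → g ⟨$⟩ˡ i ≡ h ⟨$⟩ˡ i
  flip-cong {g = g} {h} e i = trans (cong (g ⟨$⟩ˡ_) (trans (sym (Perm.inverseʳ h)) (sym (e (h ⟨$⟩ˡ i))))) (Perm.inverseˡ g)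

  img-cong : ∀ {n} {g h : Permutation′ n} → g Perm.≈ h → ∀ σ → img g σ ≡ img h σ
  img-cong {g = g} {h} e σ = tabulate-cong λ i → cong (lookup σ) (flip-cong {g = g} {h} e i)

  ∣img∣ : ∀ {n} (g : Permutation′ n) σ → ∣ img g σ ∣ ≡ ∣ σ ∣
  ∣img∣ g σ = proj₂ (image g (σ , refl))

  -- For r = n - k this is membership in the row subgroup of T_k; the Boolean form passes directly
  -- through the conditional in `row`.
  PreservesBelow : ∀ {n} → ℕ → Permutation′ n → Set
  PreservesBelow r g = ∀ i → (toℕ (g ⟨$⟩ʳ i) <ᵇ r) ≡ (toℕ i <ᵇ r)

  <⇒<ᵇ-true : ∀ {m n} → m < n → (m <ᵇ n) ≡ true
  <⇒<ᵇ-true {zero}  {suc n} _       = refl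
  <⇒<ᵇ-true {suc m} {suc n} (s≤s l) = <⇒<ᵇ-true l

  ≤⇒<ᵇ-false : ∀ {m n} → n ≤ m → (m <ᵇ n) ≡ false
  ≤⇒<ᵇ-false {m}     {zero}  _       = refl
  ≤⇒<ᵇ-false {suc m} {suc n} (s≤s l) = ≤⇒<ᵇ-false l

  AgreeAbove : ∀ {n} → ℕ → Subset n → Subset n → Set
  AgreeAbove r v w = ∀ i → r ≤ toℕ i → lookup v i ≡ lookup w i

  -- If v had all points below r, it would contain w, because the two agree from r on.
  find-outside : ∀ {n} r (v w : Subset n) → AgreeAbove r v w → ∣ v ∣ < ∣ w ∣ → ∃[ i ] toℕ i < r × lookup v i ≡ outside
  find-outside zero    v w agree l = ⊥-elim (ℕ.<-irrefl (cong ∣_∣ (lookup-ext {σ = v} {w} (λ i → agree i z≤n))) l)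
  find-outside (suc r) (outside ∷ v) (_ ∷ w) agree l = zero , s≤s z≤n , refl
  find-outside (suc r) (inside ∷ v) (b ∷ w) agree l =
    let (i , i<r , e) = find-outside r v w (λ i r≤i → agree (suc i) (s≤s r≤i)) (ℕ.s≤s⁻¹ (ℕ.≤-trans l (bound b))) in suc i , s≤s i<r , e
    where
    bound : ∀ b → ∣ b ∷ w ∣ ≤ suc ∣ w ∣
    bound inside  = ℕ.≤-refl
    bound outside = ℕ.n≤1+n _

  find-inside : ∀ {n} r (v w : Subset n) → AgreeAbove r v w → ∣ w ∣ < ∣ v ∣ → ∃[ i ] toℕ i < r × lookup v i ≡ inside
  find-inside zero    v w agree l = ⊥-elim (ℕ.<-irrefl (cong ∣_∣ (sym (lookup-ext {σ = v} {w} (λ i → agree i z≤n)))) l)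
  find-inside (suc r) (inside ∷ v) (_ ∷ w) agree l = zero , s≤s z≤n , refl
  find-inside (suc r) (outside ∷ v) (b ∷ w) agree l =
    let (i , i<r , e) = find-inside r v w (λ i r≤i → agree (suc i) (s≤s r≤i)) (ℕ.≤-trans (s≤s (bound b)) l) in suc i , s≤s i<r , e
    where
    bound : ∀ b → ∣ w ∣ ≤ ∣ b ∷ w ∣
    bound inside  = ℕ.n≤1+n _
    bound outside = ℕ.≤-refl

  transpose-preserves : ∀ {n} r {x y : Fin n} → toℕ x < r → toℕ y < r → PreservesBelow r (Perm.transpose x y)
  transpose-preserves r {x} {y} x<r y<r i with i Fin.≟ x
  ... | yes refl = trans (<⇒<ᵇ-true y<r) (sym (<⇒<ᵇ-true x<r))
  ... | no i≢x with i Fin.≟ y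
  ...   | yes refl = trans (<⇒<ᵇ-true x<r) (sym (<⇒<ᵇ-true y<r))
  ...   | no i≢y = refl

  -- A transposition below r brings a point of the right membership to the front, and the tail is
  -- treated by a lifted permutation. This supplies the row permutation that carries Ω to a given
  -- m-set containing the second row.
  transitive : ∀ {n} r (v w : Subset n) → AgreeAbove r v w → ∣ v ∣ ≡ ∣ w ∣ → ∃[ g ] PreservesBelow r g × img g v ≡ w
  transitive zero v w agree e = Perm.id , (λ _ → refl) , lookup-ext λ i → trans (lookup-img Perm.id v i) (agree i z≤n)
  transitive (suc r) [] [] agree e = Perm.id , (λ ()) , refl
  transitive {suc n} (suc r) (a ∷ v) (b ∷ w) agree e = step (position a b e)
    where
    position : ∀ a b → ∣ a ∷ v ∣ ≡ ∣ b ∷ w ∣ → ∃[ i ] toℕ i < suc r × lookup (a ∷ v) i ≡ b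
    position inside  inside  e = zero , s≤s z≤n , refl
    position outside outside e = zero , s≤s z≤n , refl
    position inside  outside e = let (i , l , p) = find-outside r v w (λ i r≤i → agree (suc i) (s≤s r≤i)) (ℕ.≤-reflexive e) in suc i , s≤s l , p
    position outside inside  e = let (i , l , p) = find-inside  r v w (λ i r≤i → agree (suc i) (s≤s r≤i)) (ℕ.≤-reflexive (sym e)) in suc i , s≤s l , p
    step : ∃[ i ] toℕ i < suc r × lookup (a ∷ v) i ≡ b → ∃[ g ] PreservesBelow (suc r) g × img g (a ∷ v) ≡ b ∷ w
    step (x , x<r , at-x) = t ∘ₚ Perm.lift₀ (proj₁ rest)
      , (λ i → trans (lift-preserves (t ⟨$⟩ʳ i)) (transpose-preserves (suc r) {x} {zero} x<r (s≤s z≤n) i))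
      , trans (img-∘ t (Perm.lift₀ (proj₁ rest)) (a ∷ v)) (trans (cong (img (Perm.lift₀ (proj₁ rest))) swapped) (cong (b ∷_) (proj₂ (proj₂ rest))))
      where
      t : Permutation′ (suc n)
      t = Perm.transpose x zero
      v′ : Subset n
      v′ = Vec.tail (img t (a ∷ v))
      swapped : img t (a ∷ v) ≡ b ∷ v′
      swapped = cong (_∷ v′) (trans (cong (lookup (a ∷ v)) (transpose-left zero x)) at-x)
      -- The transposition moves only points below the bound, so the agreement beyond it survives.
      agree′ : AgreeAbove r v′ w
      agree′ i r≤i = trans (trans (sym (cong (λ z → lookup z (suc i)) swapped)) (lookup-img t (a ∷ v) (suc i)))
        (trans (cong (lookup (a ∷ v)) (transpose-other zero x {suc i} (λ ()) λ where refl → ℕ.<-irrefl refl (ℕ.≤-trans x<r (s≤s r≤i)))) (agree (suc i) (s≤s r≤i)))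
      cancel : ∀ b {w w′ : Subset n} → ∣ b ∷ w ∣ ≡ ∣ b ∷ w′ ∣ → ∣ w ∣ ≡ ∣ w′ ∣
      cancel inside  p = ℕ.suc-injective p
      cancel outside p = p
      rest = transitive r v′ w agree′ (cancel b {v′} {w} (trans (cong ∣_∣ (sym swapped)) (trans (∣img∣ t (a ∷ v)) e)))
      lift-preserves : PreservesBelow (suc r) (Perm.lift₀ (proj₁ rest))
      lift-preserves zero    = refl
      lift-preserves (suc i) = proj₁ (proj₂ rest) i

open Tallies using (tally; walks-count)
open Permutations

-- Arithmetic and finite sums over a Heyting field.

module OverHeytingField {c ℓ₁ ℓ₂ : Level} (F : HeytingField c ℓ₁ ℓ₂) where

  open HeytingField F using (_#_; #-cotrans; #-irrefl; #-sym; #⇒invertible; invertible⇒#)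

  commutativeRing : CommutativeRing c ℓ₁
  commutativeRing = HeytingCommutativeRing.commutativeRing (HeytingField.heytingCommutativeRing F)

  open CommutativeRing commutativeRing hiding (zero)
  open import Algebra.Properties.Ring (CommutativeRing.ring commutativeRing)
    using (-‿distribˡ-*; -‿involutive; -0#≈0#; -‿+-comm; -1*x≈-x; +-cancelˡ; +-cancelʳ)
  open import Algebra.Properties.Semiring.Mult semiring
    using (×-homo-+; ×1-homo-*; ×-assoc-*; ×-congʳ) renaming (_×_ to _×ₙ_)
  open import Algebra.Properties.Semiring.Exp semiring using (_^_; ^-homo-*)
  open import Algebra.Properties.CommutativeSemigroup +-commutativeSemigroup
    using () renaming (interchange to +-interchange; x∙yz≈y∙xz to x+yz≈y+xz; xy∙z≈xz∙y to xy+z≈xz+y)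
  open import Algebra.Properties.CommutativeSemigroup *-commutativeSemigroup
    using () renaming (interchange to *-interchange; x∙yz≈y∙xz to x*yz≈y*xz)
  open import Relation.Binary.Reasoning.Setoid setoid

  open OverField F using (∑; eigenvalue; B; e; π; youngSymmetrizer; sgn; GroupRing; module LinearAlgebra; Polynomial; eval; NonzeroPolynomial; Generically)

  private variable
    ℓ ℓ′ : Level
    A : Set ℓ
    A′ : Set ℓ′

  ι : ℕ → Carrier
  ι n = n ×ₙ 1#

  ι-+ : ∀ m n → ι (m ℕ.+ n) ≈ ι m + ι n
  ι-+ = ×-homo-+ 1#

  ι-* : ∀ m n → ι (m ℕ.* n) ≈ ι m * ι n
  ι-* = ×1-homo-*

  ι-1 : ι 1 ≈ 1#
  ι-1 = +-identityʳ 1#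

  ×≈ι* : ∀ n x → n ×ₙ x ≈ ι n * x
  ×≈ι* n x = sym (trans (×-assoc-* n 1# x) (×-congʳ n (*-identityˡ x)))

  x-y+y≈x : ∀ x y → (x - y) + y ≈ x
  x-y+y≈x x y = trans (+-assoc x (- y) y) (trans (+-congˡ (-‿inverseˡ y)) (+-identityʳ x))

  x+y-y≈x : ∀ x y → (x + y) - y ≈ x
  x+y-y≈x x y = trans (+-assoc x y (- y)) (trans (+-congˡ (-‿inverseʳ y)) (+-identityʳ x))

  x-0≈x : ∀ x → x - 0# ≈ x
  x-0≈x x = trans (+-congˡ -0#≈0#) (+-identityʳ x)

  x+y≈0⇒y≈-x : ∀ {x y} → x + y ≈ 0# → y ≈ - x
  x+y≈0⇒y≈-x {x} {y} e = +-cancelˡ x y (- x) (trans e (sym (-‿inverseʳ x)))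

  -- Apartness from zero is invertibility here, so most apartness statements are proved by
  -- exhibiting an inverse.
  Unit : Carrier → Set (c ⊔ ℓ₁)
  Unit x = ∃[ y ] x * y ≈ 1#

  #⇒Unit : ∀ {x y} → x # y → Unit (x - y)
  #⇒Unit p = let (v , _ , e) = #⇒invertible p in v , e

  Unit⇒# : ∀ {x y} → Unit (x - y) → x # y
  Unit⇒# {x} {y} (v , e) = invertible⇒# (v , trans (*-comm v (x - y)) e , e)

  Unit-cong : ∀ {x y} → x ≈ y → Unit x → Unit y
  Unit-cong x≈y (v , e) = v , trans (*-congʳ (sym x≈y)) e

  #0⇒Unit : ∀ {x} → x # 0# → Unit x
  #0⇒Unit {x} p = Unit-cong (x-0≈x x) (#⇒Unit p)

  Unit⇒#0 : ∀ {x} → Unit x → x # 0#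
  Unit⇒#0 {x} u = Unit⇒# (Unit-cong (sym (x-0≈x x)) u)

  #-congˡ : ∀ {x y z} → x ≈ y → x # z → y # z
  #-congˡ x≈y p = Unit⇒# (Unit-cong (+-congʳ x≈y) (#⇒Unit p))

  -#0⇒# : ∀ {x y} → x - y # 0# → x # y
  -#0⇒# p = Unit⇒# (#0⇒Unit p)

  #⇒-#0 : ∀ {x y} → x # y → x - y # 0#
  #⇒-#0 p = Unit⇒#0 (#⇒Unit p)

  -- Cotransitivity at y: either x + y # y, hence x # 0, or y # 0.
  +-#0 : ∀ x y → x + y # 0# → x # 0# ⊎ y # 0#
  +-#0 x y p with #-cotrans p y
  ... | inj₁ q = inj₁ (#-congˡ (x+y-y≈x x y) (#⇒-#0 q))
  ... | inj₂ q = inj₂ q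

  *-#0 : ∀ x y → x # 0# → y # 0# → x * y # 0#
  *-#0 x y p q = let (u , eu) = #0⇒Unit p ; (v , ev) = #0⇒Unit q in
    Unit⇒#0 (u * v , trans (*-interchange x y u v) (trans (*-cong eu ev) (*-identityˡ 1#)))

  *-#0⁻ˡ : ∀ x y → x * y # 0# → x # 0#
  *-#0⁻ˡ x y p = let (u , eu) = #0⇒Unit p in Unit⇒#0 (y * u , trans (sym (*-assoc x y u)) eu)

  *-#0⁻ʳ : ∀ x y → x * y # 0# → y # 0#
  *-#0⁻ʳ x y p = *-#0⁻ˡ y x (#-congˡ (*-comm x y) p)

  1#0 : 1# # 0#
  1#0 = Unit⇒#0 (1# , *-identityˡ 1#)

  *-cancelˡ-#0 : ∀ {x y z} → x # 0# → x * y ≈ x * z → y ≈ z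
  *-cancelˡ-#0 {x} {y} {z} p e = let (u , eu) = #0⇒Unit p in begin
    y            ≈⟨ *-identityˡ y ⟨
    1# * y       ≈⟨ *-congʳ (trans (*-comm u x) eu) ⟨
    (u * x) * y  ≈⟨ *-assoc u x y ⟩
    u * (x * y)  ≈⟨ *-congˡ e ⟩
    u * (x * z)  ≈⟨ *-assoc u x z ⟨
    (u * x) * z  ≈⟨ *-congʳ (trans (*-comm u x) eu) ⟩
    1# * z       ≈⟨ *-identityˡ z ⟩
    z            ∎

  *≈0⇒≈0 : ∀ {x y} → x # 0# → x * y ≈ 0# → y ≈ 0#
  *≈0⇒≈0 {x} p e = *-cancelˡ-#0 p (trans e (sym (zeroʳ x)))

  ^-#0 : ∀ x r → x # 0# → x ^ r # 0#
  ^-#0 x zero    p = 1#0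
  ^-#0 x (suc r) p = *-#0 x (x ^ r) p (^-#0 x r p)

  [_] : Bool → Carrier
  [ t ] = if t then 1# else 0#

  ∑-cong-∈ : ∀ {f g : A → Carrier} xs → (∀ {x} → x ∈ xs → f x ≈ g x) → ∑ xs f ≈ ∑ xs g
  ∑-cong-∈ []       e = refl
  ∑-cong-∈ (x ∷ xs) e = +-cong (e (here ≡.refl)) (∑-cong-∈ xs (e ∘ there))

  ∑-cong : ∀ {f g : A → Carrier} xs → (∀ x → f x ≈ g x) → ∑ xs f ≈ ∑ xs g
  ∑-cong xs e = ∑-cong-∈ xs λ {x} _ → e x

  ∑-zero : ∀ {f : A → Carrier} xs → (∀ x → f x ≈ 0#) → ∑ xs f ≈ 0#
  ∑-zero []       e = refl
  ∑-zero (x ∷ xs) e = trans (+-cong (e x) (∑-zero xs e)) (+-identityˡ 0#)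

  ∑-+ : ∀ xs (f g : A → Carrier) → ∑ xs (λ x → f x + g x) ≈ ∑ xs f + ∑ xs g
  ∑-+ []       f g = sym (+-identityˡ 0#)
  ∑-+ (x ∷ xs) f g = trans (+-congˡ (∑-+ xs f g)) (+-interchange (f x) (g x) (∑ xs f) (∑ xs g))

  ∑-*ˡ : ∀ xs y (f : A → Carrier) → ∑ xs (λ x → y * f x) ≈ y * ∑ xs f
  ∑-*ˡ []       y f = sym (zeroʳ y)
  ∑-*ˡ (x ∷ xs) y f = trans (+-congˡ (∑-*ˡ xs y f)) (sym (distribˡ y (f x) (∑ xs f)))

  ∑-*ʳ : ∀ xs y (f : A → Carrier) → ∑ xs (λ x → f x * y) ≈ ∑ xs f * y
  ∑-*ʳ xs y f = trans (∑-cong xs λ x → *-comm (f x) y) (trans (∑-*ˡ xs y f) (*-comm y (∑ xs f)))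

  ∑-swap : ∀ xs ys (f : A → A′ → Carrier) → ∑ xs (λ x → ∑ ys (f x)) ≈ ∑ ys (λ y → ∑ xs (λ x → f x y))
  ∑-swap []       ys f = sym (∑-zero ys λ _ → refl)
  ∑-swap (x ∷ xs) ys f = trans (+-congˡ (∑-swap xs ys f)) (sym (∑-+ ys (f x) (λ y → ∑ xs (λ x → f x y))))

  ∑-map : ∀ (g : A → A′) xs (f : A′ → Carrier) → ∑ (map g xs) f ≈ ∑ xs (f ∘ g)
  ∑-map g []       f = refl
  ∑-map g (x ∷ xs) f = +-congˡ (∑-map g xs f)

  ∑-++ : ∀ (xs ys : List A) f → ∑ (xs ++ ys) f ≈ ∑ xs f + ∑ ys f
  ∑-++ []       ys f = sym (+-identityˡ _)
  ∑-++ (x ∷ xs) ys f = trans (+-congˡ (∑-++ xs ys f)) (sym (+-assoc _ _ _))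

  ∑-concatMap : ∀ (g : A → List A′) xs (f : A′ → Carrier) → ∑ (List.concatMap g xs) f ≈ ∑ xs (λ x → ∑ (g x) f)
  ∑-concatMap g []       f = refl
  ∑-concatMap g (x ∷ xs) f = trans (∑-++ (g x) (List.concatMap g xs) f) (+-congˡ (∑-concatMap g xs f))

  ∑-filter : ∀ {p} {P : Pred A p} (P? : Decidable P) xs f → ∑ (List.filter P? xs) f ≈ ∑ xs (λ x → [ does (P? x) ] * f x)
  ∑-filter P? []       f = refl
  ∑-filter P? (x ∷ xs) f with does (P? x)
  ... | true  = +-cong (sym (*-identityˡ (f x))) (∑-filter P? xs f)
  ... | false = trans (∑-filter P? xs f) (sym (trans (+-congʳ (zeroˡ (f x))) (+-identityˡ _)))

  ∑-suc : ∀ n (f : Fin (suc n) → Carrier) → ∑ (allFin (suc n)) f ≈ f zero + ∑ (allFin n) (f ∘ suc)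
  ∑-suc n f = +-congˡ (trans (reflexive (≡.cong (λ xs → ∑ xs f) (≡.sym (List.map-tabulate id suc)))) (∑-map suc (allFin n) f))

  ∑-lookup : ∀ (xs : List A) f → ∑ (allFin (List.length xs)) (f ∘ List.lookup xs) ≈ ∑ xs f
  ∑-lookup []       f = refl
  ∑-lookup (x ∷ xs) f = trans (∑-suc (List.length xs) (f ∘ List.lookup (x ∷ xs))) (+-congˡ (∑-lookup xs f))

  -- Functions on the subsets of a finite set

  subsets : ∀ n → List (Subset n)
  subsets zero    = [] ∷ []
  subsets (suc n) = map (inside ∷_) (subsets n) ++ map (outside ∷_) (subsets n)

  ∑-subsets : ∀ n (f : Subset (suc n) → Carrier) →
    ∑ (subsets (suc n)) f ≈ ∑ (subsets n) (f ∘ (inside ∷_)) + ∑ (subsets n) (f ∘ (outside ∷_))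
  ∑-subsets n f = trans (∑-++ (map (inside ∷_) (subsets n)) _ f) (+-cong (∑-map _ (subsets n) f) (∑-map _ (subsets n) f))

  infix 4 _≗_
  _≗_ : ∀ {n} → (f g : Subset n → Carrier) → Set ℓ₁
  f ≗ g = ∀ τ → f τ ≈ g τ

  -- (D f) τ, (U f) τ and (Z f) τ sum f over the sets τ ∪ {x} with x ∉ τ, over
  -- the sets τ ∖ {x} with x ∈ τ, and over all subsets of τ.
  D U Z : ∀ {n} → (Subset n → Carrier) → Subset n → Carrier
  D f []            = 0#
  D f (inside  ∷ τ) = D (f ∘ (inside ∷_)) τ
  D f (outside ∷ τ) = D (f ∘ (outside ∷_)) τ + f (inside ∷ τ)
  U f []            = 0#
  U f (inside  ∷ τ) = U (f ∘ (inside ∷_)) τ + f (outside ∷ τ)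
  U f (outside ∷ τ) = U (f ∘ (outside ∷_)) τ
  Z f []            = f []
  Z f (inside  ∷ τ) = Z (f ∘ (inside ∷_)) τ + Z (f ∘ (outside ∷_)) τ
  Z f (outside ∷ τ) = Z (f ∘ (outside ∷_)) τ

  D-cong : ∀ {n} {f g : Subset n → Carrier} → f ≗ g → D f ≗ D g
  D-cong e []            = refl
  D-cong e (inside  ∷ τ) = D-cong (e ∘ (inside ∷_)) τ
  D-cong e (outside ∷ τ) = +-cong (D-cong (e ∘ (outside ∷_)) τ) (e (inside ∷ τ))

  Z-cong : ∀ {n} {f g : Subset n → Carrier} → f ≗ g → Z f ≗ Z g
  Z-cong e []            = e []
  Z-cong e (inside  ∷ τ) = +-cong (Z-cong (e ∘ (inside ∷_)) τ) (Z-cong (e ∘ (outside ∷_)) τ)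
  Z-cong e (outside ∷ τ) = Z-cong (e ∘ (outside ∷_)) τ

  D-∑ : ∀ {n} {a} {A : Set a} xs (f : A → Subset n → Carrier) → D (λ κ → ∑ xs (λ x → f x κ)) ≗ λ τ → ∑ xs (λ x → D (f x) τ)
  D-∑ xs f []            = sym (∑-zero xs λ _ → refl)
  D-∑ xs f (inside  ∷ τ) = D-∑ xs (λ x → f x ∘ (inside ∷_)) τ
  D-∑ xs f (outside ∷ τ) = trans (+-congʳ (D-∑ xs (λ x → f x ∘ (outside ∷_)) τ)) (sym (∑-+ xs _ _))

  Z-∑ : ∀ {n} {a} {A : Set a} xs (f : A → Subset n → Carrier) → Z (λ κ → ∑ xs (λ x → f x κ)) ≗ λ τ → ∑ xs (λ x → Z (f x) τ)
  Z-∑ xs f []            = refl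
  Z-∑ xs f (inside  ∷ τ) = trans (+-cong (Z-∑ xs (λ x → f x ∘ (inside ∷_)) τ) (Z-∑ xs (λ x → f x ∘ (outside ∷_)) τ)) (sym (∑-+ xs _ _))
  Z-∑ xs f (outside ∷ τ) = Z-∑ xs (λ x → f x ∘ (outside ∷_)) τ

  D-* : ∀ {n} y (f : Subset n → Carrier) → D (λ κ → y * f κ) ≗ λ τ → y * D f τ
  D-* y f []            = sym (zeroʳ y)
  D-* y f (inside  ∷ τ) = D-* y (f ∘ (inside ∷_)) τ
  D-* y f (outside ∷ τ) = trans (+-congʳ (D-* y (f ∘ (outside ∷_)) τ)) (sym (distribˡ y _ _))

  Z-* : ∀ {n} y (f : Subset n → Carrier) → Z (λ κ → y * f κ) ≗ λ τ → y * Z f τ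
  Z-* y f []            = refl
  Z-* y f (inside  ∷ τ) = trans (+-cong (Z-* y (f ∘ (inside ∷_)) τ) (Z-* y (f ∘ (outside ∷_)) τ)) (sym (distribˡ y _ _))
  Z-* y f (outside ∷ τ) = Z-* y (f ∘ (outside ∷_)) τ

  D-+ : ∀ {n} (f g : Subset n → Carrier) → D (λ κ → f κ + g κ) ≗ λ τ → D f τ + D g τ
  D-+ f g []            = sym (+-identityˡ 0#)
  D-+ f g (inside  ∷ τ) = D-+ (f ∘ (inside ∷_)) (g ∘ (inside ∷_)) τ
  D-+ f g (outside ∷ τ) = trans (+-congʳ (D-+ (f ∘ (outside ∷_)) (g ∘ (outside ∷_)) τ)) (+-interchange _ _ _ _)

  U-+ : ∀ {n} (f g : Subset n → Carrier) → U (λ κ → f κ + g κ) ≗ λ τ → U f τ + U g τ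
  U-+ f g []            = sym (+-identityˡ 0#)
  U-+ f g (inside  ∷ τ) = trans (+-congʳ (U-+ (f ∘ (inside ∷_)) (g ∘ (inside ∷_)) τ)) (+-interchange _ _ _ _)
  U-+ f g (outside ∷ τ) = U-+ (f ∘ (outside ∷_)) (g ∘ (outside ∷_)) τ

  Z-+ : ∀ {n} (f g : Subset n → Carrier) → Z (λ κ → f κ + g κ) ≗ λ τ → Z f τ + Z g τ
  Z-+ f g []            = refl
  Z-+ f g (inside  ∷ τ) = trans (+-cong (Z-+ (f ∘ (inside ∷_)) (g ∘ (inside ∷_)) τ) (Z-+ (f ∘ (outside ∷_)) (g ∘ (outside ∷_)) τ)) (+-interchange _ _ _ _)
  Z-+ f g (outside ∷ τ) = Z-+ (f ∘ (outside ∷_)) (g ∘ (outside ∷_)) τ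

  D-0 : ∀ {n} {f : Subset n → Carrier} → (∀ κ → f κ ≈ 0#) → ∀ τ → D f τ ≈ 0#
  D-0 e []            = refl
  D-0 e (inside  ∷ τ) = D-0 (e ∘ (inside ∷_)) τ
  D-0 e (outside ∷ τ) = trans (+-cong (D-0 (e ∘ (outside ∷_)) τ) (e (inside ∷ τ))) (+-identityˡ 0#)

  U-0 : ∀ {n} {f : Subset n → Carrier} → (∀ κ → f κ ≈ 0#) → ∀ τ → U f τ ≈ 0#
  U-0 e []            = refl
  U-0 e (inside  ∷ τ) = trans (+-cong (U-0 (e ∘ (inside ∷_)) τ) (e (outside ∷ τ))) (+-identityˡ 0#)
  U-0 e (outside ∷ τ) = U-0 (e ∘ (outside ∷_)) τ

  Z-0 : ∀ {n} {f : Subset n → Carrier} → (∀ κ → f κ ≈ 0#) → ∀ τ → Z f τ ≈ 0#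
  Z-0 e []            = e []
  Z-0 e (inside  ∷ τ) = trans (+-cong (Z-0 (e ∘ (inside ∷_)) τ) (Z-0 (e ∘ (outside ∷_)) τ)) (+-identityˡ 0#)
  Z-0 e (outside ∷ τ) = Z-0 (e ∘ (outside ∷_)) τ

  infix 8 _⟨_,_⟩
  _⟨_,_⟩ : ∀ {n} → (ℕ → ℕ → Carrier) → Subset n → Subset n → Carrier
  h ⟨ σ , κ ⟩ = h (∣ σ ∩ κ ∣) (∣ ∁ σ ∩ κ ∣)

  -- The adjoint of D on weights that depend only on a = #(σ ∩ κ) and c = #(∁σ ∩ κ): a point deleted
  -- from κ lies in σ in a ways and outside σ in c ways. At 0 the truncated predecessor is
  -- multiplied by 0.
  ∂ : (ℕ → ℕ → Carrier) → ℕ → ℕ → Carrier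
  ∂ h a c = ι a * h (ℕ.pred a) c + ι c * h a (ℕ.pred c)

  ι-suc* : ∀ a x → ι (suc a) * x ≈ x + ι a * x
  ι-suc* a x = trans (distribʳ x 1# (ι a)) (+-congʳ (*-identityˡ x))

  ι-pred : ∀ a (g : ℕ → Carrier) → ι a * g (suc (ℕ.pred a)) ≈ ι a * g a
  ι-pred zero    g = trans (zeroˡ _) (sym (zeroˡ _))
  ι-pred (suc a) g = refl

  -- When D f = 0 this says that f is orthogonal to all weights of the form ∂ h, which
  -- determines all weighted sums of a homogeneous f up to one scalar.
  ∑-D : ∀ {n} (σ : Subset n) h f → ∑ (subsets n) (λ κ → h ⟨ σ , κ ⟩ * D f κ) ≈ ∑ (subsets n) (λ κ → ∂ h ⟨ σ , κ ⟩ * f κ)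
  ∑-D [] h f = +-congʳ (trans (zeroʳ _) (sym (trans (*-congʳ (trans (+-cong (zeroˡ _) (zeroˡ _)) (+-identityˡ 0#))) (zeroˡ _))))
  ∑-D {suc n} (s ∷ σ) h f = begin
    ∑ (subsets (suc n)) (λ κ → h ⟨ s ∷ σ , κ ⟩ * D f κ)
      ≈⟨ ∑-subsets n _ ⟩
    ∑ (subsets n) (λ κ → h ⟨ s ∷ σ , inside ∷ κ ⟩ * D f₁ κ) + ∑ (subsets n) (λ κ → h ⟨ s ∷ σ , outside ∷ κ ⟩ * (D f₀ κ + f₁ κ))
      ≈⟨ +-cong (with-in s) (trans (∑-cong (subsets n) (λ κ → distribˡ _ _ _)) (trans (∑-+ (subsets n) _ _) (+-congʳ (with-out s)))) ⟩
    ∑ (subsets n) (λ κ → in′ s κ * f₁ κ) + (∑ (subsets n) (λ κ → ∂ h ⟨ s ∷ σ , outside ∷ κ ⟩ * f₀ κ) + ∑ (subsets n) (λ κ → h ⟨ s ∷ σ , outside ∷ κ ⟩ * f₁ κ))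
      ≈⟨ trans (+-congˡ (+-comm _ _)) (sym (+-assoc _ _ _)) ⟩
    (∑ (subsets n) (λ κ → in′ s κ * f₁ κ) + ∑ (subsets n) (λ κ → h ⟨ s ∷ σ , outside ∷ κ ⟩ * f₁ κ)) + ∑ (subsets n) (λ κ → ∂ h ⟨ s ∷ σ , outside ∷ κ ⟩ * f₀ κ)
      ≈⟨ +-congʳ (trans (sym (∑-+ (subsets n) _ _)) (∑-cong (subsets n) (λ κ → trans (sym (distribʳ _ _ _)) (*-congʳ (combine s κ))))) ⟩
    ∑ (subsets n) (λ κ → ∂ h ⟨ s ∷ σ , inside ∷ κ ⟩ * f₁ κ) + ∑ (subsets n) (λ κ → ∂ h ⟨ s ∷ σ , outside ∷ κ ⟩ * f₀ κ)
      ≈⟨ ∑-subsets n _ ⟨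
    ∑ (subsets (suc n)) (λ κ → ∂ h ⟨ s ∷ σ , κ ⟩ * f κ) ∎
    where
    f₁ f₀ : Subset n → Carrier
    f₁ = f ∘ (inside ∷_)
    f₀ = f ∘ (outside ∷_)
    in′ : Bool → Subset n → Carrier
    in′ inside  κ = ∂ (λ a c → h (suc a) c) ⟨ σ , κ ⟩
    in′ outside κ = ∂ (λ a c → h a (suc c)) ⟨ σ , κ ⟩
    with-in : ∀ s → ∑ (subsets n) (λ κ → h ⟨ s ∷ σ , inside ∷ κ ⟩ * D f₁ κ) ≈ ∑ (subsets n) (λ κ → in′ s κ * f₁ κ)
    with-in inside  = ∑-D σ (λ a c → h (suc a) c) f₁
    with-in outside = ∑-D σ (λ a c → h a (suc c)) f₁
    with-out : ∀ s → ∑ (subsets n) (λ κ → h ⟨ s ∷ σ , outside ∷ κ ⟩ * D f₀ κ) ≈ ∑ (subsets n) (λ κ → ∂ h ⟨ s ∷ σ , outside ∷ κ ⟩ * f₀ κ)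
    with-out inside  = ∑-D σ h f₀
    with-out outside = ∑-D σ h f₀
    -- Deleting the first point itself contributes one more h, which raises the coefficient of its
    -- count by one.
    combine : ∀ s κ → in′ s κ + h ⟨ s ∷ σ , outside ∷ κ ⟩ ≈ ∂ h ⟨ s ∷ σ , inside ∷ κ ⟩
    combine inside κ = let a = ∣ σ ∩ κ ∣ ; c′ = ∣ ∁ σ ∩ κ ∣ in
      trans (+-congʳ (+-congʳ (ι-pred a (λ x → h x c′)))) (trans (xy+z≈xz+y _ _ _) (+-congʳ (trans (+-comm _ _) (sym (ι-suc* a _)))))
    combine outside κ = let a = ∣ σ ∩ κ ∣ ; c′ = ∣ ∁ σ ∩ κ ∣ in
      trans (+-congʳ (+-congˡ (ι-pred c′ (h a)))) (trans (+-assoc _ _ _) (+-congˡ (trans (+-comm _ _) (sym (ι-suc* c′ _)))))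

  -- T u w h a c is the sum of (u choose p) (w choose q) h (a + p) (c + q) over p and q.
  T : ℕ → ℕ → (ℕ → ℕ → Carrier) → ℕ → ℕ → Carrier
  T zero    zero    h a c = h a c
  T zero    (suc w) h a c = T zero w h a (suc c) + T zero w h a c
  T (suc u) w       h a c = T u w h (suc a) c + T u w h a c

  T-sucʳ : ∀ u w h a c → T u (suc w) h a c ≈ T u w h a (suc c) + T u w h a c
  T-sucʳ zero    w h a c = refl
  T-sucʳ (suc u) w h a c = trans (+-cong (T-sucʳ u w h (suc a) c) (T-sucʳ u w h a c)) (+-interchange _ _ _ _)

  T-shiftˡ : ∀ u w h a c → T u w (λ a c → h (suc a) c) a c ≡ T u w h (suc a) c
  T-shiftˡ zero    zero    h a c = ≡.refl
  T-shiftˡ zero    (suc w) h a c = ≡.cong₂ _+_ (T-shiftˡ zero w h a (suc c)) (T-shiftˡ zero w h a c)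
  T-shiftˡ (suc u) w       h a c = ≡.cong₂ _+_ (T-shiftˡ u w h (suc a) c) (T-shiftˡ u w h a c)

  T-shiftʳ : ∀ u w h a c → T u w (λ a c → h a (suc c)) a c ≡ T u w h a (suc c)
  T-shiftʳ zero    zero    h a c = ≡.refl
  T-shiftʳ zero    (suc w) h a c = ≡.cong₂ _+_ (T-shiftʳ zero w h a (suc c)) (T-shiftʳ zero w h a c)
  T-shiftʳ (suc u) w       h a c = ≡.cong₂ _+_ (T-shiftʳ u w h (suc a) c) (T-shiftʳ u w h a c)

  T⟨_,_⟩ : ∀ {n} → Subset n → Subset n → (ℕ → ℕ → Carrier) → Carrier
  T⟨ σ , κ ⟩ h = T (∣ σ ∩ ∁ κ ∣) (∣ ∁ σ ∩ ∁ κ ∣) h (∣ σ ∩ κ ∣) (∣ ∁ σ ∩ κ ∣)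

  -- Interchange of summation: f κ occurs once for every τ containing κ. Such a τ adds to κ some
  -- points of σ and some points outside σ, and `T` sums h over these choices.
  ∑-Z : ∀ {n} (σ : Subset n) h f → ∑ (subsets n) (λ τ → h ⟨ σ , τ ⟩ * Z f τ) ≈ ∑ (subsets n) (λ κ → T⟨ σ , κ ⟩ h * f κ)
  ∑-Z [] h f = refl
  ∑-Z {suc n} (s ∷ σ) h f = begin
    ∑ (subsets (suc n)) (λ κ → h ⟨ s ∷ σ , κ ⟩ * Z f κ)
      ≈⟨ ∑-subsets n _ ⟩
    ∑ (subsets n) (λ τ → h ⟨ s ∷ σ , inside ∷ τ ⟩ * (Z f₁ τ + Z f₀ τ)) + ∑ (subsets n) (λ τ → h ⟨ s ∷ σ , outside ∷ τ ⟩ * Z f₀ τ)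
      ≈⟨ +-congʳ (trans (∑-cong (subsets n) (λ κ → distribˡ _ _ _)) (∑-+ (subsets n) _ _)) ⟩
    (∑ (subsets n) (λ τ → h ⟨ s ∷ σ , inside ∷ τ ⟩ * Z f₁ τ) + ∑ (subsets n) (λ τ → h ⟨ s ∷ σ , inside ∷ τ ⟩ * Z f₀ τ))
        + ∑ (subsets n) (λ τ → h ⟨ s ∷ σ , outside ∷ τ ⟩ * Z f₀ τ)
      ≈⟨ +-assoc _ _ _ ⟩
    ∑ (subsets n) (λ τ → h ⟨ s ∷ σ , inside ∷ τ ⟩ * Z f₁ τ) + (∑ (subsets n) (λ τ → h ⟨ s ∷ σ , inside ∷ τ ⟩ * Z f₀ τ)
        + ∑ (subsets n) (λ τ → h ⟨ s ∷ σ , outside ∷ τ ⟩ * Z f₀ τ))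
      ≈⟨ +-cong (with-in s f₁) (+-cong (with-in s f₀) (with-out s)) ⟩
    ∑ (subsets n) (λ κ → T⟨ s ∷ σ , inside ∷ κ ⟩ h * f₁ κ) + (∑ (subsets n) (λ κ → T⟨ s ∷ σ , inside ∷ κ ⟩ h * f₀ κ)
        + ∑ (subsets n) (λ κ → T⟨ σ , κ ⟩ h * f₀ κ))
      ≈⟨ +-congˡ (trans (sym (∑-+ (subsets n) _ _)) (∑-cong (subsets n) (λ κ → trans (sym (distribʳ _ _ _)) (*-congʳ (combine s κ))))) ⟩
    ∑ (subsets n) (λ κ → T⟨ s ∷ σ , inside ∷ κ ⟩ h * f₁ κ) + ∑ (subsets n) (λ κ → T⟨ s ∷ σ , outside ∷ κ ⟩ h * f₀ κ)
      ≈⟨ ∑-subsets n _ ⟨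
    ∑ (subsets (suc n)) (λ κ → T⟨ s ∷ σ , κ ⟩ h * f κ) ∎
    where
    f₁ f₀ : Subset n → Carrier
    f₁ = f ∘ (inside ∷_)
    f₀ = f ∘ (outside ∷_)
    with-in : ∀ s g → ∑ (subsets n) (λ τ → h ⟨ s ∷ σ , inside ∷ τ ⟩ * Z g τ) ≈ ∑ (subsets n) (λ κ → T⟨ s ∷ σ , inside ∷ κ ⟩ h * g κ)
    with-in inside  g = trans (∑-Z σ (λ a c → h (suc a) c) g) (∑-cong (subsets n) λ κ → *-congʳ (reflexive (T-shiftˡ (∣ σ ∩ ∁ κ ∣) (∣ ∁ σ ∩ ∁ κ ∣) h (∣ σ ∩ κ ∣) (∣ ∁ σ ∩ κ ∣))))
    with-in outside g = trans (∑-Z σ (λ a c → h a (suc c)) g) (∑-cong (subsets n) λ κ → *-congʳ (reflexive (T-shiftʳ (∣ σ ∩ ∁ κ ∣) (∣ ∁ σ ∩ ∁ κ ∣) h (∣ σ ∩ κ ∣) (∣ ∁ σ ∩ κ ∣))))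
    with-out : ∀ s → ∑ (subsets n) (λ τ → h ⟨ s ∷ σ , outside ∷ τ ⟩ * Z f₀ τ) ≈ ∑ (subsets n) (λ κ → T⟨ σ , κ ⟩ h * f₀ κ)
    with-out inside  = ∑-Z σ h f₀
    with-out outside = ∑-Z σ h f₀
    combine : ∀ s κ → T⟨ s ∷ σ , inside ∷ κ ⟩ h + T⟨ σ , κ ⟩ h ≈ T⟨ s ∷ σ , outside ∷ κ ⟩ h
    combine inside  κ = refl
    combine outside κ = sym (T-sucʳ ∣ σ ∩ ∁ κ ∣ _ h _ _)

  -- The bracket expresses κ ⊆ σ as the vanishing of #(∁σ ∩ κ), which makes Z f a sum of the kind
  -- that harmonicity controls.
  Z-as-sum : ∀ {n} (σ : Subset n) f → Z f σ ≈ ∑ (subsets n) (λ κ → [ ∣ ∁ σ ∩ κ ∣ ≡ᵇ 0 ] * f κ)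
  Z-as-sum []            f = sym (trans (+-identityʳ _) (*-identityˡ _))
  Z-as-sum {suc n} (inside ∷ σ) f = trans (+-cong (Z-as-sum σ (f ∘ (inside ∷_))) (Z-as-sum σ (f ∘ (outside ∷_))))
    (sym (∑-subsets n (λ κ → [ ∣ ∁ (inside ∷ σ) ∩ κ ∣ ≡ᵇ 0 ] * f κ)))
  Z-as-sum {suc n} (outside ∷ σ) f = trans (Z-as-sum σ (f ∘ (outside ∷_)))
    (sym (trans (∑-subsets n (λ κ → [ ∣ ∁ (outside ∷ σ) ∩ κ ∣ ≡ᵇ 0 ] * f κ)) (trans (+-congʳ (∑-zero (subsets n) λ κ → zeroˡ _)) (+-identityˡ _))))

  -- The sl2 relation with the negative terms moved across. Both products contain the same exchanges
  -- of a point of τ with a point outside; adding and removing the same point gives n - #τ copies of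
  -- f τ in DU and #τ copies in UD.
  commutator : ∀ {n} (f : Subset n → Carrier) τ → D (U f) τ + ι (∣ τ ∣ ℕ.+ ∣ τ ∣) * f τ ≈ U (D f) τ + ι n * f τ
  commutator f [] = refl
  commutator {suc n} f (inside ∷ τ) = begin
    D (λ κ → U f₁ κ + f₀ κ) τ + ι (suc t ℕ.+ suc t) * x  ≈⟨ +-cong (D-+ (U f₁) f₀ τ) (trans (*-congʳ (reflexive (≡.cong (ι ∘ suc) (ℕ.+-suc t t)))) (trans (ι-suc* (suc (t ℕ.+ t)) x) (+-congˡ (ι-suc* (t ℕ.+ t) x)))) ⟩
    (D (U f₁) τ + D f₀ τ) + (x + (x + ι (t ℕ.+ t) * x))  ≈⟨ +-congˡ (trans (sym (+-assoc _ _ _)) (+-comm _ _)) ⟩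
    (D (U f₁) τ + D f₀ τ) + (ι (t ℕ.+ t) * x + (x + x))  ≈⟨ +-interchange _ _ _ _ ⟩
    (D (U f₁) τ + ι (t ℕ.+ t) * x) + (D f₀ τ + (x + x))  ≈⟨ +-congʳ (commutator f₁ τ) ⟩
    (U (D f₁) τ + ι n * x) + (D f₀ τ + (x + x))          ≈⟨ +-congˡ (sym (+-assoc _ _ _)) ⟩
    (U (D f₁) τ + ι n * x) + ((D f₀ τ + x) + x)          ≈⟨ +-interchange _ _ _ _ ⟩
    (U (D f₁) τ + (D f₀ τ + x)) + (ι n * x + x)          ≈⟨ +-congˡ (trans (+-comm _ _) (sym (ι-suc* n x))) ⟩
    (U (D f₁) τ + (D f₀ τ + x)) + ι (suc n) * x          ∎
    where
    t = ∣ τ ∣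
    x = f (inside ∷ τ)
    f₁ f₀ : Subset n → Carrier
    f₁ = f ∘ (inside ∷_)
    f₀ = f ∘ (outside ∷_)
  commutator {suc n} f (outside ∷ τ) = begin
    (D (U f₀) τ + (U f₁ τ + x)) + ι (t ℕ.+ t) * x  ≈⟨ xy+z≈xz+y _ _ _ ⟩
    (D (U f₀) τ + ι (t ℕ.+ t) * x) + (U f₁ τ + x)  ≈⟨ +-congʳ (commutator f₀ τ) ⟩
    (U (D f₀) τ + ι n * x) + (U f₁ τ + x)          ≈⟨ +-interchange _ _ _ _ ⟩
    (U (D f₀) τ + U f₁ τ) + (ι n * x + x)          ≈⟨ +-cong (sym (U-+ (D f₀) f₁ τ)) (trans (+-comm _ _) (sym (ι-suc* n x))) ⟩
    U (λ κ → D f₀ κ + f₁ κ) τ + ι (suc n) * x      ∎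
    where
    t = ∣ τ ∣
    x = f (outside ∷ τ)
    f₁ f₀ : Subset n → Carrier
    f₁ = f ∘ (inside ∷_)
    f₀ = f ∘ (outside ∷_)

  -- A subset κ of τ can be enlarged inside τ by #τ - #κ points, so Z (U f) weights f κ by that
  -- difference.
  Z-U : ∀ {n} (f : Subset n → Carrier) τ → Z (U f) τ + Z (λ κ → ι ∣ κ ∣ * f κ) τ ≈ ι ∣ τ ∣ * Z f τ
  Z-U f [] = +-identityˡ _
  Z-U {suc n} f (inside ∷ τ) = begin
    (Z (λ κ → U f₁ κ + f₀ κ) τ + Z (U f₀) τ) + (Z (λ κ → ι (suc ∣ κ ∣) * f₁ κ) τ + Z (λ κ → ι ∣ κ ∣ * f₀ κ) τ)
      ≈⟨ +-interchange _ _ _ _ ⟩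
    (Z (λ κ → U f₁ κ + f₀ κ) τ + Z (λ κ → ι (suc ∣ κ ∣) * f₁ κ) τ) + (Z (U f₀) τ + Z (λ κ → ι ∣ κ ∣ * f₀ κ) τ)
      ≈⟨ +-cong (+-cong (Z-+ (U f₁) f₀ τ) (trans (Z-cong (λ κ → ι-suc* ∣ κ ∣ (f₁ κ)) τ) (trans (Z-+ f₁ _ τ) (+-comm _ _)))) (Z-U f₀ τ) ⟩
    ((Z (U f₁) τ + Z f₀ τ) + (Z (λ κ → ι ∣ κ ∣ * f₁ κ) τ + Z f₁ τ)) + ι ∣ τ ∣ * Z f₀ τ
      ≈⟨ +-congʳ (trans (+-interchange _ _ _ _) (+-congʳ (Z-U f₁ τ))) ⟩
    (ι ∣ τ ∣ * Z f₁ τ + (Z f₀ τ + Z f₁ τ)) + ι ∣ τ ∣ * Z f₀ τ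
      ≈⟨ xy+z≈xz+y _ _ _ ⟩
    (ι ∣ τ ∣ * Z f₁ τ + ι ∣ τ ∣ * Z f₀ τ) + (Z f₀ τ + Z f₁ τ)
      ≈⟨ trans (+-cong (sym (distribˡ _ _ _)) (+-comm _ _)) (trans (+-comm _ _) (sym (ι-suc* ∣ τ ∣ _))) ⟩
    ι (suc ∣ τ ∣) * (Z f₁ τ + Z f₀ τ) ∎
    where
    f₁ f₀ : Subset n → Carrier
    f₁ = f ∘ (inside ∷_)
    f₀ = f ∘ (outside ∷_)
  Z-U f (outside ∷ τ) = Z-U (f ∘ (outside ∷_)) τ

  -- Harmonic functions

  [≡ᵇ]-1 : ∀ {x y} → x ≡ y → [ x ≡ᵇ y ] ≈ 1#
  [≡ᵇ]-1 {x} ≡.refl rewrite ≡ᵇ-refl x = refl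

  [≡ᵇ]-0 : ∀ {x y} → x ≢ y → [ x ≡ᵇ y ] ≈ 0#
  [≡ᵇ]-0 p rewrite ≢⇒≡ᵇ-false p = refl

  [≡ᵇ]-cong : ∀ x y {u v : Carrier} → (x ≡ y → u ≈ v) → u * [ x ≡ᵇ y ] ≈ v * [ x ≡ᵇ y ]
  [≡ᵇ]-cong x y e with x ℕ.≟ y
  ... | yes p = *-congʳ (e p)
  ... | no ¬p = trans (*-congˡ ([≡ᵇ]-0 ¬p)) (trans (zeroʳ _) (sym (trans (*-congˡ ([≡ᵇ]-0 ¬p)) (zeroʳ _))))

  ∑-pick : ∀ N x (G : ℕ → Carrier) → x < N → ∑ (allFin N) (λ i → G (toℕ i) * [ x ≡ᵇ toℕ i ]) ≈ G x
  ∑-pick (suc N) zero G _ = trans (∑-suc N _) (trans (+-cong (*-identityʳ _) (∑-zero (allFin N) λ i → zeroʳ _)) (+-identityʳ _))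
  ∑-pick (suc N) (suc x) G (s≤s x<N) = trans (∑-suc N _) (trans (+-cong (zeroʳ _) (∑-pick N x (G ∘ suc) x<N)) (+-identityˡ _))

  ∑-last : ∀ N (G : ℕ → Carrier) → ∑ (allFin (suc N)) (G ∘ toℕ) ≈ ∑ (allFin N) (G ∘ toℕ) + G N
  ∑-last zero    G = +-comm _ _
  ∑-last (suc N) G = trans (∑-suc (suc N) _) (trans (+-congˡ (∑-last N (G ∘ suc)))
    (trans (sym (+-assoc _ _ _)) (+-congʳ (sym (∑-suc N _)))))

  ∑-reverse : ∀ k (G : ℕ → Carrier) → ∑ (allFin (suc k)) (G ∘ toℕ) ≈ ∑ (allFin (suc k)) (λ i → G (k ∸ toℕ i))
  ∑-reverse zero    G = refl
  ∑-reverse (suc k) G = begin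
    ∑ (allFin (suc (suc k))) (G ∘ toℕ)                                   ≈⟨ ∑-suc (suc k) _ ⟩
    G 0 + ∑ (allFin (suc k)) (G ∘ suc ∘ toℕ)                             ≈⟨ +-congˡ (∑-reverse k (G ∘ suc)) ⟩
    G 0 + ∑ (allFin (suc k)) (λ i → G (suc (k ∸ toℕ i)))                 ≈⟨ +-cong (reflexive (≡.cong G (≡.sym (ℕ.n∸n≡0 (suc k)))))
        (∑-cong (allFin (suc k)) λ i → reflexive (≡.cong G (≡.sym (ℕ.+-∸-assoc 1 (toℕ≤pred[n] i))))) ⟩
    G (suc k ∸ suc k) + ∑ (allFin (suc k)) (λ i → G (suc k ∸ toℕ i))     ≈⟨ +-comm _ _ ⟩
    ∑ (allFin (suc k)) (λ i → G (suc k ∸ toℕ i)) + G (suc k ∸ suc k)     ≈⟨ ∑-last (suc k) (λ j → G (suc k ∸ j)) ⟨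
    ∑ (allFin (suc (suc k))) (λ i → G (suc k ∸ toℕ i))                   ∎

  -- Functions on k-subsets are kept as functions on all subsets that vanish off size k, so that D,
  -- U and Z can recurse along the vector.
  Homogeneous : ∀ {n} → ℕ → (Subset n → Carrier) → Set ℓ₁
  Homogeneous k f = ∀ κ → ∣ κ ∣ ≢ k → f κ ≈ 0#

  Harmonic : ∀ {n} → (Subset n → Carrier) → Set ℓ₁
  Harmonic f = ∀ ρ → D f ρ ≈ 0#

  ∑-homogeneous : ∀ {n k} {f : Subset n → Carrier} → Homogeneous k f → ∀ {g g′ : Subset n → Carrier} →
    (∀ κ → ∣ κ ∣ ≡ k → g κ ≈ g′ κ) → ∑ (subsets n) (λ κ → g κ * f κ) ≈ ∑ (subsets n) (λ κ → g′ κ * f κ)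
  ∑-homogeneous {n} {k} hom e = ∑-cong (subsets n) λ κ → go κ (∣ κ ∣ ℕ.≟ k)
    where
    go : ∀ κ → Dec (∣ κ ∣ ≡ k) → _
    go κ (yes p) = *-congʳ (e κ p)
    go κ (no ¬p) = trans (*-congˡ (hom κ ¬p)) (trans (zeroʳ _) (sym (trans (*-congˡ (hom κ ¬p)) (zeroʳ _))))

  module HarmonicSums (char0 : ∀ n → ι (suc n) # 0#) {n k : ℕ} (f : Subset n → Carrier)
    (hom : Homogeneous k f) (harm : Harmonic f) (σ : Subset n) where

    -- The moments of f relative to σ, sorted by the number of points outside σ; E 0 is Z f σ.
    E : ℕ → Carrier
    E c = ∑ (subsets n) (λ κ → [ ∣ ∁ σ ∩ κ ∣ ≡ᵇ c ] * f κ)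

    -- `∑-D` is applied to the weight that selects c points outside σ, and D f = 0 makes the sum
    -- vanish. On sets of size k with c points outside, the factor #(σ ∩ κ) is k - c.
    E-step : ∀ c → ι (k ∸ c) * E c + ι (suc c) * E (suc c) ≈ 0#
    E-step c = begin
      ι (k ∸ c) * E c + ι (suc c) * E (suc c)
        ≈⟨ +-cong (pull (ι (k ∸ c)) c) (pull (ι (suc c)) (suc c)) ⟨
      ∑ (subsets n) (λ κ → (ι (k ∸ c) * [ ∣ ∁ σ ∩ κ ∣ ≡ᵇ c ]) * f κ) + ∑ (subsets n) (λ κ → (ι (suc c) * [ ∣ ∁ σ ∩ κ ∣ ≡ᵇ suc c ]) * f κ)
        ≈⟨ ∑-+ (subsets n) _ _ ⟨
      ∑ (subsets n) (λ κ → (ι (k ∸ c) * [ ∣ ∁ σ ∩ κ ∣ ≡ᵇ c ]) * f κ + (ι (suc c) * [ ∣ ∁ σ ∩ κ ∣ ≡ᵇ suc c ]) * f κ)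
        ≈⟨ ∑-cong (subsets n) (λ κ → distribʳ _ _ _) ⟨
      ∑ (subsets n) (λ κ → (ι (k ∸ c) * [ ∣ ∁ σ ∩ κ ∣ ≡ᵇ c ] + ι (suc c) * [ ∣ ∁ σ ∩ κ ∣ ≡ᵇ suc c ]) * f κ)
        ≈⟨ ∑-homogeneous hom (λ κ e → +-cong (first κ e) (second (∣ ∁ σ ∩ κ ∣))) ⟨
      ∑ (subsets n) (λ κ → ∂ h ⟨ σ , κ ⟩ * f κ)
        ≈⟨ ∑-D σ h f ⟨
      ∑ (subsets n) (λ κ → h ⟨ σ , κ ⟩ * D f κ)
        ≈⟨ ∑-zero (subsets n) (λ κ → trans (*-congˡ (harm κ)) (zeroʳ _)) ⟩
      0# ∎
      where
      h : ℕ → ℕ → Carrier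
      h _ c′ = [ c′ ≡ᵇ c ]
      pull : ∀ x c → ∑ (subsets n) (λ κ → (x * [ ∣ ∁ σ ∩ κ ∣ ≡ᵇ c ]) * f κ) ≈ x * E c
      pull x c = trans (∑-cong (subsets n) λ κ → *-assoc _ _ _) (∑-*ˡ (subsets n) x _)
      first : ∀ κ → ∣ κ ∣ ≡ k → ι (∣ σ ∩ κ ∣) * [ ∣ ∁ σ ∩ κ ∣ ≡ᵇ c ] ≈ ι (k ∸ c) * [ ∣ ∁ σ ∩ κ ∣ ≡ᵇ c ]
      first κ e = [≡ᵇ]-cong (∣ ∁ σ ∩ κ ∣) c λ p → reflexive (≡.cong ι (≡.trans (≡.sym (ℕ.m+n∸n≡m (∣ σ ∩ κ ∣) (∣ ∁ σ ∩ κ ∣)))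
        (≡.cong₂ _∸_ (≡.trans (∣∩∣+∣∁∩∣ σ κ) e) p)))
      second : ∀ c′ → ι c′ * [ ℕ.pred c′ ≡ᵇ c ] ≈ ι (suc c) * [ c′ ≡ᵇ suc c ]
      second zero     = trans (zeroˡ _) (sym (zeroʳ _))
      second (suc c′) = [≡ᵇ]-cong c′ c λ p → reflexive (≡.cong (ι ∘ suc) p)

    -- Solving `E-step` divides by c + 1, where characteristic zero enters; `absorption` recognises
    -- the product of the ratios as a binomial coefficient.
    E-formula : ∀ c → E c ≈ ((- 1#) ^ c * ι (k choose c)) * E 0
    E-formula zero = sym (trans (*-congʳ (trans (*-identityˡ _) (trans (reflexive (≡.cong ι (nC0≡1 k))) ι-1))) (*-identityˡ _))
    E-formula (suc c) = *-cancelˡ-#0 (char0 c) (begin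
      ι (suc c) * E (suc c)                                          ≈⟨ x+y≈0⇒y≈-x (E-step c) ⟩
      - (ι (k ∸ c) * E c)                                            ≈⟨ -‿cong (*-congˡ (E-formula c)) ⟩
      - (ι (k ∸ c) * ((s * ι (k choose c)) * E 0))                   ≈⟨ -‿cong (trans (sym (*-assoc _ _ _)) (*-congʳ (x*yz≈y*xz _ _ _))) ⟩
      - ((s * (ι (k ∸ c) * ι (k choose c))) * E 0)                   ≈⟨ -‿cong (*-congʳ (*-congˡ (trans (sym (ι-* (k ∸ c) _)) (trans (reflexive (≡.cong ι (≡.sym (absorption k c)))) (ι-* (suc c) (k choose suc c)))))) ⟩
      - ((s * (ι (suc c) * ι (k choose suc c))) * E 0)               ≈⟨ trans (-‿distribˡ-* _ _) (*-congʳ (trans (-‿distribˡ-* _ _) (*-congʳ (sym (-1*x≈-x s))))) ⟩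
      (((- 1#) ^ suc c) * (ι (suc c) * ι (k choose suc c))) * E 0    ≈⟨ trans (*-congʳ (x*yz≈y*xz _ _ _)) (*-assoc _ _ _) ⟩
      ι (suc c) * (((- 1#) ^ suc c * ι (k choose suc c)) * E 0)      ∎)
      where s = (- 1#) ^ c

    -- Sorting by the number c of points outside σ leaves only moments, each a multiple of Z f σ.
    -- The final reversal passes to j = k - c, the index used in λ_k.
    ∑-harmonic : (G : ℕ → Carrier) → ∑ (subsets n) (λ κ → G (∣ ∁ σ ∩ κ ∣) * f κ)
      ≈ ∑ (allFin (suc k)) (λ j → ((- 1#) ^ (k ∸ toℕ j) * ι (k choose toℕ j)) * G (k ∸ toℕ j)) * Z f σ
    ∑-harmonic G = begin
      ∑ (subsets n) (λ κ → G (∣ ∁ σ ∩ κ ∣) * f κ)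
        ≈⟨ ∑-homogeneous hom (λ κ e → ∑-pick (suc k) (∣ ∁ σ ∩ κ ∣) G (s≤s (≡.subst (∣ ∁ σ ∩ κ ∣ ≤_) (≡.trans (∣∩∣+∣∁∩∣ σ κ) e) (ℕ.m≤n+m _ _)))) ⟨
      ∑ (subsets n) (λ κ → ∑ (allFin (suc k)) (λ i → G (toℕ i) * [ ∣ ∁ σ ∩ κ ∣ ≡ᵇ toℕ i ]) * f κ)
        ≈⟨ ∑-cong (subsets n) (λ κ → trans (sym (∑-*ʳ (allFin (suc k)) (f κ) _)) (∑-cong (allFin (suc k)) λ i → *-assoc _ _ _)) ⟩
      ∑ (subsets n) (λ κ → ∑ (allFin (suc k)) (λ i → G (toℕ i) * ([ ∣ ∁ σ ∩ κ ∣ ≡ᵇ toℕ i ] * f κ)))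
        ≈⟨ ∑-swap (subsets n) (allFin (suc k)) _ ⟩
      ∑ (allFin (suc k)) (λ i → ∑ (subsets n) (λ κ → G (toℕ i) * ([ ∣ ∁ σ ∩ κ ∣ ≡ᵇ toℕ i ] * f κ)))
        ≈⟨ ∑-cong (allFin (suc k)) (λ i → trans (∑-*ˡ (subsets n) _ _) (trans (*-congˡ (E-formula (toℕ i)))
             (trans (sym (*-assoc _ _ _)) (*-cong (*-comm _ _) (sym (Z-as-sum σ f)))))) ⟩
      ∑ (allFin (suc k)) (λ i → (((- 1#) ^ toℕ i * ι (k choose toℕ i)) * G (toℕ i)) * Z f σ)
        ≈⟨ ∑-*ʳ (allFin (suc k)) _ _ ⟩
      ∑ (allFin (suc k)) (λ i → ((- 1#) ^ toℕ i * ι (k choose toℕ i)) * G (toℕ i)) * Z f σ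
        ≈⟨ *-congʳ (∑-reverse k (λ i → ((- 1#) ^ i * ι (k choose i)) * G i)) ⟩
      ∑ (allFin (suc k)) (λ j → ((- 1#) ^ (k ∸ toℕ j) * ι (k choose (k ∸ toℕ j))) * G (k ∸ toℕ j)) * Z f σ
        ≈⟨ *-congʳ (∑-cong (allFin (suc k)) λ j → *-congʳ (*-congˡ (reflexive (≡.cong ι (≡.sym (nCk≡nC[n∸k] {toℕ j} {k} (toℕ≤pred[n] j))))))) ⟩
      ∑ (allFin (suc k)) (λ j → ((- 1#) ^ (k ∸ toℕ j) * ι (k choose toℕ j)) * G (k ∸ toℕ j)) * Z f σ ∎

  -- Counting the m-sets that contain a given k-set, and the eigenvalue formula.

  module ClosedForm (m : ℕ) (b : ℕ → Carrier) where

    -- The entry of B at (σ , τ), with the condition #τ = m expressed through the two counts so that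
    -- `∑-Z` applies.
    level : ℕ → ℕ → Carrier
    level a c = [ a ℕ.+ c ≡ᵇ m ] * b a

    -- `T` only adds points, so a set with more than m points never returns to size m.
    T-vanish : ∀ u w a c → m < a ℕ.+ c → T u w level a c ≈ 0#
    T-vanish zero    zero    a c m< = trans (*-congʳ ([≡ᵇ]-0 λ e → ℕ.<-irrefl (≡.sym e) m<)) (zeroˡ _)
    T-vanish zero    (suc w) a c m< = trans (+-cong (T-vanish zero w a (suc c) (≡.subst (m <_) (≡.sym (ℕ.+-suc a c)) (ℕ.m≤n⇒m≤1+n m<))) (T-vanish zero w a c m<)) (+-identityˡ 0#)
    T-vanish (suc u) w       a c m< = trans (+-cong (T-vanish u w (suc a) c (ℕ.m≤n⇒m≤1+n m<)) (T-vanish u w a c m<)) (+-identityˡ 0#)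

    private
      above : ∀ {a c} → a ℕ.+ c ℕ.+ 0 ≡ m → m < suc (a ℕ.+ c)
      above {a} {c} e = s≤s (ℕ.≤-reflexive (≡.trans (≡.sym e) (ℕ.+-identityʳ _)))

      shiftʳ : ∀ {a c r} → a ℕ.+ c ℕ.+ suc r ≡ m → a ℕ.+ suc c ℕ.+ r ≡ m
      shiftʳ {a} {c} {r} e = ≡.trans (≡.trans (≡.cong (ℕ._+ r) (ℕ.+-suc a c)) (≡.sym (ℕ.+-suc (a ℕ.+ c) r))) e

      shiftˡ : ∀ {a c r} → a ℕ.+ c ℕ.+ suc r ≡ m → suc a ℕ.+ c ℕ.+ r ≡ m
      shiftˡ {a} {c} {r} e = ≡.trans (≡.sym (ℕ.+-suc (a ℕ.+ c) r)) e

    T-closed₀ : ∀ w a c r → a ℕ.+ c ℕ.+ r ≡ m → T zero w level a c ≈ ι (w choose r) * b a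
    T-closed₀ zero a c zero e = *-congʳ (trans ([≡ᵇ]-1 (≡.trans (≡.sym (ℕ.+-identityʳ _)) e)) (sym ι-1))
    T-closed₀ zero a c (suc r) e = *-congʳ (trans ([≡ᵇ]-0 λ p → ℕ.m≢1+m+n (a ℕ.+ c) (≡.trans p (≡.trans (≡.sym e) (ℕ.+-suc _ r))))
      (reflexive (≡.cong ι (≡.sym (k>n⇒nCk≡0 {0} {suc r} (s≤s z≤n))))))
    T-closed₀ (suc w) a c zero e = trans (+-cong (T-vanish zero w a (suc c) (≡.subst (m <_) (≡.sym (ℕ.+-suc a c)) (above {a} {c} e))) (T-closed₀ w a c zero e))
      (trans (+-identityˡ _) (*-congʳ (reflexive (≡.cong ι (≡.trans (nC0≡1 w) (≡.sym (nC0≡1 (suc w))))))))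
    T-closed₀ (suc w) a c (suc r) e = trans (+-cong (T-closed₀ w a (suc c) r (shiftʳ {a} {c} e)) (T-closed₀ w a c (suc r) e))
      (trans (sym (distribʳ _ _ _)) (*-congʳ (trans (sym (ι-+ (w choose r) _)) (reflexive (≡.cong ι (nCk+nC[k+1]≡[n+1]C[k+1] w r))))))

    -- Pascal's rule on u. There are r = m - a - c points still to be added, p of them from σ and r
    -- - p from outside.
    T-closed : ∀ u w a c r → a ℕ.+ c ℕ.+ r ≡ m →
      T u w level a c ≈ ∑ (allFin (suc r)) (λ p → ι ((u choose toℕ p) ℕ.* (w choose (r ∸ toℕ p))) * b (a ℕ.+ toℕ p))
    T-closed zero w a c r e = trans (T-closed₀ w a c r e) (sym (trans (∑-suc r _) (trans (+-cong
      (*-cong (reflexive (≡.cong ι (≡.trans (≡.cong (ℕ._* (w choose r)) (nC0≡1 0)) (ℕ.*-identityˡ _)))) (reflexive (≡.cong b (ℕ.+-identityʳ a))))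
      (∑-zero (allFin r) λ p → trans (*-congʳ (reflexive (≡.cong (λ t → ι (t ℕ.* (w choose (r ∸ toℕ (suc p))))) (k>n⇒nCk≡0 {0} {suc (toℕ p)} (s≤s z≤n))))) (zeroˡ _)))
      (+-identityʳ _))))
    T-closed (suc u) w a c zero e = trans (+-cong (T-vanish u w (suc a) c (above {a} {c} e)) (T-closed u w a c zero e))
      (trans (+-identityˡ _) (+-congʳ (*-congʳ (reflexive (≡.cong (λ t → ι (t ℕ.* (w choose 0))) (≡.trans (nC0≡1 u) (≡.sym (nC0≡1 (suc u)))))))))
    T-closed (suc u) w a c (suc r) e = begin
      T u w level (suc a) c + T u w level a c
        ≈⟨ +-cong (T-closed u w (suc a) c r (shiftˡ {a} {c} e)) (trans (T-closed u w a c (suc r) e) (∑-suc (suc r) _)) ⟩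
      ∑ (allFin (suc r)) (λ p → ι ((u choose toℕ p) ℕ.* (w choose (r ∸ toℕ p))) * b (suc a ℕ.+ toℕ p))
        + (ι ((u choose 0) ℕ.* (w choose suc r)) * b (a ℕ.+ 0) + ∑ (allFin (suc r)) (λ p → ι ((u choose suc (toℕ p)) ℕ.* (w choose (r ∸ toℕ p))) * b (a ℕ.+ suc (toℕ p))))
        ≈⟨ x+yz≈y+xz _ _ _ ⟩
      ι ((u choose 0) ℕ.* (w choose suc r)) * b (a ℕ.+ 0) + (∑ (allFin (suc r)) (λ p → ι ((u choose toℕ p) ℕ.* (w choose (r ∸ toℕ p))) * b (suc a ℕ.+ toℕ p))
        + ∑ (allFin (suc r)) (λ p → ι ((u choose suc (toℕ p)) ℕ.* (w choose (r ∸ toℕ p))) * b (a ℕ.+ suc (toℕ p))))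
        ≈⟨ +-cong (*-congʳ (reflexive (≡.cong (λ t → ι (t ℕ.* (w choose suc r))) (≡.trans (nC0≡1 u) (≡.sym (nC0≡1 (suc u)))))))
             (trans (sym (∑-+ (allFin (suc r)) _ _)) (∑-cong (allFin (suc r)) λ p → pascal (toℕ p))) ⟩
      ι ((suc u choose 0) ℕ.* (w choose suc r)) * b (a ℕ.+ 0) + ∑ (allFin (suc r)) (λ p → ι ((suc u choose suc (toℕ p)) ℕ.* (w choose (r ∸ toℕ p))) * b (a ℕ.+ suc (toℕ p)))
        ≈⟨ ∑-suc (suc r) _ ⟨
      ∑ (allFin (suc (suc r))) (λ p → ι ((suc u choose toℕ p) ℕ.* (w choose (suc r ∸ toℕ p))) * b (a ℕ.+ toℕ p)) ∎
      where
      pascal : ∀ p → ι ((u choose p) ℕ.* (w choose (r ∸ p))) * b (suc a ℕ.+ p) + ι ((u choose suc p) ℕ.* (w choose (r ∸ p))) * b (a ℕ.+ suc p)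
        ≈ ι ((suc u choose suc p) ℕ.* (w choose (r ∸ p))) * b (a ℕ.+ suc p)
      pascal p = let x = w choose (r ∸ p) in begin
        ι ((u choose p) ℕ.* x) * b (suc a ℕ.+ p) + ι ((u choose suc p) ℕ.* x) * b (a ℕ.+ suc p)
          ≈⟨ +-congʳ (*-congˡ (reflexive (≡.cong b (≡.sym (ℕ.+-suc a p))))) ⟩
        ι ((u choose p) ℕ.* x) * b (a ℕ.+ suc p) + ι ((u choose suc p) ℕ.* x) * b (a ℕ.+ suc p)
          ≈⟨ distribʳ _ _ _ ⟨
        (ι ((u choose p) ℕ.* x) + ι ((u choose suc p) ℕ.* x)) * b (a ℕ.+ suc p)
          ≈⟨ *-congʳ (trans (sym (ι-+ ((u choose p) ℕ.* x) _)) (reflexive (≡.cong ι (≡.trans (≡.sym (ℕ.*-distribʳ-+ x (u choose p) _)) (≡.cong (ℕ._* x) (nCk+nC[k+1]≡[n+1]C[k+1] u p)))))) ⟩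
        ι ((suc u choose suc p) ℕ.* x) * b (a ℕ.+ suc p) ∎

  -- A total sequence spares index proofs during the calculation. Indices beyond m meet a vanishing
  -- bracket in `level`, so the default 0 never shows.
  extend : ∀ {m} → (Fin (suc m) → Carrier) → ℕ → Carrier
  extend {m} b i with i ℕ.<? suc m
  ... | yes i≤m = b (fromℕ< i≤m)
  ... | no  _   = 0#

  extend-fromℕ< : ∀ {m} (b : Fin (suc m) → Carrier) i (i≤m : i < suc m) → extend b i ≡ b (fromℕ< i≤m)
  extend-fromℕ< {m} b i i≤m with i ℕ.<? suc m
  ... | yes p = ≡.cong b (fromℕ<-cong i i ≡.refl p i≤m)
  ... | no ¬p = ⊥-elim (¬p i≤m)

  ∑-mSubsets : ∀ n m (G : Subset n → Carrier) → ∑ (mSubsets n m) (G ∘ proj₁) ≈ ∑ (subsets n) (λ τ → [ ∣ τ ∣ ≡ᵇ m ] * G τ)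
  ∑-mSubsets zero    zero    G = +-congʳ (sym (*-identityˡ _))
  ∑-mSubsets zero    (suc m) G = sym (trans (+-congʳ (zeroˡ _)) (+-identityˡ 0#))
  ∑-mSubsets (suc n) zero    G = begin
    ∑ (mSubsets (suc n) zero) (G ∘ proj₁)            ≈⟨ ∑-map _ (mSubsets n zero) (G ∘ proj₁) ⟩
    ∑ (mSubsets n zero) (G ∘ (outside ∷_) ∘ proj₁)   ≈⟨ ∑-mSubsets n zero (G ∘ (outside ∷_)) ⟩
    ∑ (subsets n) (λ τ → [ ∣ τ ∣ ≡ᵇ 0 ] * G (outside ∷ τ))  ≈⟨ trans (+-congʳ (∑-zero (subsets n) (λ τ → zeroˡ _))) (+-identityˡ _) ⟨
    ∑ (subsets n) (λ τ → 0# * G (inside ∷ τ)) + ∑ (subsets n) (λ τ → [ ∣ τ ∣ ≡ᵇ 0 ] * G (outside ∷ τ)) ≈⟨ ∑-subsets n _ ⟨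
    ∑ (subsets (suc n)) (λ τ → [ ∣ τ ∣ ≡ᵇ 0 ] * G τ) ∎
  ∑-mSubsets (suc n) (suc m) G = begin
    ∑ (mSubsets (suc n) (suc m)) (G ∘ proj₁)
      ≈⟨ ∑-++ (map _ (mSubsets n m)) _ _ ⟩
    ∑ (map _ (mSubsets n m)) (G ∘ proj₁) + ∑ (map _ (mSubsets n (suc m))) (G ∘ proj₁)
      ≈⟨ +-cong (∑-map _ (mSubsets n m) _) (∑-map _ (mSubsets n (suc m)) _) ⟩
    ∑ (mSubsets n m) (G ∘ (inside ∷_) ∘ proj₁) + ∑ (mSubsets n (suc m)) (G ∘ (outside ∷_) ∘ proj₁)
      ≈⟨ +-cong (∑-mSubsets n m (G ∘ (inside ∷_))) (∑-mSubsets n (suc m) (G ∘ (outside ∷_))) ⟩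
    ∑ (subsets n) (λ τ → [ ∣ τ ∣ ≡ᵇ m ] * G (inside ∷ τ)) + ∑ (subsets n) (λ τ → [ ∣ τ ∣ ≡ᵇ suc m ] * G (outside ∷ τ))
      ≈⟨ ∑-subsets n _ ⟨
    ∑ (subsets (suc n)) (λ τ → [ ∣ τ ∣ ≡ᵇ suc m ] * G τ) ∎

  module _ (char0 : ∀ n → ι (suc n) # 0#) {n m k : ℕ} (k≤m : k ≤ m) (m+k≤n : m ℕ.+ k ≤ n) (b : Fin (suc m) → Carrier) where

    open LinearAlgebra (mSubsets n m)

    private
      b̂ : ℕ → Carrier
      b̂ = extend b

      open ClosedForm m b̂

      -- The closed form of the superset sum for a κ with c points outside σ. It depends on c alone,
      -- as `∑-harmonic` requires, and at c = k - j it is the inner sum of λ_k up to the factor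
      -- binom(k,j).
      G : ℕ → Carrier
      G c = ∑ (allFin (suc (m ∸ k))) (λ p → ι (((m ∸ (k ∸ c)) choose toℕ p) ℕ.* ((n ∸ m ∸ c) choose (m ∸ k ∸ toℕ p))) * b̂ (k ∸ c ℕ.+ toℕ p))

      T-on-level : ∀ σ κ → ∣ σ ∣ ≡ m → ∣ κ ∣ ≡ k → T⟨ σ , κ ⟩ level ≈ G (∣ ∁ σ ∩ κ ∣)
      T-on-level σ κ ∣σ∣ ∣κ∣ = begin
        T⟨ σ , κ ⟩ level
          ≈⟨ T-closed (∣ σ ∩ ∁ κ ∣) (∣ ∁ σ ∩ ∁ κ ∣) (∣ σ ∩ κ ∣) (∣ ∁ σ ∩ κ ∣) (m ∸ k)
               (≡.trans (≡.cong (ℕ._+ (m ∸ k)) (≡.trans (∣∩∣+∣∁∩∣ σ κ) ∣κ∣)) (ℕ.m+[n∸m]≡n k≤m)) ⟩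
        ∑ (allFin (suc (m ∸ k))) (λ p → ι ((∣ σ ∩ ∁ κ ∣ choose toℕ p) ℕ.* (∣ ∁ σ ∩ ∁ κ ∣ choose (m ∸ k ∸ toℕ p))) * b̂ (∣ σ ∩ κ ∣ ℕ.+ toℕ p))
          ≈⟨ ∑-cong (allFin (suc (m ∸ k))) (λ p → *-cong
               (reflexive (≡.cong ι (≡.cong₂ ℕ._*_ (≡.cong (_choose toℕ p) u≡) (≡.cong (_choose (m ∸ k ∸ toℕ p)) w≡))))
               (reflexive (≡.cong (λ t → b̂ (t ℕ.+ toℕ p)) a≡))) ⟩
        G (∣ ∁ σ ∩ κ ∣) ∎
        where
        a≡ : ∣ σ ∩ κ ∣ ≡ k ∸ ∣ ∁ σ ∩ κ ∣
        a≡ = ≡.trans (≡.sym (ℕ.m+n∸n≡m _ (∣ ∁ σ ∩ κ ∣))) (≡.cong (_∸ ∣ ∁ σ ∩ κ ∣) (≡.trans (∣∩∣+∣∁∩∣ σ κ) ∣κ∣))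
        u≡ : ∣ σ ∩ ∁ κ ∣ ≡ m ∸ (k ∸ ∣ ∁ σ ∩ κ ∣)
        u≡ = ≡.trans (≡.sym (ℕ.m+n∸n≡m _ (∣ σ ∩ κ ∣))) (≡.cong₂ _∸_ (≡.trans (∣∩∁∣+∣∩∣ σ κ) ∣σ∣) a≡)
        w≡ : ∣ ∁ σ ∩ ∁ κ ∣ ≡ n ∸ m ∸ ∣ ∁ σ ∩ κ ∣
        w≡ = ≡.trans (≡.sym (ℕ.m+n∸n≡m _ (∣ ∁ σ ∩ κ ∣))) (≡.cong (_∸ ∣ ∁ σ ∩ κ ∣) (≡.trans (∣∩∁∣+∣∩∣ (∁ σ) κ)
               (≡.trans (≡.sym (ℕ.m+n∸n≡m _ (∣ σ ∣))) (≡.cong₂ _∸_ (∣∁∣+∣∣ σ) ∣σ∣))))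

      eigenvalue-as-sum : ∑ (allFin (suc k)) (λ j → ((- 1#) ^ (k ∸ toℕ j) * ι (k choose toℕ j)) * G (k ∸ toℕ j)) ≈ eigenvalue n k≤m b
      eigenvalue-as-sum = ∑-cong (allFin (suc k)) λ j → trans (sym (∑-*ˡ (allFin (suc (m ∸ k))) _ _))
        (∑-cong (allFin (suc (m ∸ k))) λ p → trans (*-assoc _ _ _) (*-congˡ (term (toℕ j) (toℕ p) (toℕ≤pred[n] j) (s≤s (≡.subst (toℕ j ℕ.+ toℕ p ≤_) (ℕ.m+[n∸m]≡n k≤m) (ℕ.+-mono-≤ (toℕ≤pred[n] j) (toℕ≤pred[n] p)))))))
        where
        -- This makes n - m - (k - j) and n - m - k + j agree under truncated subtraction.
        k≤n∸m : k ≤ n ∸ m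
        k≤n∸m = ℕ.m+n≤o⇒m≤o∸n k (≡.subst (_≤ n) (ℕ.+-comm m k) m+k≤n)
        n∸m∸[k∸j] : ∀ j → j ≤ k → n ∸ m ∸ (k ∸ j) ≡ n ∸ m ∸ k ℕ.+ j
        n∸m∸[k∸j] j j≤k = ≡.trans (≡.cong (_∸ (k ∸ j)) (≡.sym (ℕ.m∸n+n≡m k≤n∸m)))
          (≡.trans (ℕ.+-∸-assoc (n ∸ m ∸ k) (ℕ.m∸n≤m k j)) (≡.cong ((n ∸ m ∸ k) ℕ.+_) (ℕ.m∸[m∸n]≡n j≤k)))
        term : ∀ j p → j ≤ k → (j+p≤m : j ℕ.+ p < suc m) →
          ι (k choose j) * (ι (((m ∸ (k ∸ (k ∸ j))) choose p) ℕ.* ((n ∸ m ∸ (k ∸ j)) choose (m ∸ k ∸ p))) * b̂ (k ∸ (k ∸ j) ℕ.+ p))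
          ≈ ((k choose j) ℕ.* ((m ∸ j) choose p) ℕ.* ((n ∸ m ∸ k ℕ.+ j) choose (m ∸ k ∸ p))) ×ₙ b (fromℕ< j+p≤m)
        term j p j≤k j+p≤m rewrite ℕ.m∸[m∸n]≡n j≤k | n∸m∸[k∸j] j j≤k = begin
          ι x * (ι (y ℕ.* z) * b̂ (j ℕ.+ p))   ≈⟨ *-assoc _ _ _ ⟨
          (ι x * ι (y ℕ.* z)) * b̂ (j ℕ.+ p)   ≈⟨ *-congʳ (ι-* x (y ℕ.* z)) ⟨
          ι (x ℕ.* (y ℕ.* z)) * b̂ (j ℕ.+ p)   ≈⟨ *-cong (reflexive (≡.cong ι (≡.sym (ℕ.*-assoc x y z)))) (reflexive (extend-fromℕ< b _ j+p≤m)) ⟩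
          ι (x ℕ.* y ℕ.* z) * b (fromℕ< j+p≤m)  ≈⟨ ×≈ι* (x ℕ.* y ℕ.* z) _ ⟨
          (x ℕ.* y ℕ.* z) ×ₙ b (fromℕ< j+p≤m)  ∎
          where
          x = k choose j
          y = (m ∸ j) choose p
          z = (n ∸ m ∸ k ℕ.+ j) choose (m ∸ k ∸ p)

    harmonic⇒eigenvector : ∀ (f : Subset n → Carrier) → Homogeneous k f → Harmonic f → Eigenspace (B n m b) (eigenvalue n k≤m b) (Z f ∘ proj₁)
    harmonic⇒eigenvector f hom harm (σ , ∣σ∣) = begin
      ∑ (mSubsets n m) (λ τ → B n m b (σ , ∣σ∣) τ * Z f (proj₁ τ))
        ≈⟨ ∑-cong (mSubsets n m) (λ τ → *-congʳ (reflexive (≡.sym (extend-fromℕ< b (∣ σ ∩ proj₁ τ ∣) (s≤s (≡.subst (∣ σ ∩ proj₁ τ ∣ ≤_) ∣σ∣ (∣p∩q∣≤∣p∣ σ (proj₁ τ)))))))) ⟩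
      ∑ (mSubsets n m) (λ τ → b̂ (∣ σ ∩ proj₁ τ ∣) * Z f (proj₁ τ))
        ≈⟨ ∑-mSubsets n m (λ τ → b̂ (∣ σ ∩ τ ∣) * Z f τ) ⟩
      ∑ (subsets n) (λ τ → [ ∣ τ ∣ ≡ᵇ m ] * (b̂ (∣ σ ∩ τ ∣) * Z f τ))
        ≈⟨ ∑-cong (subsets n) (λ τ → trans (sym (*-assoc _ _ _)) (*-congʳ (*-congʳ (reflexive (≡.cong (λ t → [ t ≡ᵇ m ]) (≡.sym (∣∩∣+∣∁∩∣ σ τ))))))) ⟩
      ∑ (subsets n) (λ τ → level ⟨ σ , τ ⟩ * Z f τ)
        ≈⟨ ∑-Z σ level f ⟩
      ∑ (subsets n) (λ κ → T⟨ σ , κ ⟩ level * f κ)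
        ≈⟨ ∑-homogeneous hom (λ κ → T-on-level σ κ ∣σ∣) ⟩
      ∑ (subsets n) (λ κ → G (∣ ∁ σ ∩ κ ∣) * f κ)
        ≈⟨ HarmonicSums.∑-harmonic char0 f hom harm σ G ⟩
      ∑ (allFin (suc k)) (λ j → ((- 1#) ^ (k ∸ toℕ j) * ι (k choose toℕ j)) * G (k ∸ toℕ j)) * Z f σ
        ≈⟨ *-congʳ eigenvalue-as-sum ⟩
      eigenvalue n k≤m b * Z f σ ∎

  -- The eigenbasis

  -- The basis vectors are the images under Z of φ P.  Adding a new point to the
  -- ground set, up P extends φ P by zero, and down P is the Clebsch–Gordan
  -- combination of U (φ P) and φ P that D annihilates.
  φ : ∀ {n k d} → Path n k d → Subset n → Carrier
  φ start            []            = 1#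
  φ (up P)           (inside  ∷ τ) = 0#
  φ (up P)           (outside ∷ τ) = φ P τ
  φ (down {d = d} P) (inside  ∷ τ) = (- ι (suc d)) * φ P τ
  φ (down P)         (outside ∷ τ) = U (φ P) τ

  U-vanish : ∀ {n} (f : Subset n → Carrier) τ → (∀ κ → suc ∣ κ ∣ ≡ ∣ τ ∣ → f κ ≈ 0#) → U f τ ≈ 0#
  U-vanish f []            e = refl
  U-vanish f (inside  ∷ τ) e = trans (+-cong (U-vanish _ τ λ κ p → e (inside ∷ κ) (≡.cong suc p)) (e (outside ∷ τ) ≡.refl)) (+-identityˡ 0#)
  U-vanish f (outside ∷ τ) e = U-vanish _ τ λ κ p → e (outside ∷ κ) p

  φ-homogeneous : ∀ {n k d} (P : Path n k d) → Homogeneous k (φ P)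
  φ-homogeneous start    []            p = ⊥-elim (p ≡.refl)
  φ-homogeneous (up P)   (inside  ∷ τ) p = refl
  φ-homogeneous (up P)   (outside ∷ τ) p = φ-homogeneous P τ p
  φ-homogeneous (down P) (inside  ∷ τ) p = trans (*-congˡ (φ-homogeneous P τ (p ∘ ≡.cong suc))) (zeroʳ _)
  φ-homogeneous (down P) (outside ∷ τ) p = U-vanish (φ P) τ λ κ e → φ-homogeneous P κ λ q → p (≡.trans (≡.sym e) (≡.cong suc q))

  -- For a down step from height d + 1 the commutator and D (φ P) = 0 give D (U (φ P)) = (n - 2k) φ
  -- P = (d + 1) φ P. The coefficient - (d + 1) on the sets with the new point is chosen to cancel
  -- this.
  φ-harmonic : ∀ {n k d} (P : Path n k d) → Harmonic (φ P)
  φ-harmonic start    []            = refl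
  φ-harmonic (up P)   (inside  ∷ τ) = D-0 (λ _ → refl) τ
  φ-harmonic (up P)   (outside ∷ τ) = trans (+-identityʳ _) (φ-harmonic P τ)
  φ-harmonic (down P) (inside  ∷ τ) = trans (D-* _ (φ P) τ) (trans (*-congˡ (φ-harmonic P τ)) (zeroʳ _))
  φ-harmonic {suc n} {suc k} (down {d = d} P) (outside ∷ τ) = begin
    D (U (φ P)) τ + (- ι (suc d)) * φ P τ   ≈⟨ +-congʳ (+-cancelʳ _ _ _ (trans (commutator (φ P) τ) (trans (+-congʳ (U-0 (φ-harmonic P) τ)) (trans (+-identityˡ _) (weight (∣ τ ∣ ℕ.≟ k)))))) ⟩
    ι (suc d) * φ P τ + (- ι (suc d)) * φ P τ   ≈⟨ trans (sym (distribʳ _ _ _)) (trans (*-congʳ (-‿inverseʳ _)) (zeroˡ _)) ⟩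
    0# ∎
    where
    weight : Dec (∣ τ ∣ ≡ k) → ι n * φ P τ ≈ ι (suc d) * φ P τ + ι (∣ τ ∣ ℕ.+ ∣ τ ∣) * φ P τ
    weight (yes e) = trans (*-congʳ (trans (reflexive (≡.cong ι (≡.trans (path-size P)
        (≡.trans (ℕ.+-comm (k ℕ.+ k) (suc d)) (≡.cong (λ t → suc d ℕ.+ (t ℕ.+ t)) (≡.sym e)))))) (ι-+ (suc d) (∣ τ ∣ ℕ.+ ∣ τ ∣)))) (distribʳ _ _ _)
    weight (no ¬e) = trans (*-congˡ φ≈0) (trans (zeroʳ _) (sym (trans (+-cong (trans (*-congˡ φ≈0) (zeroʳ _)) (trans (*-congˡ φ≈0) (zeroʳ _))) (+-identityˡ 0#))))
      where
      φ≈0 = φ-homogeneous P τ ¬e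

  ζ : ∀ {n k d} → Path n k d → Subset n → Carrier
  ζ P = Z (φ P)

  ζ-up-inside : ∀ {n k d} (P : Path n k d) τ → ζ (up P) (inside ∷ τ) ≈ ζ P τ
  ζ-up-inside P τ = trans (+-congʳ (Z-0 (λ _ → refl) τ)) (+-identityˡ _)

  -- `Z-U` for a function supported in size k. Both children of P thus restrict to scalar multiples
  -- of ζ P, which reduces the change of basis to scalars.
  ζ-down-outside : ∀ {n k d} (P : Path n k (suc d)) τ → ζ (down P) (outside ∷ τ) ≈ (ι ∣ τ ∣ - ι k) * ζ P τ
  ζ-down-outside {k = k} P τ = begin
    Z (U (φ P)) τ                                            ≈⟨ x+y-y≈x _ _ ⟨
    (Z (U (φ P)) τ + ι k * ζ P τ) - ι k * ζ P τ              ≈⟨ +-congʳ (+-congˡ (trans (Z-cong (λ κ → scale κ (∣ κ ∣ ℕ.≟ k)) τ) (Z-* (ι k) (φ P) τ))) ⟨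
    (Z (U (φ P)) τ + Z (λ κ → ι ∣ κ ∣ * φ P κ) τ) - ι k * ζ P τ  ≈⟨ +-cong (Z-U (φ P) τ) (-‿distribˡ-* _ _) ⟩
    ι ∣ τ ∣ * ζ P τ + (- ι k) * ζ P τ                        ≈⟨ distribʳ _ _ _ ⟨
    (ι ∣ τ ∣ - ι k) * ζ P τ                                  ∎
    where
    scale : ∀ κ → Dec (∣ κ ∣ ≡ k) → ι ∣ κ ∣ * φ P κ ≈ ι k * φ P κ
    scale κ (yes e) = *-congʳ (reflexive (≡.cong ι e))
    scale κ (no ¬e) = trans (*-congˡ (φ-homogeneous P κ ¬e)) (trans (zeroʳ _) (sym (trans (*-congˡ (φ-homogeneous P κ ¬e)) (zeroʳ _))))

  ζ-down-inside : ∀ {n k d} (P : Path n k (suc d)) τ → ζ (down P) (inside ∷ τ) ≈ ((ι ∣ τ ∣ - ι k) - ι (suc d)) * ζ P τ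
  ζ-down-inside P τ = trans (+-comm _ _) (trans (+-cong (ζ-down-outside P τ) (Z-* _ (φ P) τ)) (sym (distribʳ _ _ _)))

  ιk-ιk : ∀ {M k} → M ≡ k → ι M - ι k ≈ 0#
  ιk-ιk {M} ≡.refl = -‿inverseʳ (ι M)

  ι[k+d]-ιk-ιd : ∀ {M} k d → M ≡ k ℕ.+ d → (ι M - ι k) - ι d ≈ 0#
  ι[k+d]-ιk-ιd k d ≡.refl = trans (+-congʳ (trans (+-congʳ (trans (ι-+ k d) (+-comm _ _))) (x+y-y≈x (ι d) (ι k)))) (-‿inverseʳ (ι d))

  -- A set with fewer than k points has no subset in the support of φ P; in the induction the
  -- boundary case is killed by the factor #τ - k.
  ζ-low : ∀ {n k d} (P : Path n k d) τ → ∣ τ ∣ < k → ζ P τ ≈ 0#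
  ζ-low start    []            ()
  ζ-low (up P)   (inside  ∷ τ) l = trans (ζ-up-inside P τ) (ζ-low P τ (ℕ.<-trans (ℕ.n<1+n _) l))
  ζ-low (up P)   (outside ∷ τ) l = ζ-low P τ l
  ζ-low (down P) (inside  ∷ τ) (s≤s l) = trans (ζ-down-inside P τ) (trans (*-congˡ (ζ-low P τ l)) (zeroʳ _))
  ζ-low {k = suc k} (down P) (outside ∷ τ) (s≤s l) = trans (ζ-down-outside P τ) (case (ℕ.m≤n⇒m<n∨m≡n l))
    where
    case : ∣ τ ∣ < k ⊎ ∣ τ ∣ ≡ k → (ι ∣ τ ∣ - ι k) * ζ P τ ≈ 0#
    case (inj₁ l) = trans (*-congˡ (ζ-low P τ l)) (zeroʳ _)
    case (inj₂ e) = trans (*-congʳ (ιk-ιk e)) (zeroˡ _)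

  -- The bound k + d is n - k. After a down step, the sets with the new point leave one size at
  -- which the parent need not vanish, and exactly there the coefficient (#τ - k) - (d + 1) is zero.
  ζ-high : ∀ {n k d} (P : Path n k d) τ → k ℕ.+ d < ∣ τ ∣ → ζ P τ ≈ 0#
  ζ-high start    []            ()
  ζ-high {k = k} {suc d} (up P) (inside  ∷ τ) (s≤s l) = trans (ζ-up-inside P τ) (ζ-high P τ (≡.subst (_≤ ∣ τ ∣) (ℕ.+-suc k d) l))
  ζ-high {k = k} {suc d} (up P) (outside ∷ τ) l = ζ-high P τ (ℕ.<-trans (ℕ.+-monoʳ-< k (ℕ.n<1+n d)) l)
  ζ-high {k = suc k} {d} (down P) (inside  ∷ τ) (s≤s l) = trans (ζ-down-inside P τ) (case (ℕ.m≤n⇒m<n∨m≡n (≡.subst (_≤ ∣ τ ∣) (≡.sym (ℕ.+-suc k d)) l)))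
    where
    case : k ℕ.+ suc d < ∣ τ ∣ ⊎ k ℕ.+ suc d ≡ ∣ τ ∣ → ((ι ∣ τ ∣ - ι k) - ι (suc d)) * ζ P τ ≈ 0#
    case (inj₁ l) = trans (*-congˡ (ζ-high P τ l)) (zeroʳ _)
    case (inj₂ e) = trans (*-congʳ (ι[k+d]-ιk-ιd k (suc d) (≡.sym e))) (zeroˡ _)
  ζ-high {k = suc k} {d} (down P) (outside ∷ τ) l = trans (ζ-down-outside P τ) (trans (*-congˡ (ζ-high P τ (≡.subst (_< ∣ τ ∣) (≡.sym (ℕ.+-suc k d)) l))) (zeroʳ _))

  ζʷ : ∀ {n} → Walk n → Subset n → Carrier
  ζʷ (_ , _ , P) = ζ P

  -- A walk at height zero has no down child, so its down coefficient is set to zero.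
  up-coefficient down-coefficient : ∀ {n} → (Walk (suc n) → Carrier) → Walk n → Carrier
  up-coefficient   a (k , d , P)     = a (k , suc d , up P)
  down-coefficient a (k , zero  , P) = 0#
  down-coefficient a (k , suc d , P) = a (suc k , d , down P)

  -- The coefficients of ζ P after restricting a combination to the sets without or with the new
  -- point, M being the number of remaining points: the two rows of the 2 × 2 change of basis.
  outside-coefficient inside-coefficient : ∀ {n} → (Walk (suc n) → Carrier) → ℕ → Walk n → Carrier
  outside-coefficient a M w@(k , d , _) = up-coefficient a w + down-coefficient a w * (ι M - ι k)
  inside-coefficient  a M w@(k , d , _) = up-coefficient a w + down-coefficient a w * ((ι M - ι k) - ι d)

  ∑-walks-outside : ∀ {n} (a : Walk (suc n) → Carrier) τ →
    ∑ (walks (suc n)) (λ w → a w * ζʷ w (outside ∷ τ)) ≈ ∑ (walks n) (λ w → outside-coefficient a ∣ τ ∣ w * ζʷ w τ)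
  ∑-walks-outside {n} a τ = trans (∑-concatMap children (walks n) _) (∑-cong (walks n) go)
    where
    go : ∀ w → ∑ (children w) (λ w → a w * ζʷ w (outside ∷ τ)) ≈ outside-coefficient a ∣ τ ∣ w * ζʷ w τ
    go (k , zero , P) = trans (+-identityʳ _) (*-congʳ (sym (trans (+-congˡ (zeroˡ _)) (+-identityʳ _))))
    go (k , suc d , P) = trans (+-congˡ (trans (+-identityʳ _) (trans (*-congˡ (ζ-down-outside P τ)) (sym (*-assoc _ _ _))))) (sym (distribʳ _ _ _))

  ∑-walks-inside : ∀ {n} (a : Walk (suc n) → Carrier) τ →
    ∑ (walks (suc n)) (λ w → a w * ζʷ w (inside ∷ τ)) ≈ ∑ (walks n) (λ w → inside-coefficient a ∣ τ ∣ w * ζʷ w τ)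
  ∑-walks-inside {n} a τ = trans (∑-concatMap children (walks n) _) (∑-cong (walks n) go)
    where
    go : ∀ w → ∑ (children w) (λ w → a w * ζʷ w (inside ∷ τ)) ≈ inside-coefficient a ∣ τ ∣ w * ζʷ w τ
    go (k , zero , P) = trans (+-identityʳ _) (*-cong (sym (trans (+-congˡ (zeroˡ _)) (+-identityʳ _))) (ζ-up-inside P τ))
    go (k , suc d , P) = trans (+-cong (*-congˡ (ζ-up-inside P τ)) (trans (+-identityʳ _) (trans (*-congˡ (ζ-down-inside P τ)) (sym (*-assoc _ _ _))))) (sym (distribʳ _ _ _))

  -- At total size M + 1 the outside row is taken at M + 1 and the inside row at M. Up to sign, the
  -- gap d + 1 is the determinant of the change of basis.
  coefficient-gap : ∀ M k d → ι (suc M) - ι k ≈ ((ι M - ι k) - ι d) + ι (suc d)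
  coefficient-gap M k d = sym (begin
    ((ι M - ι k) - ι d) + (1# + ι d)   ≈⟨ x+yz≈y+xz _ _ _ ⟩
    1# + (((ι M - ι k) - ι d) + ι d)   ≈⟨ +-congˡ (x-y+y≈x _ _) ⟩
    1# + (ι M - ι k)                   ≈⟨ +-assoc _ _ _ ⟨
    (1# + ι M) - ι k                   ∎)

  module _ (char0 : ∀ n → ι (suc n) # 0#) where

    -- Outside k ≤ M ≤ k + d the function ζ P vanishes at size M, and its coefficient is
    -- undetermined. Restriction to sets without and with the new point gives relations among
    -- shorter walks at sizes M and M - 1.
    walks-independent : ∀ n M (a : Walk n → Carrier) → (∀ τ → ∣ τ ∣ ≡ M → ∑ (walks n) (λ w → a w * ζʷ w τ) ≈ 0#) →
      ∀ {k d} (P : Path n k d) → k ≤ M → M ≤ k ℕ.+ d → a (k , d , P) ≈ 0#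
    walks-independent zero zero a e start z≤n z≤n = trans (sym (trans (+-identityʳ _) (*-identityʳ _))) (e [] ≡.refl)
    walks-independent (suc n) M a e = go
      where
      outside≈0 : ∀ {k d} (P : Path n k d) → k ≤ M → M ≤ k ℕ.+ d → outside-coefficient a M (k , d , P) ≈ 0#
      outside≈0 = walks-independent n M (outside-coefficient a M) λ where
        τ ≡.refl → trans (sym (∑-walks-outside a τ)) (e (outside ∷ τ) ≡.refl)
      inside≈0 : ∀ {M′} → M ≡ suc M′ → ∀ {k d} (P : Path n k d) → k ≤ M′ → M′ ≤ k ℕ.+ d → inside-coefficient a M′ (k , d , P) ≈ 0#
      inside≈0 {M′} M≡ = walks-independent n M′ (inside-coefficient a M′) λ where
        τ ≡.refl → trans (sym (∑-walks-inside a τ)) (e (inside ∷ τ) (≡.sym M≡))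
      -- Subtracting the inside relation from the outside one leaves d + 1 times the down
      -- coefficient.
      down≈0 : ∀ {k d} (P : Path n k d) → k < M → M ≤ k ℕ.+ d → down-coefficient a (k , d , P) ≈ 0#
      down≈0 {k} {d} P (s≤s {n = M′} k≤M′) M≤ = *≈0⇒≈0 (char0 d) (trans (*-comm _ _) (begin
        y * ι (suc d)                                                        ≈⟨ +-identityˡ _ ⟨
        0# + y * ι (suc d)                                                   ≈⟨ +-congʳ (inside≈0 ≡.refl P k≤M′ (ℕ.≤-trans (ℕ.n≤1+n M′) M≤)) ⟨
        (x + y * ((ι M′ - ι k) - ι d)) + y * ι (suc d)                       ≈⟨ trans (+-assoc _ _ _) (+-congˡ (sym (distribˡ _ _ _))) ⟩
        x + y * (((ι M′ - ι k) - ι d) + ι (suc d))                           ≈⟨ +-congˡ (*-congˡ (coefficient-gap M′ k d)) ⟨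
        x + y * (ι (suc M′) - ι k)                                           ≈⟨ outside≈0 P (ℕ.m≤n⇒m≤1+n k≤M′) M≤ ⟩
        0#                                                                   ∎))
        where
        x = up-coefficient a (k , d , P)
        y = down-coefficient a (k , d , P)
      -- At M = k the outside relation multiplies the down coefficient by M - k = 0. At M = k + d +
      -- 1 only the inside relation is available, with factor (M - 1 - k) - d = 0. In between the
      -- down coefficient is already zero.
      up≈0 : ∀ {k d} (P : Path n k d) → k ≤ M → M ≤ k ℕ.+ suc d → up-coefficient a (k , d , P) ≈ 0#
      up≈0 {k} {d} P k≤M M≤ with ℕ.m≤n⇒m<n∨m≡n k≤M
      ... | inj₂ k≡M = trans (sym (trans (+-congˡ (trans (*-congˡ (ιk-ιk (≡.sym k≡M))) (zeroʳ _))) (+-identityʳ _)))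
            (outside≈0 P k≤M (≡.subst (_≤ k ℕ.+ d) k≡M (ℕ.m≤m+n k d)))
      ... | inj₁ k<M with ℕ.m≤n⇒m<n∨m≡n (≡.subst (M ≤_) (ℕ.+-suc k d) M≤)
      ...   | inj₁ (s≤s M≤k+d) = trans (sym (trans (+-congˡ (trans (*-congʳ (down≈0 P k<M M≤k+d)) (zeroˡ _))) (+-identityʳ _))) (outside≈0 P k≤M M≤k+d)
      ...   | inj₂ M≡ = trans (sym (trans (+-congˡ (trans (*-congˡ (ι[k+d]-ιk-ιd k d ≡.refl)) (zeroʳ _))) (+-identityʳ _)))
                (inside≈0 M≡ P (ℕ.m≤m+n k d) ℕ.≤-refl)
      go : ∀ {k d} (P : Path (suc n) k d) → k ≤ M → M ≤ k ℕ.+ d → a (k , d , P) ≈ 0#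
      go (up P)   l h = up≈0 P l h
      go {suc k} {d} (down P) l h = down≈0 P l (≡.subst (M ≤_) (≡.sym (ℕ.+-suc k d)) h)

    -- The restrictions of G to the sets without and with the new point are expanded by induction
    -- with coefficients a₀ and a₁; for each shorter walk a 2 × 2 system is then solved for the
    -- coefficients of its children.
    walks-spanning : ∀ n M (G : Subset n → Carrier) →
      Σ (Walk n → Carrier) λ a → ∀ τ → ∣ τ ∣ ≡ M → G τ ≈ ∑ (walks n) (λ w → a w * ζʷ w τ)
    walks-spanning zero M G = (λ _ → G []) , λ where [] _ → sym (trans (+-identityʳ _) (*-identityʳ _))
    walks-spanning (suc n) M G = a , λ where
        (outside ∷ τ) e → trans (eq₀ τ e) (trans (∑-cong (walks n) (outside≈ τ e)) (sym (∑-walks-outside a τ)))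
        (inside  ∷ τ) e → trans (eq₁ τ (≡.cong ℕ.pred e)) (trans (∑-cong (walks n) (inside≈ τ e)) (sym (∑-walks-inside a τ)))
      where
      a₀ a₁ : Walk n → Carrier
      a₀ = proj₁ (walks-spanning n M (G ∘ (outside ∷_)))
      a₁ = proj₁ (walks-spanning n (ℕ.pred M) (G ∘ (inside ∷_)))
      eq₀ = proj₂ (walks-spanning n M (G ∘ (outside ∷_)))
      eq₁ = proj₂ (walks-spanning n (ℕ.pred M) (G ∘ (inside ∷_)))
      inv : ℕ → Carrier
      inv d = proj₁ (#0⇒Unit (char0 d))
      x y : Walk n → Carrier
      -- Cramer's rule with determinant d + 1.
      y w@(k , d , _) = (a₀ w - a₁ w) * inv d
      x w@(k , d , _) = a₀ w - y w * (ι M - ι k)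
      a : Walk (suc n) → Carrier
      a (_ , _ , up P)   = x (_ , _ , P)
      a (_ , _ , down P) = y (_ , _ , P)
      solves₀ : ∀ w → x w + y w * (ι M - ι (proj₁ w)) ≈ a₀ w
      solves₀ w = x-y+y≈x _ _
      solves₁ : ∀ {M′} → suc M′ ≡ M → ∀ w → x w + y w * ((ι M′ - ι (proj₁ w)) - ι (proj₁ (proj₂ w))) ≈ a₁ w
      solves₁ {M′} ≡.refl w@(k , d , _) = begin
        x w + y w * t                                       ≈⟨ x+y-y≈x _ _ ⟨
        ((x w + y w * t) + y w * ι (suc d)) - y w * ι (suc d)  ≈⟨ +-congʳ (trans (+-assoc _ _ _) (+-congˡ (trans (sym (distribˡ _ _ _)) (*-congˡ (sym (coefficient-gap M′ k d)))))) ⟩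
        (x w + y w * (ι (suc M′) - ι k)) - y w * ι (suc d)  ≈⟨ +-cong (solves₀ w) (-‿cong (trans (*-assoc _ _ _) (trans (*-congˡ (trans (*-comm _ _) (proj₂ (#0⇒Unit (char0 d))))) (*-identityʳ _)))) ⟩
        a₀ w - (a₀ w - a₁ w)                                ≈⟨ +-congʳ (trans (+-comm _ _) (x-y+y≈x _ _)) ⟨
        (a₁ w + (a₀ w - a₁ w)) - (a₀ w - a₁ w)              ≈⟨ x+y-y≈x _ _ ⟩
        a₁ w                                                ∎
        where t = (ι M′ - ι k) - ι d
      -- A walk of height zero has no down child, so its y has to be discarded. This is legitimate
      -- because ζ P then lives only at size k, where y is multiplied by 0.
      drop : ∀ w {s t : Carrier} → t ≈ 0# → x w + y w * t ≈ s → s ≈ x w + 0# * t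
      drop w t≈0 e = trans (sym e) (+-congˡ (trans (*-congˡ t≈0) (trans (zeroʳ _) (sym (zeroˡ _)))))
      outside≈ : ∀ τ → ∣ τ ∣ ≡ M → ∀ w → a₀ w * ζʷ w τ ≈ outside-coefficient a ∣ τ ∣ w * ζʷ w τ
      outside≈ τ ≡.refl (k , suc d , P) = *-congʳ (sym (solves₀ (k , suc d , P)))
      outside≈ τ ≡.refl (k , zero  , P) with ℕ.<-cmp ∣ τ ∣ k
      ... | tri≈ _ e _ = *-congʳ (drop (k , 0 , P) (ιk-ιk e) (solves₀ (k , 0 , P)))
      ... | tri< l _ _ = trans (*-congˡ (ζ-low P τ l)) (trans (zeroʳ _) (sym (trans (*-congˡ (ζ-low P τ l)) (zeroʳ _))))
      ... | tri> _ _ h = let v = ζ-high P τ (≡.subst (_< ∣ τ ∣) (≡.sym (ℕ.+-identityʳ k)) h) in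
            trans (*-congˡ v) (trans (zeroʳ _) (sym (trans (*-congˡ v) (zeroʳ _))))
      inside≈ : ∀ τ → suc ∣ τ ∣ ≡ M → ∀ w → a₁ w * ζʷ w τ ≈ inside-coefficient a ∣ τ ∣ w * ζʷ w τ
      inside≈ τ e (k , suc d , P) = *-congʳ (sym (solves₁ e (k , suc d , P)))
      inside≈ τ e (k , zero  , P) with ℕ.<-cmp ∣ τ ∣ k
      ... | tri≈ _ p _ = *-congʳ (drop (k , 0 , P) (ι[k+d]-ιk-ιd k 0 (≡.trans p (≡.sym (ℕ.+-identityʳ k)))) (solves₁ e (k , 0 , P)))
      ... | tri< l _ _ = trans (*-congˡ (ζ-low P τ l)) (trans (zeroʳ _) (sym (trans (*-congˡ (ζ-low P τ l)) (zeroʳ _))))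
      ... | tri> _ _ h = let v = ζ-high P τ (≡.subst (_< ∣ τ ∣) (≡.sym (ℕ.+-identityʳ k)) h) in
            trans (*-congˡ v) (trans (zeroʳ _) (sym (trans (*-congˡ v) (zeroʳ _))))

  -- Multiplicities

  ∑-zero-∈ : ∀ {a} {A : Set a} {f : A → Carrier} xs → (∀ {x} → x ∈ xs → f x ≈ 0#) → ∑ xs f ≈ 0#
  ∑-zero-∈ xs e = trans (∑-cong-∈ xs e) (∑-zero xs λ _ → refl)

  ∑-single : ∀ {a} {A : Set a} {xs : List A} {x} (g : A → Carrier) → Unique xs → x ∈ xs → (∀ {y} → y ≢ x → g y ≈ 0#) → ∑ xs g ≈ g x
  ∑-single {xs = _ ∷ xs} g (x∉ ∷ _) (here ≡.refl) e = trans (+-congˡ (∑-zero-∈ xs λ y∈ → e (All.lookup x∉ y∈ ∘ ≡.sym))) (+-identityʳ _)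
  ∑-single {xs = y ∷ xs} g (y∉ ∷ u) (there x∈) e = trans (+-cong (e (All.lookup y∉ x∈)) (∑-single g u x∈ e)) (+-identityˡ _)

  lookup-injective : ∀ {a} {A : Set a} {xs : List A} → Unique xs → ∀ i j → List.lookup xs i ≡ List.lookup xs j → i ≡ j
  lookup-injective (_  ∷ u) zero    zero    e = ≡.refl
  lookup-injective (x∉ ∷ u) zero    (suc j) e = ⊥-elim (All.lookup x∉ (∈-lookup j) e)
  lookup-injective (x∉ ∷ u) (suc i) zero    e = ⊥-elim (All.lookup x∉ (∈-lookup i) (≡.sym e))
  lookup-injective (_  ∷ u) (suc i) (suc j) e = ≡.cong suc (lookup-injective u i j e)

  -- If w = Σ a_j v_j and (A - μ)^r w = 0, independence gives (value j - μ)^r a_j = 0, and a power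
  -- of an invertible scalar cancels; so the selected vectors span the generalized eigenspace as
  -- well. `Basic` marks the vectors with determined coefficients, since the family may also contain
  -- zero vectors.
  module Diagonalization {I : Set} (enum : List I) (A : LinearAlgebra.Matrix enum)
    {J : Set} (_≟_ : DecidableEquality J) {js : List J} (unique : Unique js)
    (v : J → LinearAlgebra.V enum) (value : J → Carrier) (Basic : J → Set)
    (eigen : ∀ j → LinearAlgebra.Eigenspace enum A (value j) (v j))
    (independent : ∀ (a : J → Carrier) → (∀ i → ∑ js (λ j → a j * v j i) ≈ 0#) → ∀ j → Basic j → a j ≈ 0#)
    (spanning : ∀ (w : LinearAlgebra.V enum) → Σ (J → Carrier) λ a → ∀ i → w i ≈ ∑ js (λ j → a j * v j i))
    (μ : Carrier) {Selected : J → Set} (selected? : Decidable Selected)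
    (selected-value : ∀ j → Selected j → Basic j × value j ≈ μ)
    (unselected-value : ∀ j → ¬ Selected j → (Basic j × value j # μ) ⊎ (∀ i → v j i ≈ 0#))
    where

    open LinearAlgebra enum

    private
      chosen : List J
      chosen = List.filter selected? js

      chosen-unique : Unique chosen
      chosen-unique = Unique.filter⁺ selected? unique

      vᶜ : Fin (List.length chosen) → V
      vᶜ i = v (List.lookup chosen i)

      lookup∈ : ∀ i → List.lookup chosen i ∈ js × Selected (List.lookup chosen i)
      lookup∈ i = ∈-filter⁻ selected? (∈-lookup {xs = chosen} i)

      eigen′ : ∀ i → Eigenspace A μ (vᶜ i)
      eigen′ i σ = trans (eigen _ σ) (*-congʳ (proj₂ (selected-value _ (proj₂ (lookup∈ i)))))

      Eigenspace⊆Generalized : ∀ {w} → Eigenspace A μ w → GeneralizedEigenspace A μ w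
      Eigenspace⊆Generalized {w} e = 1 , λ i → trans (+-cong (e i) (sym (-‿distribˡ-* _ _))) (-‿inverseʳ _)

      independent′ : ∀ a → combination a vᶜ ≋ 0ᵛ → ∀ i → a i ≈ 0#
      independent′ a e i = trans (sym (a′-lookup i)) (independent a′ (λ σ → trans (a′-sum σ) (e σ)) _ (proj₁ (selected-value _ (proj₂ (lookup∈ i)))))
        where
        fins = allFin (List.length chosen)
        -- Coefficients on the chosen vectors are extended by zero to the whole family, so that the
        -- given independence applies.
        a′ : J → Carrier
        a′ j = ∑ fins (λ i → a i * [ does (j ≟ List.lookup chosen i) ])
        yes′ : ∀ {j j′} → j ≡ j′ → [ does (j ≟ j′) ] ≈ 1#
        yes′ {j} {j′} e with j ≟ j′
        ... | yes _ = refl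
        ... | no ¬e = ⊥-elim (¬e e)
        no′ : ∀ {j j′} → j ≢ j′ → [ does (j ≟ j′) ] ≈ 0#
        no′ {j} {j′} ¬e with j ≟ j′
        ... | yes e = ⊥-elim (¬e e)
        ... | no _  = refl
        a′-lookup : ∀ i → a′ (List.lookup chosen i) ≈ a i
        a′-lookup i = trans (∑-single _ (Unique.tabulate⁺ id) (∈-allFin i) λ {i′} i′≢i → trans (*-congˡ (no′ (i′≢i ∘ ≡.sym ∘ lookup-injective chosen-unique i i′))) (zeroʳ _))
          (trans (*-congˡ (yes′ {List.lookup chosen i} ≡.refl)) (*-identityʳ _))
        a′-sum : ∀ σ → ∑ js (λ j → a′ j * v j σ) ≈ combination a vᶜ σ
        a′-sum σ = begin
          ∑ js (λ j → a′ j * v j σ)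
            ≈⟨ ∑-cong js (λ j → trans (sym (∑-*ʳ fins _ _)) (∑-cong fins λ i → *-assoc _ _ _)) ⟩
          ∑ js (λ j → ∑ fins (λ i → a i * ([ does (j ≟ List.lookup chosen i) ] * v j σ)))
            ≈⟨ ∑-swap js fins _ ⟩
          ∑ fins (λ i → ∑ js (λ j → a i * ([ does (j ≟ List.lookup chosen i) ] * v j σ)))
            ≈⟨ ∑-cong fins (λ i → trans (∑-*ˡ js _ _) (*-congˡ (trans
                 (∑-single _ unique (proj₁ (lookup∈ i)) λ y≢x → trans (*-congʳ (no′ y≢x)) (zeroˡ _))
                 (trans (*-congʳ (yes′ {List.lookup chosen i} ≡.refl)) (*-identityˡ _))))) ⟩
          combination a vᶜ σ ∎

      power-sum : ∀ (a : J → Carrier) w → (∀ i → w i ≈ ∑ js (λ j → a j * v j i)) → ∀ r i →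
        fold w (A -scalar μ) r i ≈ ∑ js (λ j → ((value j - μ) ^ r * a j) * v j i)
      power-sum a w e zero i = trans (e i) (∑-cong js λ j → *-congʳ (sym (*-identityˡ _)))
      power-sum a w e (suc r) i = begin
        (A · u) i + (- μ) * u i
          ≈⟨ +-cong (∑-cong enum λ i′ → *-congˡ (ih i′)) (*-congˡ (ih i)) ⟩
        ∑ enum (λ i′ → A i i′ * ∑ js (λ j → x j * v j i′)) + (- μ) * ∑ js (λ j → x j * v j i)
          ≈⟨ +-cong apply (sym (∑-*ˡ js _ _)) ⟩
        ∑ js (λ j → x j * (value j * v j i)) + ∑ js (λ j → (- μ) * (x j * v j i))
          ≈⟨ ∑-+ js _ _ ⟨
        ∑ js (λ j → x j * (value j * v j i) + (- μ) * (x j * v j i))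
          ≈⟨ ∑-cong js (λ j → trans (+-congʳ (x*yz≈y*xz _ _ _)) (trans (sym (distribʳ _ _ _)) (trans (sym (*-assoc _ _ _)) (*-congʳ (sym (*-assoc _ _ _)))))) ⟩
        ∑ js (λ j → ((value j - μ) ^ suc r * a j) * v j i) ∎
        where
        u = fold w (A -scalar μ) r
        x : J → Carrier
        x j = (value j - μ) ^ r * a j
        ih = power-sum a w e r
        apply : ∑ enum (λ i′ → A i i′ * ∑ js (λ j → x j * v j i′)) ≈ ∑ js (λ j → x j * (value j * v j i))
        apply = begin
          ∑ enum (λ i′ → A i i′ * ∑ js (λ j → x j * v j i′))
            ≈⟨ ∑-cong enum (λ i′ → trans (sym (∑-*ˡ js _ _)) (∑-cong js λ j → x*yz≈y*xz _ _ _)) ⟩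
          ∑ enum (λ i′ → ∑ js (λ j → x j * (A i i′ * v j i′)))
            ≈⟨ ∑-swap enum js _ ⟩
          ∑ js (λ j → ∑ enum (λ i′ → x j * (A i i′ * v j i′)))
            ≈⟨ ∑-cong js (λ j → trans (∑-*ˡ enum _ _) (*-congˡ (eigen j i))) ⟩
          ∑ js (λ j → x j * (value j * v j i)) ∎

      spanning′ : ∀ w → GeneralizedEigenspace A μ w → ∃[ a ] w ≋ combination a vᶜ
      spanning′ w (r , e) = (λ i → a (List.lookup chosen i)) , λ i → begin
        w i                                                       ≈⟨ proj₂ (spanning w) i ⟩
        ∑ js (λ j → a j * v j i)                                  ≈⟨ ∑-cong js (λ j → restrict i j (selected? j)) ⟩
        ∑ js (λ j → [ does (selected? j) ] * (a j * v j i))       ≈⟨ ∑-filter selected? js _ ⟨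
        ∑ chosen (λ j → a j * v j i)                              ≈⟨ ∑-lookup chosen _ ⟨
        combination (λ i → a (List.lookup chosen i)) vᶜ i         ∎
        where
        a : J → Carrier
        a = proj₁ (spanning w)
        a≈0 : ∀ j → Basic j → value j # μ → a j ≈ 0#
        a≈0 j basic p = *≈0⇒≈0 (^-#0 _ r (#⇒-#0 p)) (independent (λ j → (value j - μ) ^ r * a j)
          (λ i → trans (sym (power-sum a w (proj₂ (spanning w)) r i)) (e i)) j basic)
        restrict : ∀ i j (s : Dec (Selected j)) → a j * v j i ≈ [ does s ] * (a j * v j i)
        restrict i j (yes _) = sym (*-identityˡ _)
        restrict i j (no ¬s) = trans (case (unselected-value j ¬s)) (sym (zeroˡ _))
          where
          case : (Basic j × value j # μ) ⊎ (∀ i → v j i ≈ 0#) → a j * v j i ≈ 0#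
          case (inj₁ (basic , p)) = trans (*-congʳ (a≈0 j basic p)) (zeroˡ _)
          case (inj₂ v≈0) = trans (*-congˡ (v≈0 i)) (zeroʳ _)

    hasMultiplicity : HasMultiplicity A μ (List.length (List.filter selected? js))
    hasMultiplicity =
        (vᶜ , eigen′ , independent′ , λ w e → spanning′ w (Eigenspace⊆Generalized e))
      , (vᶜ , (λ i → Eigenspace⊆Generalized (eigen′ i)) , independent′ , spanning′)

  module _ (char0 : ∀ n → ι (suc n) # 0#) {n m k : ℕ} (2m≤n : m ℕ.+ m ≤ n) (k≤m : k ≤ m) (b : Fin (suc m) → Carrier) where

    private
      -- Walks with more than m down steps give the zero vector at size m, which satisfies the
      -- eigenvector equation for every scalar; 0 is picked.
      value′ : ∀ {κ} → Dec (κ ≤ m) → Carrier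
      value′ (yes κ≤m) = eigenvalue n κ≤m b
      value′ (no _)    = 0#

      value : Walk n → Carrier
      value (κ , _) = value′ (κ ℕ.≤? m)

      vec : Walk n → MSubset n m → Carrier
      vec w = ζʷ w ∘ proj₁

      vec≈0 : ∀ w → ¬ (proj₁ w ≤ m) → ∀ i → vec w i ≈ 0#
      vec≈0 (_ , _ , P) κ≰m (τ , e) = ζ-low P τ (≡.subst (_< _) (≡.sym e) (ℕ.≰⇒> κ≰m))

      value-eigenvalue : ∀ {κ} (κ≤m : κ ≤ m) (d : Dec (κ ≤ m)) → value′ d ≈ eigenvalue n κ≤m b
      value-eigenvalue κ≤m (yes p) = reflexive (≡.cong (λ q → eigenvalue n q b) (ℕ.≤-irrelevant p κ≤m))
      value-eigenvalue κ≤m (no ¬p) = ⊥-elim (¬p κ≤m)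

      eigen : ∀ w → LinearAlgebra.Eigenspace (mSubsets n m) (B n m b) (value w) (vec w)
      eigen w@(κ , d , P) i with κ ℕ.≤? m
      ... | yes κ≤m = harmonic⇒eigenvector char0 κ≤m (ℕ.≤-trans (ℕ.+-monoʳ-≤ m κ≤m) 2m≤n) b (φ P) (φ-homogeneous P) (φ-harmonic P) i
      ... | no κ≰m = trans (∑-zero (mSubsets n m) λ i′ → trans (*-congˡ (vec≈0 w κ≰m i′)) (zeroʳ _)) (sym (zeroˡ _))

      -- From m + κ ≤ 2m ≤ n follows m ≤ n - κ; so every walk with κ ≤ m is in the range of
      -- `walks-independent`.
      m≤k+d : ∀ {κ d} → Path n κ d → κ ≤ m → m ≤ κ ℕ.+ d
      m≤k+d {κ} {d} P κ≤m with m ℕ.≤? κ ℕ.+ d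
      ... | yes p = p
      ... | no ¬p = ⊥-elim (ℕ.<-irrefl ≡.refl (ℕ.≤-trans
        (ℕ.≤-trans (ℕ.+-mono-<-≤ (ℕ.≰⇒> ¬p) κ≤m) 2m≤n)
        (ℕ.≤-reflexive (≡.trans (path-size P) (≡.trans (ℕ.+-assoc κ κ d) (ℕ.+-comm κ (κ ℕ.+ d)))))))

      independent : ∀ (a : Walk n → Carrier) → (∀ i → ∑ (walks n) (λ w → a w * vec w i) ≈ 0#) → ∀ (w : Walk n) → proj₁ w ≤ m → a w ≈ 0#
      independent a e (κ , d , P) κ≤m = walks-independent char0 n m a (λ τ p → e (τ , p)) P κ≤m (m≤k+d P κ≤m)

      spanning : ∀ (w : MSubset n m → Carrier) → Σ (Walk n → Carrier) λ a → ∀ i → w i ≈ ∑ (walks n) (λ j → a j * vec j i)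
      spanning w = proj₁ s , λ (τ , e) → trans (agree τ e (∣ τ ∣ ℕ.≟ m)) (proj₂ s τ e)
        where
        total : ∀ τ → Dec (∣ τ ∣ ≡ m) → Carrier
        total τ (yes p) = w (τ , p)
        total τ (no _)  = 0#
        s = walks-spanning char0 n m (λ τ → total τ (∣ τ ∣ ℕ.≟ m))
        agree : ∀ τ e d → w (τ , e) ≈ total τ d
        agree τ e (yes p) = reflexive (≡.cong (λ q → w (τ , q)) (ℕ.≡-irrelevant e p))
        agree τ e (no ¬p) = ⊥-elim (¬p e)

    separated⇒hasMultiplicity : (∀ {j} (j≤m : j ≤ m) → j ≢ k → eigenvalue n j≤m b # eigenvalue n k≤m b) →
      LinearAlgebra.HasMultiplicity (mSubsets n m) (B n m b) (eigenvalue n k≤m b) (List.length (List.filter (λ w → proj₁ w ℕ.≟ k) (walks n)))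
    separated⇒hasMultiplicity separated = Diagonalization.hasMultiplicity (mSubsets n m) (B n m b) _≟ʷ_ (walks-unique n)
      vec value (λ w → proj₁ w ≤ m) eigen independent spanning (eigenvalue n k≤m b) (λ w → proj₁ w ℕ.≟ k)
      (λ where (κ , _) ≡.refl → k≤m , value-eigenvalue k≤m (κ ℕ.≤? m))
      unselected
      where
      unselected : ∀ w → proj₁ w ≢ k → (proj₁ w ≤ m × value w # eigenvalue n k≤m b) ⊎ (∀ i → vec w i ≈ 0#)
      unselected w@(κ , _) κ≢k with κ ℕ.≤? m
      ... | yes κ≤m = inj₁ (κ≤m , separated κ≤m κ≢k)
      ... | no κ≰m = inj₂ (vec≈0 w κ≰m)

  -- Genericity

  -- One point with value apart from zero yields a coefficient apart from zero, by cotransitivity at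
  -- every step; no coefficient has to be computed.
  eval#0⇒nonzero : ∀ r (p : Polynomial r) b → eval r p b # 0# → NonzeroPolynomial r p
  eval#0⇒nonzero zero    p        b e = lift e
  eval#0⇒nonzero (suc r) []       b e = ⊥-elim (#-irrefl refl e)
  eval#0⇒nonzero (suc r) (p ∷ ps) b e with +-#0 _ _ e
  ... | inj₁ q = here (eval#0⇒nonzero r p (b ∘ suc) q)
  ... | inj₂ q = there (eval#0⇒nonzero (suc r) ps b (*-#0⁻ʳ _ _ q))

  constᵖ : ∀ r → Carrier → Polynomial r
  constᵖ zero    x = x
  constᵖ (suc r) x = constᵖ r x ∷ []

  varᵖ : ∀ {r} → Fin r → Polynomial r
  varᵖ {suc r} zero    = constᵖ r 0# ∷ constᵖ r 1# ∷ []
  varᵖ {suc r} (suc i) = varᵖ i ∷ []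

  addᵖ : ∀ r → Polynomial r → Polynomial r → Polynomial r
  addᵖ zero    p        q        = p + q
  addᵖ (suc r) []       qs       = qs
  addᵖ (suc r) (p ∷ ps) []       = p ∷ ps
  addᵖ (suc r) (p ∷ ps) (q ∷ qs) = addᵖ r p q ∷ addᵖ (suc r) ps qs

  mulᵖ : ∀ r → Polynomial r → Polynomial r → Polynomial r
  mulᵖ zero    p        q  = p * q
  mulᵖ (suc r) []       qs = []
  mulᵖ (suc r) (p ∷ ps) qs = addᵖ (suc r) (map (mulᵖ r p) qs) (constᵖ r 0# ∷ mulᵖ (suc r) ps qs)

  eval-const : ∀ r x b → eval r (constᵖ r x) b ≈ x
  eval-const zero    x b = refl
  eval-const (suc r) x b = trans (+-cong (eval-const r x (b ∘ suc)) (zeroʳ _)) (+-identityʳ x)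

  eval-var : ∀ {r} (i : Fin r) b → eval r (varᵖ i) b ≈ b i
  eval-var {suc r} zero b = trans (+-cong (eval-const r 0# (b ∘ suc)) (*-congˡ (trans (+-cong (eval-const r 1# (b ∘ suc)) (zeroʳ _)) (+-identityʳ _)))) (trans (+-identityˡ _) (*-identityʳ _))
  eval-var {suc r} (suc i) b = trans (+-cong (eval-var i (b ∘ suc)) (zeroʳ _)) (+-identityʳ _)

  eval-add : ∀ r p q b → eval r (addᵖ r p q) b ≈ eval r p b + eval r q b
  eval-add zero    p        q        b = refl
  eval-add (suc r) []       qs       b = sym (+-identityˡ _)
  eval-add (suc r) (p ∷ ps) []       b = sym (+-identityʳ _)
  eval-add (suc r) (p ∷ ps) (q ∷ qs) b = trans (+-cong (eval-add r p q (b ∘ suc)) (trans (*-congˡ (eval-add (suc r) ps qs b)) (distribˡ _ _ _))) (+-interchange _ _ _ _)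

  eval-mul : ∀ r p q b → eval r (mulᵖ r p q) b ≈ eval r p b * eval r q b
  eval-mul zero    p        q  b = refl
  eval-mul (suc r) []       qs b = sym (zeroˡ _)
  eval-mul (suc r) (p ∷ ps) qs b = begin
    eval (suc r) (addᵖ (suc r) (map (mulᵖ r p) qs) (constᵖ r 0# ∷ mulᵖ (suc r) ps qs)) b
      ≈⟨ eval-add (suc r) (map (mulᵖ r p) qs) _ b ⟩
    eval (suc r) (map (mulᵖ r p) qs) b + (eval r (constᵖ r 0#) (b ∘ suc) + b zero * eval (suc r) (mulᵖ (suc r) ps qs) b)
      ≈⟨ +-cong (scale qs) (trans (+-cong (eval-const r 0# (b ∘ suc)) (*-congˡ (eval-mul (suc r) ps qs b))) (trans (+-identityˡ _) (sym (*-assoc _ _ _)))) ⟩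
    eval r p (b ∘ suc) * eval (suc r) qs b + (b zero * eval (suc r) ps b) * eval (suc r) qs b
      ≈⟨ distribʳ _ _ _ ⟨
    eval (suc r) (p ∷ ps) b * eval (suc r) qs b ∎
    where
    scale : ∀ qs → eval (suc r) (map (mulᵖ r p) qs) b ≈ eval r p (b ∘ suc) * eval (suc r) qs b
    scale []       = sym (zeroʳ _)
    scale (q ∷ qs) = trans (+-cong (eval-mul r p q (b ∘ suc)) (trans (*-congˡ (scale qs)) (x*yz≈y*xz _ _ _))) (sym (distribˡ _ _ _))

  -- Genericity refers to a polynomial only through its values and its being nonzero, and one good
  -- value ensures the latter; so closure under sums and products suffices, without normal forms.
  IsPolynomial : ∀ r → ((Fin r → Carrier) → Carrier) → Set (c ⊔ ℓ₁)
  IsPolynomial r f = Σ (Polynomial r) λ p → ∀ b → eval r p b ≈ f b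

  module _ {r : ℕ} where

    poly-const : ∀ x → IsPolynomial r (λ _ → x)
    poly-const x = constᵖ r x , eval-const r x

    poly-var : ∀ i → IsPolynomial r (λ b → b i)
    poly-var i = varᵖ i , eval-var i

    poly-+ : ∀ {f g} → IsPolynomial r f → IsPolynomial r g → IsPolynomial r (λ b → f b + g b)
    poly-+ (p , ep) (q , eq) = addᵖ r p q , λ b → trans (eval-add r p q b) (+-cong (ep b) (eq b))

    poly-* : ∀ {f g} → IsPolynomial r f → IsPolynomial r g → IsPolynomial r (λ b → f b * g b)
    poly-* (p , ep) (q , eq) = mulᵖ r p q , λ b → trans (eval-mul r p q b) (*-cong (ep b) (eq b))

    poly-cong : ∀ {f g} → (∀ b → f b ≈ g b) → IsPolynomial r f → IsPolynomial r g
    poly-cong e (p , ep) = p , λ b → trans (ep b) (e b)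

    poly-neg : ∀ {f} → IsPolynomial r f → IsPolynomial r (λ b → - f b)
    poly-neg pf = poly-cong (λ b → -1*x≈-x _) (poly-* (poly-const (- 1#)) pf)

    poly-× : ∀ n {f} → IsPolynomial r f → IsPolynomial r (λ b → n ×ₙ f b)
    poly-× n pf = poly-cong (λ b → sym (×≈ι* n _)) (poly-* (poly-const (ι n)) pf)

    poly-∑ : ∀ {a} {A : Set a} (xs : List A) {f : A → (Fin r → Carrier) → Carrier} → (∀ x → IsPolynomial r (f x)) → IsPolynomial r (λ b → ∑ xs (λ x → f x b))
    poly-∑ []       pf = poly-const 0#
    poly-∑ (x ∷ xs) pf = poly-+ (pf x) (poly-∑ xs pf)

  j+p≤m : ∀ {m k} → k ≤ m → (j : Fin (suc k)) (p : Fin (suc (m ∸ k))) → toℕ j ℕ.+ toℕ p < suc m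
  j+p≤m k≤m j p = s≤s (≡.subst (toℕ j ℕ.+ toℕ p ≤_) (ℕ.m+[n∸m]≡n k≤m) (ℕ.+-mono-≤ (toℕ≤pred[n] j) (toℕ≤pred[n] p)))

  eigenvalue-polynomial : ∀ n {m k} (k≤m : k ≤ m) → IsPolynomial (suc m) (eigenvalue n k≤m)
  eigenvalue-polynomial n {m} {k} k≤m = poly-∑ (allFin (suc k)) λ j → poly-∑ (allFin (suc (m ∸ k))) λ p →
    poly-* (poly-const _) (poly-× ((k choose toℕ j) ℕ.* ((m ∸ toℕ j) choose toℕ p) ℕ.* ((n ∸ m ∸ k ℕ.+ toℕ j) choose (m ∸ k ∸ toℕ p))) (poly-var (fromℕ< (j+p≤m k≤m j p))))

  ∏ : ∀ {a} {A : Set a} → List A → (A → Carrier) → Carrier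
  ∏ xs f = List.foldr (λ x s → f x * s) 1# xs

  ∏-#0 : ∀ {a} {A : Set a} (xs : List A) (f : A → Carrier) → (∀ x → f x # 0#) → ∏ xs f # 0#
  ∏-#0 []       f e = 1#0
  ∏-#0 (x ∷ xs) f e = *-#0 _ _ (e x) (∏-#0 xs f e)

  ∏-#0⁻ : ∀ {a} {A : Set a} {xs : List A} {x} (f : A → Carrier) → ∏ xs f # 0# → x ∈ xs → f x # 0#
  ∏-#0⁻ f e (here ≡.refl) = *-#0⁻ˡ _ _ e
  ∏-#0⁻ f e (there x∈)    = ∏-#0⁻ f (*-#0⁻ʳ _ _ e) x∈

  poly-∏ : ∀ {r} {a} {A : Set a} (xs : List A) {f : A → (Fin r → Carrier) → Carrier} → (∀ x → IsPolynomial r (f x)) → IsPolynomial r (λ b → ∏ xs (λ x → f x b))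
  poly-∏ []       pf = poly-const 1#
  poly-∏ (x ∷ xs) pf = poly-* (pf x) (poly-∏ xs pf)

  -- At the point b = (0, …, 0, 1, 0) the matrix B is the adjacency matrix of the
  -- Johnson graph.
  johnson : ∀ m → Fin (suc m) → Carrier
  johnson m i = [ suc (toℕ i) ≡ᵇ m ]

  -- Only terms with j + p = m - 1 survive, and since j ≤ k and p ≤ m - k these are (k , m - k - 1)
  -- and (k - 1 , m - k), when they exist. They add up to (m - k)(n - m) - k(m - k + 1), which is
  -- the familiar (m - k)(n - m - k) - k.
  module _ (n : ℕ) {m k : ℕ} (k≤m : k ≤ m) where

    private
      t = m ∸ k

      k+t≡m : k ℕ.+ t ≡ m
      k+t≡m = ℕ.m+[n∸m]≡n k≤m

      N : ℕ → ℕ → ℕ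
      N j p = (k choose j) ℕ.* ((m ∸ j) choose p) ℕ.* ((n ∸ m ∸ k ℕ.+ j) choose (t ∸ p))

      inner : ℕ → Carrier
      inner j = ∑ (allFin (suc t)) (λ p → ι (N j (toℕ p)) * [ suc (j ℕ.+ toℕ p) ≡ᵇ m ])

      outer : ℕ → Carrier
      outer j = (- 1#) ^ (k ∸ j) * inner j

      eigenvalue-johnson : eigenvalue n k≤m (johnson m) ≈ ∑ (allFin (suc k)) (outer ∘ toℕ)
      eigenvalue-johnson = ∑-cong (allFin (suc k)) λ j → trans (∑-*ˡ (allFin (suc t)) _ _)
        (*-congˡ (∑-cong (allFin (suc t)) λ p → trans (×≈ι* (N (toℕ j) (toℕ p)) _)
          (*-congˡ (reflexive (≡.cong (λ i → [ suc i ≡ᵇ m ]) (toℕ-fromℕ< (j+p≤m k≤m j p))))))) 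

      inner-pick : ∀ j q → q ≤ t → suc (j ℕ.+ q) ≡ m → inner j ≈ ι (N j q)
      inner-pick j q q≤t e = trans (∑-cong (allFin (suc t)) λ p → *-congˡ (indicator (toℕ p))) (∑-pick (suc t) q (λ p → ι (N j p)) (s≤s q≤t))
        where
        indicator : ∀ p → [ suc (j ℕ.+ p) ≡ᵇ m ] ≈ [ q ≡ᵇ p ]
        indicator p with q ℕ.≟ p
        ... | yes ≡.refl = trans ([≡ᵇ]-1 e) (sym ([≡ᵇ]-1 {p} ≡.refl))
        ... | no q≢p = trans ([≡ᵇ]-0 λ e′ → q≢p (ℕ.+-cancelˡ-≡ (suc j) q p (≡.trans e (≡.sym e′)))) (sym ([≡ᵇ]-0 q≢p))

      inner-zero : ∀ j → (∀ p → p ≤ t → suc (j ℕ.+ p) ≢ m) → inner j ≈ 0#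
      inner-zero j e = ∑-zero (allFin (suc t)) λ p → trans (*-congˡ ([≡ᵇ]-0 (e (toℕ p) (toℕ≤pred[n] p)))) (zeroʳ _)

      last≈ : m ℕ.+ k ≤ n → ∀ {s} → t ≡ s → outer k ≈ ι (s ℕ.* (n ∸ m))
      last≈ m+k≤n {zero} t≡ = trans (*-congˡ (inner-zero k λ p p≤t e → ℕ.m≢1+m+n k (≡.trans (≡.sym (≡.trans (≡.cong (k ℕ.+_) t≡) (ℕ.+-identityʳ k))) (≡.trans k+t≡m (≡.sym e))))) (zeroʳ _)
      last≈ m+k≤n {suc s} t≡ = trans (*-cong (reflexive (≡.cong ((- 1#) ^_) (ℕ.n∸n≡0 k)))
          (inner-pick k s (≡.subst (s ≤_) (≡.sym t≡) (ℕ.n≤1+n s)) (≡.trans (≡.sym (ℕ.+-suc k s)) (≡.trans (≡.cong (k ℕ.+_) (≡.sym t≡)) k+t≡m))))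
        (trans (*-identityˡ _) (reflexive (≡.cong ι N≡)))
        where
        N≡ : N k s ≡ suc s ℕ.* (n ∸ m)
        N≡ = ≡.cong₂ ℕ._*_ (≡.trans (≡.cong₂ ℕ._*_ (nCn≡1 k) (≡.trans (≡.cong (_choose s) t≡) (≡.trans (nCk≡nC[n∸k] {s} {suc s} (ℕ.n≤1+n s)) (≡.trans (≡.cong (suc s choose_) (ℕ.m+n∸n≡m 1 s)) (nC1≡n (suc s)))))) (ℕ.*-identityˡ (suc s)))
          (≡.trans (≡.cong₂ _choose_ (ℕ.m∸n+n≡m (ℕ.m+n≤o⇒m≤o∸n k (≡.subst (_≤ n) (ℕ.+-comm m k) m+k≤n))) (≡.trans (≡.cong (_∸ s) t≡) (ℕ.m+n∸n≡m 1 s))) (nC1≡n (n ∸ m)))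

      before≈ : ∀ {k₀} → k ≡ suc k₀ → outer k₀ ≈ - ι (k ℕ.* suc t)
      before≈ {k₀} k≡ = trans (*-cong (trans (reflexive (≡.cong ((- 1#) ^_) (≡.trans (≡.cong (_∸ k₀) k≡) (ℕ.m+n∸n≡m 1 k₀)))) (*-identityʳ _))
          (inner-pick k₀ t ℕ.≤-refl (≡.trans (≡.cong (ℕ._+ t) (≡.sym k≡)) k+t≡m)))
        (trans (-1*x≈-x _) (-‿cong (reflexive (≡.cong ι N≡))))
        where
        m∸k₀ : m ∸ k₀ ≡ suc t
        m∸k₀ = ≡.trans (≡.cong (_∸ k₀) (≡.trans (≡.sym k+t≡m) (≡.trans (≡.cong (ℕ._+ t) k≡) (≡.sym (ℕ.+-suc k₀ t))))) (ℕ.m+n∸m≡n k₀ (suc t))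
        N≡ : N k₀ t ≡ k ℕ.* suc t
        N≡ = ≡.trans (≡.cong₂ ℕ._*_ (≡.cong₂ ℕ._*_
            (≡.trans (≡.cong (_choose k₀) k≡) (≡.trans (nCk≡nC[n∸k] {k₀} {suc k₀} (ℕ.n≤1+n k₀)) (≡.trans (≡.cong (suc k₀ choose_) (ℕ.m+n∸n≡m 1 k₀)) (≡.trans (nC1≡n (suc k₀)) (≡.sym k≡)))))
            (≡.trans (≡.cong (_choose t) m∸k₀) (≡.trans (nCk≡nC[n∸k] {t} {suc t} (ℕ.n≤1+n t)) (≡.trans (≡.cong (suc t choose_) (ℕ.m+n∸n≡m 1 t)) (nC1≡n (suc t))))))
            (≡.trans (≡.cong ((n ∸ m ∸ k ℕ.+ k₀) choose_) (ℕ.n∸n≡0 t)) (nC0≡1 (n ∸ m ∸ k ℕ.+ k₀))))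
          (ℕ.*-identityʳ _)

      sum≈ : ∀ {k₀} → k ≡ k₀ → ∑ (allFin k₀) (outer ∘ toℕ) ≈ - ι (k ℕ.* suc t)
      sum≈ {zero} ≡.refl = sym -0#≈0#
      sum≈ {suc k₀} k≡ = trans (∑-last k₀ outer) (trans (+-cong (∑-zero (allFin k₀) λ j → trans (*-congˡ (inner-zero (toℕ j) (vanish (toℕ<n j)))) (zeroʳ _)) (before≈ k≡)) (+-identityˡ _))
        where
        vanish : ∀ {j} → j < k₀ → ∀ p → p ≤ t → suc (j ℕ.+ p) ≢ m
        vanish {j} j<k₀ p p≤t e = ℕ.<-irrefl (≡.trans e (≡.trans (≡.sym k+t≡m) (≡.cong (ℕ._+ t) k≡))) (s≤s (ℕ.+-mono-≤ j<k₀ p≤t))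

    johnson-eigenvalue : m ℕ.+ k ≤ n → eigenvalue n k≤m (johnson m) ≈ ι ((m ∸ k) ℕ.* (n ∸ m)) - ι (k ℕ.* suc (m ∸ k))
    johnson-eigenvalue m+k≤n = trans eigenvalue-johnson (trans (∑-last k outer) (trans (+-comm _ _) (+-cong (last≈ m+k≤n ≡.refl) (sum≈ ≡.refl))))

  module _ (char0 : ∀ n → ι (suc n) # 0#) where

    -- Moving the subtracted terms across turns the claim into one about natural numbers, where a
    -- gap of s + 1 is visible.
    ι-difference-#0 : ∀ {a b a′ b′ s} → a ℕ.+ b′ ≡ suc s ℕ.+ (a′ ℕ.+ b) → ι a - ι b # ι a′ - ι b′
    ι-difference-#0 {a} {b} {a′} {b′} {s} e = -#0⇒# (#-congˡ (begin
      ι (suc s)                                               ≈⟨ x+y-y≈x _ _ ⟨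
      (ι (suc s) + ι (a′ ℕ.+ b)) - ι (a′ ℕ.+ b)               ≈⟨ +-congʳ (trans (sym (ι-+ (suc s) (a′ ℕ.+ b))) (trans (reflexive (≡.cong ι (≡.sym e))) (ι-+ a b′))) ⟩
      (ι a + ι b′) - ι (a′ ℕ.+ b)                             ≈⟨ +-congˡ (trans (-‿cong (trans (ι-+ a′ b) (+-comm _ _))) (sym (-‿+-comm _ _))) ⟩
      (ι a + ι b′) + (- ι b - ι a′)                           ≈⟨ +-interchange _ _ _ _ ⟩
      (ι a - ι b) + (ι b′ - ι a′)                             ≈⟨ +-congˡ (trans (+-comm _ _) (trans (+-congˡ (sym (-‿involutive _))) (-‿+-comm _ _))) ⟩
      (ι a - ι b) - (ι a′ - ι b′)                             ∎) (char0 s))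

    johnson-separates : ∀ {n m j k} (j≤m : j ≤ m) (k≤m : k ≤ m) → m ℕ.+ m ≤ n → j ≢ k → eigenvalue n j≤m (johnson m) # eigenvalue n k≤m (johnson m)
    johnson-separates {n} {m} {j} {k} j≤m k≤m 2m≤n j≢k = case (ℕ.<-cmp j k)
      where
      m+_≤n : ∀ {i} → i ≤ m → m ℕ.+ i ≤ n
      m+ i≤m ≤n = ℕ.≤-trans (ℕ.+-monoʳ-≤ m i≤m) 2m≤n
      -- With k = j + 1 + s, m = k + t and n = 2m + r, the difference of the two eigenvalues is (k -
      -- j)(n - k - j + 1) = (s + 1)(s + 2t + r + 2), written here as a successor.
      identity : ∀ j s t r → (suc s ℕ.+ t) ℕ.* (suc j ℕ.+ s ℕ.+ t ℕ.+ r) ℕ.+ (suc j ℕ.+ s) ℕ.* suc t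
        ≡ suc (suc (s ℕ.+ t ℕ.+ t ℕ.+ r) ℕ.+ s ℕ.* suc (suc (s ℕ.+ t ℕ.+ t ℕ.+ r))) ℕ.+ (t ℕ.* (suc j ℕ.+ s ℕ.+ t ℕ.+ r) ℕ.+ j ℕ.* suc (suc s ℕ.+ t))
      identity = solve-∀
      substituted : ∀ j s t r {k u v w} → k ≡ suc j ℕ.+ s → u ≡ suc j ℕ.+ s ℕ.+ t ℕ.+ r → v ≡ suc s ℕ.+ t → w ≡ t →
        ∃[ x ] v ℕ.* u ℕ.+ k ℕ.* suc w ≡ suc x ℕ.+ (w ℕ.* u ℕ.+ j ℕ.* suc v)
      substituted j s t r ≡.refl ≡.refl ≡.refl ≡.refl = suc (s ℕ.+ t ℕ.+ t ℕ.+ r) ℕ.+ s ℕ.* suc (suc (s ℕ.+ t ℕ.+ t ℕ.+ r)) , identity j s t r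
      ordered : ∀ {j k} (j≤m : j ≤ m) (k≤m : k ≤ m) → j < k → eigenvalue n j≤m (johnson m) # eigenvalue n k≤m (johnson m)
      ordered {j} {k} j≤m k≤m j<k = #-congˡ (sym (johnson-eigenvalue n j≤m (m+ j≤m ≤n)))
        (#-sym (#-congˡ (sym (johnson-eigenvalue n k≤m (m+ k≤m ≤n))) (#-sym (ι-difference-#0 {(m ∸ j) ℕ.* (n ∸ m)} {j ℕ.* suc (m ∸ j)} {(m ∸ k) ℕ.* (n ∸ m)} {k ℕ.* suc (m ∸ k)} {proj₁ (substituted j s t r k≡ u≡ v≡ ≡.refl)} (proj₂ (substituted j s t r k≡ u≡ v≡ ≡.refl))))))
        where
        s = k ∸ suc j
        t = m ∸ k
        r = n ∸ m ∸ m
        k≡ : k ≡ suc j ℕ.+ s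
        k≡ = ≡.sym (ℕ.m+[n∸m]≡n j<k)
        m≡ : m ≡ suc j ℕ.+ s ℕ.+ t
        m≡ = ≡.trans (≡.sym (ℕ.m+[n∸m]≡n k≤m)) (≡.cong (ℕ._+ t) k≡)
        u≡ : n ∸ m ≡ suc j ℕ.+ s ℕ.+ t ℕ.+ r
        u≡ = ≡.trans (≡.sym (ℕ.m+[n∸m]≡n (ℕ.m+n≤o⇒m≤o∸n m 2m≤n))) (≡.cong (ℕ._+ r) m≡)
        v≡ : m ∸ j ≡ suc s ℕ.+ t
        v≡ = ≡.trans (≡.cong (_∸ j) (≡.trans m≡ (regroup j s t))) (ℕ.m+n∸m≡n j (suc s ℕ.+ t))
          where
          regroup : ∀ j s t → suc j ℕ.+ s ℕ.+ t ≡ j ℕ.+ (suc s ℕ.+ t)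
          regroup = solve-∀
      case : _ → eigenvalue n j≤m (johnson m) # eigenvalue n k≤m (johnson m)
      case (tri≈ _ j≡k _) = ⊥-elim (j≢k j≡k)
      case (tri< j<k _ _) = ordered j≤m k≤m j<k
      case (tri> _ _ k<j) = #-sym (ordered k≤m j≤m k<j)

    generic-multiplicity : ∀ {n m k} (2m≤n : m ℕ.+ m ≤ n) (k≤m : k ≤ m) → Generically (suc m) (λ b →
      LinearAlgebra.HasMultiplicity (mSubsets n m) (B n m b) (eigenvalue n k≤m b) (tally k (walks n)))
    generic-multiplicity {n} {m} {k} 2m≤n k≤m = proj₁ poly , eval#0⇒nonzero (suc m) (proj₁ poly) (johnson m)
        (#-congˡ (sym (proj₂ poly (johnson m))) (∏-#0 (allFin (suc m)) _ λ j → factor-#0 j (toℕ j ℕ.≟ k)))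
      , λ b p → separated⇒hasMultiplicity char0 2m≤n k≤m b λ {j} j≤m j≢k → separated b (#-congˡ (proj₂ poly b) p) j≤m j≢k
      where
      λⱼ : Fin (suc m) → (Fin (suc m) → Carrier) → Carrier
      λⱼ j = eigenvalue n (toℕ≤pred[n] j)
      -- The difference at j = k is zero and is replaced by 1.
      factor : ∀ j → Dec (toℕ j ≡ k) → (Fin (suc m) → Carrier) → Carrier
      factor j (yes _) b = 1#
      factor j (no _)  b = λⱼ j b - eigenvalue n k≤m b
      poly : IsPolynomial (suc m) (λ b → ∏ (allFin (suc m)) (λ j → factor j (toℕ j ℕ.≟ k) b))
      poly = poly-∏ (allFin (suc m)) λ j → factor-poly j (toℕ j ℕ.≟ k)
        where
        factor-poly : ∀ j d → IsPolynomial (suc m) (factor j d)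
        factor-poly j (yes _) = poly-const 1#
        factor-poly j (no _)  = poly-+ (eigenvalue-polynomial n (toℕ≤pred[n] j)) (poly-neg (eigenvalue-polynomial n k≤m))
      factor-#0 : ∀ j d → factor j d (johnson m) # 0#
      factor-#0 j (yes _)  = 1#0
      factor-#0 j (no j≢k) = #⇒-#0 (johnson-separates (toℕ≤pred[n] j) k≤m 2m≤n j≢k)
      separated : ∀ b → ∏ (allFin (suc m)) (λ j → factor j (toℕ j ℕ.≟ k) b) # 0# →
        ∀ {j} (j≤m : j ≤ m) → j ≢ k → eigenvalue n j≤m b # eigenvalue n k≤m b
      separated b p {j} j≤m j≢k = -#0⇒# (go (toℕ-fromℕ< (s≤s j≤m)) (toℕ≤pred[n] (fromℕ< (s≤s j≤m))) (toℕ (fromℕ< (s≤s j≤m)) ℕ.≟ k) (∏-#0⁻ _ p (∈-allFin (fromℕ< (s≤s j≤m)))))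
        where
        go : ∀ {i} → toℕ i ≡ j → (i≤m : toℕ i ≤ m) → ∀ d → factor i d b # 0# → eigenvalue n j≤m b - eigenvalue n k≤m b # 0#
        go ≡.refl i≤m (yes j≡k) _ = ⊥-elim (j≢k j≡k)
        go {i} ≡.refl i≤m (no _) q = #-congˡ (+-congʳ (reflexive (≡.cong (λ l → eigenvalue n l b) (ℕ.≤-irrelevant (toℕ≤pred[n] i) j≤m)))) q

  -- The Young symmetrizer

  _≈ₚ?_ : ∀ {n} (g h : Permutation′ n) → Dec (g Perm.≈ h)
  g ≈ₚ? h = Fin.all? λ i → (g ⟨$⟩ʳ i) Fin.≟ (h ⟨$⟩ʳ i)

  [yes] : ∀ {p} {P : Set p} (d : Dec P) → P → [ does d ] ≈ 1#
  [yes] d p = reflexive (≡.cong [_] (dec-true d p))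

  [no] : ∀ {p} {P : Set p} (d : Dec P) → ¬ P → [ does d ] ≈ 0#
  [no] d ¬p = reflexive (≡.cong [_] (dec-false d ¬p))

  Respects≈ : ∀ {n} → (Permutation′ n → Carrier) → Set ℓ₁
  Respects≈ G = ∀ {g h} → g Perm.≈ h → G g ≈ G h

  -- `permutations` lists one representative of each permutation up to pointwise equality, so
  -- exactly one term survives.
  ∑-pick-perm : ∀ {n} (z : Permutation′ n) (G : Permutation′ n → Carrier) → Respects≈ G → ∑ (permutations n) (λ y → [ does (z ≈ₚ? y) ] * G y) ≈ G z
  ∑-pick-perm {n} z G resp = go (permutations n) (permutations-unique n) (permutations-complete z)
    where
    vanish : ∀ ys → (∀ {y} → y ∈ ys → ¬ (z Perm.≈ y)) → ∑ ys (λ y → [ does (z ≈ₚ? y) ] * G y) ≈ 0#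
    vanish ys z≉ = trans (∑-cong-∈ ys λ {y} y∈ → trans (*-congʳ ([no] (z ≈ₚ? y) (z≉ y∈))) (zeroˡ _)) (∑-zero ys λ _ → refl)
    go : ∀ ys → AllPairs (λ g h → ¬ (g Perm.≈ h)) ys → Any (Perm._≈ z) ys → ∑ ys (λ y → [ does (z ≈ₚ? y) ] * G y) ≈ G z
    go (y ∷ ys) (y≉ ∷ u) (here y≈z) = trans (+-cong (trans (*-congʳ ([yes] (z ≈ₚ? y) (λ i → ≡.sym (y≈z i)))) (trans (*-identityˡ _) (resp y≈z)))
      (vanish ys λ y′∈ z≈y′ → All.lookup y≉ y′∈ λ i → ≡.trans (y≈z i) (z≈y′ i))) (+-identityʳ _)
    go (y ∷ ys) (y≉ ∷ u) (there y∈) = let (y′ , y′∈ , y′≈z) = find y∈ in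
      trans (+-cong (trans (*-congʳ ([no] (z ≈ₚ? y) λ z≈y → All.lookup y≉ y′∈ λ i → ≡.trans (≡.sym (z≈y i)) (≡.sym (y′≈z i)))) (zeroˡ _)) (go ys u y∈)) (+-identityˡ _)

  -- Pointwise equal permutations need not be equal terms, so f need not permute the list itself.
  -- Instead the indicator of f⁻¹ y ≈ x, which is also that of f x ≈ y, is inserted and the two sums
  -- are swapped.
  ∑-reindex : ∀ {n} {H : Permutation′ n → Set} (H? : Decidable H) (f f⁻¹ : Permutation′ n → Permutation′ n) →
    (∀ {g h} → f g Perm.≈ h → f⁻¹ h Perm.≈ g) → (∀ {g h} → f⁻¹ h Perm.≈ g → f g Perm.≈ h) →
    (∀ {g} → H g → H (f g)) → (∀ {g} → H (f g) → H g) → (∀ {g h} → g Perm.≈ h → H g → H h) →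
    (G : Permutation′ n → Carrier) → Respects≈ G →
    ∑ (List.filter H? (permutations n)) G ≈ ∑ (List.filter H? (permutations n)) (G ∘ f)
  ∑-reindex {n} H? f f⁻¹ to from H-f H-f⁻ H-resp G resp = begin
    ∑ (List.filter H? ps) G
      ≈⟨ ∑-filter H? ps G ⟩
    ∑ ps G′
      ≈⟨ ∑-cong ps (λ y → ∑-pick-perm (f⁻¹ y) (λ _ → G′ y) (λ _ → refl)) ⟨
    ∑ ps (λ y → ∑ ps (λ x → [ does (f⁻¹ y ≈ₚ? x) ] * G′ y))
      ≈⟨ ∑-swap ps ps _ ⟩
    ∑ ps (λ x → ∑ ps (λ y → [ does (f⁻¹ y ≈ₚ? x) ] * G′ y))
      ≈⟨ ∑-cong ps (λ x → ∑-cong ps λ y → *-congʳ (reflexive (≡.cong [_] (does-⇔ (mk⇔ from to) (f⁻¹ y ≈ₚ? x) (f x ≈ₚ? y))))) ⟩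
    ∑ ps (λ x → ∑ ps (λ y → [ does (f x ≈ₚ? y) ] * G′ y))
      ≈⟨ ∑-cong ps (λ x → ∑-pick-perm (f x) G′ G′-resp) ⟩
    ∑ ps (G′ ∘ f)
      ≈⟨ ∑-cong ps (λ x → *-congʳ (reflexive (≡.cong [_] (does-⇔ (mk⇔ H-f⁻ H-f) (H? (f x)) (H? x))))) ⟩
    ∑ ps (λ x → [ does (H? x) ] * G (f x))
      ≈⟨ ∑-filter H? ps (G ∘ f) ⟨
    ∑ (List.filter H? ps) (G ∘ f) ∎
    where
    ps = permutations n
    G′ : Permutation′ n → Carrier
    G′ g = [ does (H? g) ] * G g
    G′-resp : Respects≈ G′
    G′-resp {g} {h} g≈h = *-cong (reflexive (≡.cong [_] (does-⇔ (mk⇔ (H-resp {g} {h} g≈h) (H-resp {h} {g} (λ i → ≡.sym (g≈h i)))) (H? g) (H? h)))) (resp g≈h)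

  [-1]^[M+M] : ∀ M → (- 1#) ^ (M ℕ.+ M) ≈ 1#
  [-1]^[M+M] zero    = refl
  [-1]^[M+M] (suc M) = begin
    (- 1#) * (- 1#) ^ (M ℕ.+ suc M)          ≈⟨ *-congˡ (reflexive (≡.cong ((- 1#) ^_) (ℕ.+-suc M M))) ⟩
    (- 1#) * ((- 1#) * (- 1#) ^ (M ℕ.+ M))   ≈⟨ trans (-1*x≈-x _) (-‿cong (-1*x≈-x _)) ⟩
    - (- ((- 1#) ^ (M ℕ.+ M)))               ≈⟨ -‿involutive _ ⟩
    (- 1#) ^ (M ℕ.+ M)                       ≈⟨ [-1]^[M+M] M ⟩
    1#                                       ∎

  sgn-∘ : ∀ {n} (p q : Permutation′ n) → sgn (p ∘ₚ q) ≈ sgn p * sgn q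
  sgn-∘ p q = let (M , e) = inversions-∘ p q in begin
    sgn (p ∘ₚ q)                                       ≈⟨ *-identityʳ _ ⟨
    sgn (p ∘ₚ q) * 1#                                  ≈⟨ *-congˡ ([-1]^[M+M] M) ⟨
    sgn (p ∘ₚ q) * (- 1#) ^ (M ℕ.+ M)                  ≈⟨ ^-homo-* (- 1#) (inversions (p ∘ₚ q)) (M ℕ.+ M) ⟨
    (- 1#) ^ (inversions (p ∘ₚ q) ℕ.+ (M ℕ.+ M))       ≈⟨ reflexive (≡.cong ((- 1#) ^_) e) ⟩
    (- 1#) ^ (inversions p ℕ.+ inversions q)           ≈⟨ ^-homo-* (- 1#) (inversions p) (inversions q) ⟩
    sgn p * sgn q                                      ∎

  sgn-transpose : ∀ {n} {x y : Fin n} → x ≢ y → sgn (Perm.transpose x y) ≈ - 1#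
  sgn-transpose {x = x} {y} x≢y = let (M , e) = inversions-transpose-odd x y x≢y in begin
    s                       ≈⟨ -‿involutive s ⟨
    - (- s)                 ≈⟨ -‿cong (-1*x≈-x s) ⟨
    - ((- 1#) ^ suc (inversions (Perm.transpose x y)))  ≈⟨ -‿cong (reflexive (≡.cong ((- 1#) ^_) (≡.trans (ℕ.+-comm 1 _) e))) ⟩
    - ((- 1#) ^ (M ℕ.+ M))  ≈⟨ -‿cong ([-1]^[M+M] M) ⟩
    - 1#                    ∎
    where s = sgn (Perm.transpose x y)

  sgn-cong : ∀ {n} → Respects≈ {n} sgn
  sgn-cong {g = g} {h} g≈h = reflexive (≡.cong ((- 1#) ^_) (inversions-cong {g = g} {h} g≈h))

  _≟ₛ_ : ∀ {n} (σ τ : Subset n) → Dec (σ ≡ τ)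
  _≟ₛ_ = Vec.≡-dec Bool._≟_

  δ : ∀ {n} → Subset n → Subset n → Carrier
  δ σ τ = [ does (σ ≟ₛ τ) ]

  δ-yes : ∀ {n} {σ τ : Subset n} → σ ≡ τ → δ σ τ ≈ 1#
  δ-yes {σ = σ} {τ} = [yes] (σ ≟ₛ τ)

  δ-no : ∀ {n} {σ τ : Subset n} → σ ≢ τ → δ σ τ ≈ 0#
  δ-no {σ = σ} {τ} = [no] (σ ≟ₛ τ)

  δ-cong : ∀ {n n′} {σ τ : Subset n} {σ′ τ′ : Subset n′} → (σ ≡ τ → σ′ ≡ τ′) → (σ′ ≡ τ′ → σ ≡ τ) → δ σ τ ≈ δ σ′ τ′
  δ-cong {σ = σ} {τ} {σ′} {τ′} f g = reflexive (≡.cong [_] (does-⇔ (mk⇔ f g) (σ ≟ₛ τ) (σ′ ≟ₛ τ′)))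

  δ-∷ : ∀ {n} b (σ τ : Subset n) → δ (b ∷ σ) (b ∷ τ) ≈ δ σ τ
  δ-∷ b σ τ = δ-cong {σ = b ∷ σ} {b ∷ τ} {σ} {τ} Vec.∷-injectiveʳ (≡.cong (b ∷_))

  δ-in-out : ∀ {n} (σ τ : Subset n) → δ (inside ∷ σ) (outside ∷ τ) ≈ 0#
  δ-in-out σ τ = δ-no {σ = inside ∷ σ} {outside ∷ τ} λ ()

  δ-out-in : ∀ {n} (σ τ : Subset n) → δ (outside ∷ σ) (inside ∷ τ) ≈ 0#
  δ-out-in σ τ = δ-no {σ = outside ∷ σ} {inside ∷ τ} λ ()

  δ-img : ∀ {n} (g : Permutation′ n) σ τ → δ (img g σ) τ ≈ δ σ (img (Perm.flip g) τ)
  δ-img g σ τ = δ-cong (λ e → ≡.trans (≡.sym (img-flip g σ)) (≡.cong (img (Perm.flip g)) e)) (λ e → ≡.trans (≡.cong (img g) e) (flip-img g τ))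

  -- Sorting by the deleted point z lets each deletion be cancelled separately in the polytabloid.
  D-δ : ∀ {n} (κ ρ : Subset n) → D (δ κ) ρ ≈ ∑ (allFin n) (λ z → [ lookup κ z ] * δ (κ [ z ]≔ outside) ρ)
  D-δ [] [] = refl
  D-δ {suc n} (inside ∷ κ) (inside ∷ ρ) = begin
    D (λ τ → δ (inside ∷ κ) (inside ∷ τ)) ρ                                  ≈⟨ D-cong (δ-∷ inside κ) ρ ⟩
    D (δ κ) ρ                                                                ≈⟨ D-δ κ ρ ⟩
    ∑ (allFin n) (λ z → [ lookup κ z ] * δ (κ [ z ]≔ outside) ρ)             ≈⟨ ∑-cong (allFin n) (λ z → *-congˡ (sym (δ-∷ inside (κ [ z ]≔ outside) ρ))) ⟩
    ∑ (allFin n) (λ z → [ lookup κ z ] * δ (inside ∷ κ [ z ]≔ outside) (inside ∷ ρ))  ≈⟨ trans (+-congʳ (trans (*-congˡ (δ-out-in κ ρ)) (zeroʳ _))) (+-identityˡ _) ⟨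
    1# * δ (outside ∷ κ) (inside ∷ ρ) + ∑ (allFin n) (λ z → [ lookup κ z ] * δ (inside ∷ κ [ z ]≔ outside) (inside ∷ ρ))  ≈⟨ ∑-suc n _ ⟨
    ∑ (allFin (suc n)) (λ z → [ lookup (inside ∷ κ) z ] * δ ((inside ∷ κ) [ z ]≔ outside) (inside ∷ ρ)) ∎
  D-δ {suc n} (outside ∷ κ) (inside ∷ ρ) = trans (D-0 (δ-out-in κ) ρ)
    (sym (trans (∑-suc n _) (trans (+-cong (zeroˡ _) (∑-zero (allFin n) λ z → trans (*-congˡ (δ-out-in (κ [ z ]≔ outside) ρ)) (zeroʳ _))) (+-identityˡ 0#))))
  D-δ {suc n} (inside ∷ κ) (outside ∷ ρ) = trans (+-cong (D-0 (δ-in-out κ) ρ) (δ-∷ inside κ ρ)) (trans (+-comm _ _)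
    (sym (trans (∑-suc n _) (+-cong (trans (*-identityˡ _) (δ-∷ outside κ ρ)) (∑-zero (allFin n) λ z → trans (*-congˡ (δ-in-out (κ [ z ]≔ outside) ρ)) (zeroʳ _))))))
  D-δ {suc n} (outside ∷ κ) (outside ∷ ρ) = begin
    D (λ τ → δ (outside ∷ κ) (outside ∷ τ)) ρ + δ (outside ∷ κ) (inside ∷ ρ)   ≈⟨ +-cong (D-cong (δ-∷ outside κ) ρ) (δ-out-in κ ρ) ⟩
    D (δ κ) ρ + 0#                                                           ≈⟨ trans (+-comm _ _) (+-cong (sym (zeroˡ _)) (D-δ κ ρ)) ⟩
    0# * δ (outside ∷ κ) (outside ∷ ρ) + ∑ (allFin n) (λ z → [ lookup κ z ] * δ (κ [ z ]≔ outside) ρ)  ≈⟨ +-congˡ (∑-cong (allFin n) (λ z → *-congˡ (sym (δ-∷ outside (κ [ z ]≔ outside) ρ)))) ⟩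
    0# * δ (outside ∷ κ) (outside ∷ ρ) + ∑ (allFin n) (λ z → [ lookup κ z ] * δ (outside ∷ κ [ z ]≔ outside) (outside ∷ ρ))  ≈⟨ ∑-suc n _ ⟨
    ∑ (allFin (suc n)) (λ z → [ lookup (outside ∷ κ) z ] * δ ((outside ∷ κ) [ z ]≔ outside) (outside ∷ ρ)) ∎

  Sub : ∀ {n} → Subset n → Subset n → Set
  Sub κ τ = ∀ i → lookup κ i ≡ inside → lookup τ i ≡ inside

  sub? : ∀ {n} (κ τ : Subset n) → Dec (Sub κ τ)
  sub? κ τ = Fin.all? λ i → implies (lookup κ i) (lookup τ i)
    where
    implies : ∀ a b → Dec (a ≡ inside → b ≡ inside)
    implies outside b       = yes λ ()
    implies inside  inside  = yes λ _ → ≡.refl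
    implies inside  outside = no λ f → case (f ≡.refl)
      where
      case : outside ≢ inside
      case ()

  Z-δ-yes : ∀ {n} (κ τ : Subset n) → Sub κ τ → Z (δ κ) τ ≈ 1#
  Z-δ-yes []            []            s = refl
  Z-δ-yes (inside  ∷ κ) (inside  ∷ τ) s = trans (+-cong (trans (Z-cong (δ-∷ inside κ) τ) (Z-δ-yes κ τ (s ∘ suc))) (Z-0 (δ-in-out κ) τ)) (+-identityʳ 1#)
  Z-δ-yes (outside ∷ κ) (inside  ∷ τ) s = trans (+-cong (Z-0 (δ-out-in κ) τ) (trans (Z-cong (δ-∷ outside κ) τ) (Z-δ-yes κ τ (s ∘ suc)))) (+-identityˡ 1#)
  Z-δ-yes (inside  ∷ κ) (outside ∷ τ) s with s zero ≡.refl
  ... | ()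
  Z-δ-yes (outside ∷ κ) (outside ∷ τ) s = trans (Z-cong (δ-∷ outside κ) τ) (Z-δ-yes κ τ (s ∘ suc))

  Z-δ-no : ∀ {n} (κ τ : Subset n) → ¬ Sub κ τ → Z (δ κ) τ ≈ 0#
  Z-δ-no []            []            ¬s = ⊥-elim (¬s λ ())
  Z-δ-no (inside  ∷ κ) (inside  ∷ τ) ¬s = trans (+-cong (trans (Z-cong (δ-∷ inside κ) τ) (Z-δ-no κ τ λ s → ¬s λ where zero _ → ≡.refl ; (suc i) → s i)) (Z-0 (δ-in-out κ) τ)) (+-identityʳ 0#)
  Z-δ-no (outside ∷ κ) (inside  ∷ τ) ¬s = trans (+-cong (Z-0 (δ-out-in κ) τ) (trans (Z-cong (δ-∷ outside κ) τ) (Z-δ-no κ τ λ s → ¬s λ where zero () ; (suc i) → s i))) (+-identityʳ 0#)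
  Z-δ-no (inside  ∷ κ) (outside ∷ τ) ¬s = Z-0 (δ-in-out κ) τ
  Z-δ-no (outside ∷ κ) (outside ∷ τ) ¬s = trans (Z-cong (δ-∷ outside κ) τ) (Z-δ-no κ τ λ s → ¬s λ where zero () ; (suc i) → s i)

  -- Both sides are the indicator of g(κ) ⊆ τ.
  Z-δ-img : ∀ {n} (g : Permutation′ n) κ τ → Z (δ (img g κ)) τ ≈ Z (δ κ) (img (Perm.flip g) τ)
  Z-δ-img g κ τ with sub? κ (img (Perm.flip g) τ)
  ... | yes s = trans (Z-δ-yes (img g κ) τ λ i p → ≡.trans (≡.cong (lookup τ) (≡.sym (Perm.inverseʳ g))) (≡.trans (≡.sym (lookup-img (Perm.flip g) τ (g ⟨$⟩ˡ i))) (s (g ⟨$⟩ˡ i) (≡.trans (≡.sym (lookup-img g κ i)) p))))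
        (sym (Z-δ-yes κ (img (Perm.flip g) τ) s))
  ... | no ¬s = trans (Z-δ-no (img g κ) τ λ s → ¬s λ i p → ≡.trans (lookup-img (Perm.flip g) τ i) (s (g ⟨$⟩ʳ i) (≡.trans (lookup-img g κ (g ⟨$⟩ʳ i)) (≡.trans (≡.cong (lookup κ) (Perm.inverseˡ g)) p))))
        (sym (Z-δ-no κ (img (Perm.flip g) τ) ¬s))

  ∑-permute : ∀ {n} (g : Permutation′ n) (f : Fin n → Carrier) → ∑ (allFin n) f ≈ ∑ (allFin n) (f ∘ (g ⟨$⟩ʳ_))
  ∑-permute {n} g f = trans (as-sum n f) (trans (S.sum-permute f g) (sym (as-sum n _)))
    where
    module S = Algebra.Properties.CommutativeMonoid.Sum +-commutativeMonoid
    as-sum : ∀ n (f : Fin n → Carrier) → ∑ (allFin n) f ≈ S.sum f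
    as-sum zero    f = refl
    as-sum (suc n) f = trans (∑-suc n f) (+-congˡ (as-sum n (f ∘ suc)))

  D-δ-img : ∀ {n} (g : Permutation′ n) κ ρ → D (δ (img g κ)) ρ ≈ ∑ (allFin n) (λ y → [ lookup κ y ] * δ (img g (κ [ y ]≔ outside)) ρ)
  D-δ-img {n} g κ ρ = trans (D-δ (img g κ) ρ) (trans (∑-permute g _) (∑-cong (allFin n) λ y →
    *-cong (reflexive (≡.cong [_] (≡.trans (lookup-img g κ (g ⟨$⟩ʳ y)) (≡.cong (lookup κ) (Perm.inverseˡ g))))) (reflexive (≡.cong (λ σ → δ σ ρ) (remove y)))))
    where
    remove : ∀ y → img g κ [ g ⟨$⟩ʳ y ]≔ outside ≡ img g (κ [ y ]≔ outside)
    remove y = lookup-ext λ i → go i (i Fin.≟ (g ⟨$⟩ʳ y))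
      where
      go : ∀ i → Dec (i ≡ g ⟨$⟩ʳ y) → lookup (img g κ [ g ⟨$⟩ʳ y ]≔ outside) i ≡ lookup (img g (κ [ y ]≔ outside)) i
      go _ (yes ≡.refl) = ≡.trans (Vec.lookup∘updateAt (g ⟨$⟩ʳ y) (img g κ)) (≡.sym (≡.trans (lookup-img g (κ [ y ]≔ outside) (g ⟨$⟩ʳ y))
        (≡.trans (≡.cong (lookup (κ [ y ]≔ outside)) (Perm.inverseˡ g)) (Vec.lookup∘updateAt y κ))))
      go i (no i≢) = ≡.trans (Vec.lookup∘updateAt′ i (g ⟨$⟩ʳ y) i≢ (img g κ)) (≡.trans (lookup-img g κ i)
        (≡.sym (≡.trans (lookup-img g (κ [ y ]≔ outside) i) (Vec.lookup∘updateAt′ (g ⟨$⟩ˡ i) y (λ p → i≢ (≡.trans (≡.sym (Perm.inverseʳ g)) (≡.cong (g ⟨$⟩ʳ_) p))) κ))))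

  ≤⇒≤ᵇ-true : ∀ {a b} → a ≤ b → (a ≤ᵇ b) ≡ true
  ≤⇒≤ᵇ-true {a} {b} = dec-true (a ℕ.≤? b)

  >⇒≤ᵇ-false : ∀ {a b} → b < a → (a ≤ᵇ b) ≡ false
  >⇒≤ᵇ-false {a} {b} b<a = dec-false (a ℕ.≤? b) (ℕ.<⇒≱ b<a)

  ≤ᵇ-true⇒≤ : ∀ {a b} → (a ≤ᵇ b) ≡ true → a ≤ b
  ≤ᵇ-true⇒≤ {a} {b} e with ℕ.≤-<-connex a b
  ... | inj₁ a≤b = a≤b
  ... | inj₂ b<a with ≡.trans (≡.sym e) (>⇒≤ᵇ-false b<a)
  ...   | ()

  ∑-cartesianProductWith : ∀ {a b d} {A : Set a} {A′ : Set b} {A″ : Set d} (g : A → A′ → A″) xs ys (f : A″ → Carrier) →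
    ∑ (List.cartesianProductWith g xs ys) f ≈ ∑ xs (λ x → ∑ ys (λ y → f (g x y)))
  ∑-cartesianProductWith g []       ys f = refl
  ∑-cartesianProductWith g (x ∷ xs) ys f = trans (∑-++ (map (g x) ys) _ f) (+-cong (∑-map (g x) ys f) (∑-cartesianProductWith g xs ys f))

  ∑-count : ∀ {a} {A : Set a} (xs : List A) (f : A → Carrier) → (∀ {x} → x ∈ xs → f x ≈ 0# ⊎ f x ≈ 1#) → ∃[ s ] ∑ xs f ≈ ι s
  ∑-count []       f e = 0 , refl
  ∑-count (x ∷ xs) f e with ∑-count xs f (e ∘ there) | e (here ≡.refl)
  ... | s , p | inj₁ q = s , trans (+-cong q p) (+-identityˡ _)
  ... | s , p | inj₂ q = suc s , +-cong q p

  -- In characteristic zero a positive number of ones is apart from zero; this shows that both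
  -- factors of π(c_k) at Ω are nonzero.
  ∑-count⁺ : ∀ {a} {A : Set a} (xs : List A) (f : A → Carrier) → (∀ {x} → x ∈ xs → f x ≈ 0# ⊎ f x ≈ 1#) → Any (λ x → f x ≈ 1#) xs → ∃[ s ] ∑ xs f ≈ ι (suc s)
  ∑-count⁺ (x ∷ xs) f e (here q) = let (s , p) = ∑-count xs f (e ∘ there) in s , +-cong q p
  ∑-count⁺ (x ∷ xs) f e (there a) with ∑-count⁺ xs f (e ∘ there) a | e (here ≡.refl)
  ... | s , p | inj₁ q = s , trans (+-cong q p) (+-identityˡ _)
  ... | s , p | inj₂ q = suc s , +-cong q p

  module _ (char0 : ∀ n → ι (suc n) # 0#) {n m k : ℕ} (2m≤n : m ℕ.+ m ≤ n) (m≤n : m ≤ n) (k≤m : k ≤ m) where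

    open LinearAlgebra (mSubsets n m)
    open Tableau n k

    private
      r : ℕ
      r = n ∸ k

      k≤n : k ≤ n
      k≤n = ℕ.≤-trans k≤m m≤n

      m+k≤n : m ℕ.+ k ≤ n
      m+k≤n = ℕ.≤-trans (ℕ.+-monoʳ-≤ m k≤m) 2m≤n

      k≤n∸m : k ≤ n ∸ m
      k≤n∸m = ℕ.m+n≤o⇒m≤o∸n k (≡.subst (_≤ n) (ℕ.+-comm m k) m+k≤n)

      n∸m≤r : n ∸ m ≤ r
      n∸m≤r = ℕ.∸-monoʳ-≤ n k≤m

      k≤r : k ≤ r
      k≤r = ℕ.≤-trans k≤n∸m n∸m≤r

      κ₀ Ω₀ : Subset n
      κ₀ = proj₁ (Ω k≤n)
      Ω₀ = proj₁ (Ω m≤n)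

      lookup-κ₀ : ∀ i → lookup κ₀ i ≡ (r ≤ᵇ toℕ i)
      lookup-κ₀ i = Vec.lookup∘tabulate _ i

      lookup-Ω₀ : ∀ i → lookup Ω₀ i ≡ (n ∸ m ≤ᵇ toℕ i)
      lookup-Ω₀ i = Vec.lookup∘tabulate _ i

      row-low : ∀ {i} → toℕ i < r → row i ≡ 0
      row-low l rewrite <⇒<ᵇ-true l = ≡.refl

      row-high : ∀ {i} → r ≤ toℕ i → row i ≡ 1
      row-high l rewrite ≤⇒<ᵇ-false l = ≡.refl

      col-low : ∀ {i} → toℕ i < r → col i ≡ toℕ i
      col-low l rewrite <⇒<ᵇ-true l = ≡.refl

      col-high : ∀ {i} → r ≤ toℕ i → col i ≡ toℕ i ∸ r
      col-high l rewrite ≤⇒<ᵇ-false l = ≡.refl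

      row-1⇒high : ∀ {i} → row i ≡ 1 → r ≤ toℕ i
      row-1⇒high {i} e with ℕ.≤-<-connex r (toℕ i)
      ... | inj₁ l = l
      ... | inj₂ l with ≡.trans (≡.sym e) (row-low {i} l)
      ...   | ()

      -- Precomposing with t permutes the column group and flips signs while G is unchanged, so S =
      -- - S and 2S = 0.
      antisymmetric-sum : ∀ {t : Permutation′ n} {G : Permutation′ n → Carrier} → PreservesColumns t → sgn t ≈ - 1# → Respects≈ G →
        (∀ q → G (t ∘ₚ q) ≈ G q) → ∑ C (λ q → sgn q * G q) ≈ 0#
      antisymmetric-sum {t} {G} t∈C sgn-t resp invariant = *≈0⇒≈0 (char0 1) (begin
        ι 2 * S            ≈⟨ trans (ι-suc* 1 S) (+-congˡ (trans (*-congʳ ι-1) (*-identityˡ S))) ⟩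
        S + S              ≈⟨ +-congˡ S≈-S ⟩
        S - S              ≈⟨ -‿inverseʳ S ⟩
        0#                 ∎)
        where
        S = ∑ C (λ q → sgn q * G q)
        S≈-S : S ≈ - S
        S≈-S = begin
          S
            ≈⟨ ∑-reindex preservesColumns? (t ∘ₚ_) (Perm.flip t ∘ₚ_)
                 (λ {g} e i → ≡.trans (≡.sym (e (t ⟨$⟩ˡ i))) (≡.cong (g ⟨$⟩ʳ_) (Perm.inverseʳ t)))
                 (λ {_} {h} e i → ≡.trans (≡.sym (e (t ⟨$⟩ʳ i))) (≡.cong (h ⟨$⟩ʳ_) (Perm.inverseˡ t)))
                 (λ g∈C i → ≡.trans (g∈C (t ⟨$⟩ʳ i)) (t∈C i))
                 (λ {g} tg∈C i → ≡.trans (≡.cong (λ j → col (g ⟨$⟩ʳ j)) (≡.sym (Perm.inverseʳ t))) (≡.trans (tg∈C (t ⟨$⟩ˡ i)) (≡.trans (≡.sym (t∈C (t ⟨$⟩ˡ i))) (≡.cong col (Perm.inverseʳ t)))))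
                 (λ e g∈C i → ≡.trans (≡.cong col (≡.sym (e i))) (g∈C i))
                 (λ q → sgn q * G q) (λ {g} {h} e → *-cong (sgn-cong {g = g} {h} e) (resp {g} {h} e)) ⟩
          ∑ C (λ q → sgn (t ∘ₚ q) * G (t ∘ₚ q))
            ≈⟨ ∑-cong C (λ q → trans (*-cong (trans (sgn-∘ t q) (*-congʳ sgn-t)) (invariant q)) (*-assoc _ _ _)) ⟩
          ∑ C (λ q → (- 1#) * (sgn q * G q))
            ≈⟨ trans (∑-*ˡ C (- 1#) _) (-1*x≈-x S) ⟩
          - S ∎

      -- π(c_k) is a multiple of Z polytabloid.
      polytabloid : Subset n → Carrier
      polytabloid κ = ∑ C (λ q → sgn q * δ (img q κ₀) κ)

      polytabloid-homogeneous : Homogeneous k polytabloid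
      polytabloid-homogeneous κ ∣κ∣≢k = ∑-zero C λ q → trans (*-congˡ (δ-no {σ = img q κ₀} {κ} λ e → ∣κ∣≢k (≡.trans (≡.cong ∣_∣ (≡.sym e)) (≡.trans (∣img∣ q κ₀) (proj₂ (Ω k≤n)))))) (zeroʳ _)

      polytabloid-harmonic : Harmonic polytabloid
      polytabloid-harmonic ρ = begin
        D polytabloid ρ
          ≈⟨ D-∑ C (λ q κ → sgn q * δ (img q κ₀) κ) ρ ⟩
        ∑ C (λ q → D (λ κ → sgn q * δ (img q κ₀) κ) ρ)
          ≈⟨ ∑-cong C (λ q → trans (D-* (sgn q) (δ (img q κ₀)) ρ) (*-congˡ (D-δ-img q κ₀ ρ))) ⟩
        ∑ C (λ q → sgn q * ∑ (allFin n) (λ y → [ lookup κ₀ y ] * δ (img q (κ₀ [ y ]≔ outside)) ρ))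
          ≈⟨ ∑-cong C (λ q → trans (sym (∑-*ˡ (allFin n) (sgn q) _)) (∑-cong (allFin n) λ y → x*yz≈y*xz _ _ _)) ⟩
        ∑ C (λ q → ∑ (allFin n) (λ y → [ lookup κ₀ y ] * (sgn q * δ (img q (κ₀ [ y ]≔ outside)) ρ)))
          ≈⟨ ∑-swap C (allFin n) _ ⟩
        ∑ (allFin n) (λ y → ∑ C (λ q → [ lookup κ₀ y ] * (sgn q * δ (img q (κ₀ [ y ]≔ outside)) ρ)))
          ≈⟨ ∑-zero (allFin n) (λ y → trans (∑-*ˡ C _ _) (removed y (lookup κ₀ y) ≡.refl)) ⟩
        0# ∎
        where
        removed : ∀ y b → lookup κ₀ y ≡ b → [ b ] * ∑ C (λ q → sgn q * δ (img q (κ₀ [ y ]≔ outside)) ρ) ≈ 0#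
        removed y outside _ = zeroˡ _
        removed y inside  e = trans (*-congˡ (antisymmetric-sum {t} {λ q → δ (img q κ) ρ} t∈C (sgn-transpose y≢y′)
            (λ {g} {h} g≈h → reflexive (≡.cong (λ σ → δ σ ρ) (img-cong {g = g} {h} g≈h κ)))
            (λ q → reflexive (≡.cong (λ σ → δ σ ρ) (≡.trans (img-∘ t q κ) (≡.cong (img q) t-fixes)))))) (zeroʳ _)
          where
          r≤y : r ≤ toℕ y
          r≤y = ≤ᵇ-true⇒≤ (≡.trans (≡.sym (lookup-κ₀ y)) e)
          y∸r<k : toℕ y ∸ r < k
          y∸r<k = ≡.subst (toℕ y ∸ r <_) (ℕ.m∸[m∸n]≡n k≤n) (ℕ.∸-monoˡ-< (Fin.toℕ<n y) r≤y)
          -- The entry above y in its column. As k ≤ n - k it lies in the first row, hence outside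
          -- κ₀, and exchanging it with y fixes κ₀ without y.
          y′ : Fin n
          y′ = fromℕ< (ℕ.<-≤-trans y∸r<k k≤n)
          toℕ-y′ : toℕ y′ ≡ toℕ y ∸ r
          toℕ-y′ = Fin.toℕ-fromℕ< (ℕ.<-≤-trans y∸r<k k≤n)
          y′<r : toℕ y′ < r
          y′<r = ≡.subst (_< r) (≡.sym toℕ-y′) (ℕ.<-≤-trans y∸r<k k≤r)
          y≢y′ : y ≢ y′
          y≢y′ p = ℕ.<-irrefl (≡.cong toℕ (≡.sym p)) (ℕ.<-≤-trans y′<r r≤y)
          t : Permutation′ n
          t = Perm.transpose y y′
          κ : Subset n
          κ = κ₀ [ y ]≔ outside
          same-col : col y′ ≡ col y
          same-col = ≡.trans (col-low {y′} y′<r) (≡.trans toℕ-y′ (≡.sym (col-high {y} r≤y)))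
          t∈C : PreservesColumns t
          t∈C i = go (i Fin.≟ y) (i Fin.≟ y′)
            where
            go : Dec (i ≡ y) → Dec (i ≡ y′) → col (t ⟨$⟩ʳ i) ≡ col i
            go (yes ≡.refl) _ = ≡.trans (≡.cong col (transpose-left y y′)) same-col
            go (no _) (yes ≡.refl) = ≡.trans (≡.cong col (transpose-right y y′)) (≡.sym same-col)
            go (no i≢y) (no i≢y′) = ≡.cong col (transpose-other y y′ i≢y i≢y′)
          κ-y : lookup κ y ≡ outside
          κ-y = Vec.lookup∘updateAt y κ₀
          κ-y′ : lookup κ y′ ≡ outside
          κ-y′ = ≡.trans (Vec.lookup∘updateAt′ y′ y (y≢y′ ∘ ≡.sym) κ₀) (≡.trans (lookup-κ₀ y′) (>⇒≤ᵇ-false y′<r))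
          t-fixes : img t κ ≡ κ
          t-fixes = lookup-ext λ i → ≡.trans (lookup-img t κ i) (go i (i Fin.≟ y) (i Fin.≟ y′))
            where
            go : ∀ i → Dec (i ≡ y) → Dec (i ≡ y′) → lookup κ (t ⟨$⟩ˡ i) ≡ lookup κ i
            go i (yes ≡.refl) _ = ≡.trans (≡.cong (lookup κ) (transpose-right y′ y)) (≡.trans κ-y′ (≡.sym κ-y))
            go i (no _) (yes ≡.refl) = ≡.trans (≡.cong (lookup κ) (transpose-left y′ y)) (≡.trans κ-y (≡.sym κ-y′))
            go i (no i≢y) (no i≢y′) = ≡.cong (lookup κ) (transpose-other y′ y i≢y′ i≢y)

      -- The number of row permutations that carry Ω to τ, as a scalar.
      w : Subset n → Carrier
      w τ = ∑ R (λ p → δ (img p Ω₀) τ)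

      w-invariant : ∀ {g : Permutation′ n} → PreservesRows g → w (img g Ω₀) ≈ w Ω₀
      w-invariant {g} g∈R = begin
        w (img g Ω₀)
          ≈⟨ ∑-reindex preservesRows? (_∘ₚ g) (_∘ₚ Perm.flip g)
               (λ e i → ≡.trans (≡.cong (g ⟨$⟩ˡ_) (≡.sym (e i))) (Perm.inverseˡ g))
               (λ e i → ≡.trans (≡.cong (g ⟨$⟩ʳ_) (≡.sym (e i))) (Perm.inverseʳ g))
               (λ {p} p∈R i → ≡.trans (g∈R (p ⟨$⟩ʳ i)) (p∈R i))
               (λ {p} pg∈R i → ≡.trans (≡.sym (g∈R (p ⟨$⟩ʳ i))) (pg∈R i))
               (λ e p∈R i → ≡.trans (≡.cong row (≡.sym (e i))) (p∈R i))
               (λ p → δ (img p Ω₀) (img g Ω₀)) (λ {g′} {h} e → reflexive (≡.cong (λ σ → δ σ (img g Ω₀)) (img-cong {g = g′} {h} e Ω₀))) ⟩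
        ∑ R (λ p → δ (img (p ∘ₚ g) Ω₀) (img g Ω₀))
          ≈⟨ ∑-cong R (λ p → trans (reflexive (≡.cong (λ σ → δ σ (img g Ω₀)) (img-∘ p g Ω₀)))
               (trans (δ-img g (img p Ω₀) (img g Ω₀)) (reflexive (≡.cong (δ (img p Ω₀)) (img-flip g Ω₀))))) ⟩
        w Ω₀ ∎

      -- Row permutations preserve the second row κ₀, and κ₀ ⊆ Ω because k ≤ m, so w vanishes unless
      -- κ₀ ⊆ τ. On these τ it is constant, because R acts transitively on them.
      w-formula : ∀ τ → ∣ τ ∣ ≡ m → w τ ≈ w Ω₀ * Z (δ κ₀) τ
      w-formula τ ∣τ∣ with sub? κ₀ τ
      ... | yes s = trans (trans (reflexive (≡.cong w (≡.sym gΩ≡τ))) (w-invariant {g} λ i → ≡.cong (if_then 0 else 1) (g∈R i))) (sym (trans (*-congˡ (Z-δ-yes κ₀ τ s)) (*-identityʳ _)))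
        where
        agree : AgreeAbove r Ω₀ τ
        agree i r≤i = ≡.trans (lookup-Ω₀ i) (≡.trans (≤⇒≤ᵇ-true (ℕ.≤-trans n∸m≤r r≤i)) (≡.sym (s i (≡.trans (lookup-κ₀ i) (≤⇒≤ᵇ-true r≤i)))))
        found = transitive r Ω₀ τ agree (≡.trans (proj₂ (Ω m≤n)) (≡.sym ∣τ∣))
        g = proj₁ found
        g∈R = proj₁ (proj₂ found)
        gΩ≡τ = proj₂ (proj₂ found)
      ... | no ¬s = trans (trans (∑-cong-∈ R λ {p} p∈ → δ-no {σ = img p Ω₀} {τ} λ e → ¬s λ i κi → ≡.subst (λ σ → lookup σ i ≡ inside) e
            (≡.trans (lookup-img p Ω₀ i) (≡.trans (lookup-Ω₀ _) (≤⇒≤ᵇ-true (ℕ.≤-trans n∸m≤r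
              (row-1⇒high {p ⟨$⟩ˡ i} (≡.trans (≡.sym (proj₂ (∈-filter⁻ preservesRows? {xs = permutations n} p∈) (p ⟨$⟩ˡ i))) (≡.trans (≡.cong row (Perm.inverseʳ p)) (row-high {i} (≤ᵇ-true⇒≤ (≡.trans (≡.sym (lookup-κ₀ i)) κi)))))))))))
          (∑-zero R λ _ → refl)) (sym (trans (*-congˡ (Z-δ-no κ₀ τ ¬s)) (zeroʳ _)))

      Z-polytabloid : ∀ τ → Z polytabloid τ ≈ ∑ C (λ q → sgn q * Z (δ κ₀) (img (Perm.flip q) τ))
      Z-polytabloid τ = trans (Z-∑ C (λ q κ → sgn q * δ (img q κ₀) κ) τ) (∑-cong C λ q → trans (Z-* (sgn q) (δ (img q κ₀)) τ) (*-congˡ (Z-δ-img q κ₀ τ)))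

      π-sum : ∀ (x : GroupRing n) τ → π n m m≤n x τ ≈ ∑ x (λ (a , g) → a * δ (img g Ω₀) (proj₁ τ))
      π-sum []      τ = refl
      π-sum (_ ∷ x) τ = +-congˡ (π-sum x τ)

      -- For each q the row sum is evaluated by `w-formula` at q⁻¹(τ), again an m-set; the signed
      -- sum over q then assembles the polytabloid.
      π-formula : ∀ τ → π n m m≤n (youngSymmetrizer n k) τ ≈ w Ω₀ * Z polytabloid (proj₁ τ)
      π-formula τ′@(τ , ∣τ∣) = begin
        π n m m≤n (youngSymmetrizer n k) τ′
          ≈⟨ π-sum (youngSymmetrizer n k) τ′ ⟩
        ∑ (youngSymmetrizer n k) (λ (a , g) → a * δ (img g Ω₀) τ)
          ≈⟨ ∑-cartesianProductWith _ (map (λ q → sgn q , q) C) (map (λ p → 1# , p) R) _ ⟩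
        ∑ (map (λ q → sgn q , q) C) (λ (a , q) → ∑ (map (λ p → 1# , p) R) (λ (b , p) → (a * b) * δ (img (p ∘ₚ q) Ω₀) τ))
          ≈⟨ ∑-map _ C _ ⟩
        ∑ C (λ q → ∑ (map (λ p → 1# , p) R) (λ (b , p) → (sgn q * b) * δ (img (p ∘ₚ q) Ω₀) τ))
          ≈⟨ ∑-cong C (λ q → ∑-map _ R _) ⟩
        ∑ C (λ q → ∑ R (λ p → (sgn q * 1#) * δ (img (p ∘ₚ q) Ω₀) τ))
          ≈⟨ ∑-cong C (λ q → ∑-cong R λ p → *-cong (*-identityʳ _) (trans (reflexive (≡.cong (λ σ → δ σ τ) (img-∘ p q Ω₀))) (δ-img q (img p Ω₀) τ))) ⟩
        ∑ C (λ q → ∑ R (λ p → sgn q * δ (img p Ω₀) (img (Perm.flip q) τ)))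
          ≈⟨ ∑-cong C (λ q → trans (∑-*ˡ R _ _) (*-congˡ (w-formula (img (Perm.flip q) τ) (≡.trans (∣img∣ (Perm.flip q) τ) ∣τ∣)))) ⟩
        ∑ C (λ q → sgn q * (w Ω₀ * Z (δ κ₀) (img (Perm.flip q) τ)))
          ≈⟨ trans (∑-cong C λ q → x*yz≈y*xz _ _ _) (∑-*ˡ C _ _) ⟩
        w Ω₀ * ∑ C (λ q → sgn q * Z (δ κ₀) (img (Perm.flip q) τ))
          ≈⟨ *-congˡ (Z-polytabloid τ) ⟨
        w Ω₀ * Z polytabloid τ ∎

      img-id : ∀ {g : Permutation′ n} → g Perm.≈ Perm.id → ∀ σ → img g σ ≡ σ
      img-id {g} e σ = lookup-ext λ i → ≡.trans (lookup-img g σ i) (≡.cong (lookup σ) (flip-cong {g = g} {Perm.id} e i))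

      wΩ#0 : w Ω₀ # 0#
      wΩ#0 = let (s , p) = ∑-count⁺ R (λ p → δ (img p Ω₀) Ω₀) (λ {p} _ → zero-one p) identity in #-congˡ (sym p) (char0 s)
        where
        zero-one : ∀ p → δ (img p Ω₀) Ω₀ ≈ 0# ⊎ δ (img p Ω₀) Ω₀ ≈ 1#
        zero-one p with img p Ω₀ ≟ₛ Ω₀
        ... | yes _ = inj₂ refl
        ... | no _  = inj₁ refl
        identity : Any (λ p → δ (img p Ω₀) Ω₀ ≈ 1#) R
        identity = let (g , g∈ , g≈id) = find (permutations-complete Perm.id) in
          lose (∈-filter⁺ preservesRows? g∈ (λ i → ≡.cong row (g≈id i))) (δ-yes (img-id {g} g≈id Ω₀))

      -- A column permutation sends an entry i of the second row to itself or to the entry i - r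
      -- above it. The latter is less than k ≤ n - m, hence outside Ω. So q fixes the second row
      -- and, by injectivity, the first.
      only-identity : ∀ {q : Permutation′ n} → PreservesColumns q → Sub κ₀ (img (Perm.flip q) Ω₀) → q Perm.≈ Perm.id
      only-identity {q} q∈C s = fixes
        where
        n∸m≤ : ∀ {i} → r ≤ toℕ i → n ∸ m ≤ toℕ (q ⟨$⟩ʳ i)
        n∸m≤ {i} r≤i = ≤ᵇ-true⇒≤ (≡.trans (≡.sym (lookup-Ω₀ (q ⟨$⟩ʳ i))) (≡.trans (≡.sym (lookup-img (Perm.flip q) Ω₀ i)) (s i (≡.trans (lookup-κ₀ i) (≤⇒≤ᵇ-true r≤i)))))
        fixes-high : ∀ {i} → r ≤ toℕ i → q ⟨$⟩ʳ i ≡ i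
        fixes-high {i} r≤i with ℕ.≤-<-connex r (toℕ (q ⟨$⟩ʳ i))
        ... | inj₁ r≤qi = Fin.toℕ-injective (ℕ.∸-cancelʳ-≡ r≤qi r≤i (≡.trans (≡.sym (col-high {q ⟨$⟩ʳ i} r≤qi)) (≡.trans (q∈C i) (col-high {i} r≤i))))
        ... | inj₂ qi<r = ⊥-elim (ℕ.<-irrefl ≡.refl (ℕ.<-≤-trans i∸r<k (ℕ.≤-trans k≤n∸m (≡.subst (n ∸ m ≤_)
                (≡.trans (≡.sym (col-low {q ⟨$⟩ʳ i} qi<r)) (≡.trans (q∈C i) (col-high {i} r≤i))) (n∸m≤ r≤i)))))
          where
          i∸r<k : toℕ i ∸ r < k
          i∸r<k = ≡.subst (toℕ i ∸ r <_) (ℕ.m∸[m∸n]≡n k≤n) (ℕ.∸-monoˡ-< (Fin.toℕ<n i) r≤i)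
        fixes : ∀ i → q ⟨$⟩ʳ i ≡ i
        fixes i with ℕ.≤-<-connex r (toℕ i)
        ... | inj₁ r≤i = fixes-high r≤i
        ... | inj₂ i<r with ℕ.≤-<-connex r (toℕ (q ⟨$⟩ʳ i))
        ...   | inj₁ r≤qi = ⊥-elim (ℕ.<-irrefl ≡.refl (ℕ.<-≤-trans i<r (≡.subst (λ j → r ≤ toℕ j) (perm-injective q (fixes-high r≤qi)) r≤qi)))
        ...   | inj₂ qi<r = Fin.toℕ-injective (≡.trans (≡.sym (col-low {q ⟨$⟩ʳ i} qi<r)) (≡.trans (q∈C i) (col-low {i} i<r)))

      Z-polytabloid-#0 : Z polytabloid Ω₀ # 0#
      Z-polytabloid-#0 = let (s , p) = ∑-count⁺ C term (λ {q} q∈ → zero-one q (proj₂ (∈-filter⁻ preservesColumns? {xs = permutations n} q∈)) (sub? κ₀ (img (Perm.flip q) Ω₀))) identity in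
          #-congˡ (sym (trans (Z-polytabloid Ω₀) p)) (char0 s)
        where
        term : Permutation′ n → Carrier
        term q = sgn q * Z (δ κ₀) (img (Perm.flip q) Ω₀)
        sgn-id : ∀ {q : Permutation′ n} → q Perm.≈ Perm.id → sgn q ≈ 1#
        sgn-id {q} e = reflexive (≡.cong ((- 1#) ^_) (≡.trans (inversions-cong {g = q} {Perm.id} e) (inversions-id n)))
        one : ∀ q → q Perm.≈ Perm.id → Sub κ₀ (img (Perm.flip q) Ω₀) → term q ≈ 1#
        one q q≈id s = trans (*-cong (sgn-id {q} q≈id) (Z-δ-yes κ₀ (img (Perm.flip q) Ω₀) s)) (*-identityˡ 1#)
        zero-one : ∀ q → PreservesColumns q → Dec (Sub κ₀ (img (Perm.flip q) Ω₀)) → term q ≈ 0# ⊎ term q ≈ 1#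
        zero-one q q∈C (yes s) = inj₂ (one q (only-identity {q} q∈C s) s)
        zero-one q q∈C (no ¬s) = inj₁ (trans (*-congˡ (Z-δ-no κ₀ (img (Perm.flip q) Ω₀) ¬s)) (zeroʳ _))
        identity : Any (λ q → term q ≈ 1#) C
        identity = let (g , g∈ , g≈id) = find (permutations-complete Perm.id) in
          lose (∈-filter⁺ preservesColumns? g∈ (λ i → ≡.cong col (g≈id i))) (one g g≈id λ i κi → ≡.trans (lookup-img (Perm.flip g) Ω₀ i)
            (≡.trans (≡.cong (lookup Ω₀) (g≈id i)) (≡.trans (lookup-Ω₀ i) (≤⇒≤ᵇ-true (ℕ.≤-trans n∸m≤r (≤ᵇ-true⇒≤ (≡.trans (≡.sym (lookup-κ₀ i)) κi)))))))

    youngSymmetrizer-eigenvector : ∀ b → OverField.IsEigenvector F (mSubsets n m) (B n m b) (eigenvalue n k≤m b) (π n m m≤n (youngSymmetrizer n k))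
    youngSymmetrizer-eigenvector b = (Ω m≤n , #-congˡ (sym (π-formula (Ω m≤n))) (*-#0 _ _ wΩ#0 Z-polytabloid-#0)) , λ σ → begin
      ∑ (mSubsets n m) (λ τ → B n m b σ τ * π n m m≤n (youngSymmetrizer n k) τ)
        ≈⟨ ∑-cong (mSubsets n m) (λ τ → trans (*-congˡ (π-formula τ)) (x*yz≈y*xz _ _ _)) ⟩
      ∑ (mSubsets n m) (λ τ → w Ω₀ * (B n m b σ τ * Z polytabloid (proj₁ τ)))
        ≈⟨ ∑-*ˡ (mSubsets n m) _ _ ⟩
      w Ω₀ * ∑ (mSubsets n m) (λ τ → B n m b σ τ * Z polytabloid (proj₁ τ))
        ≈⟨ *-congˡ (harmonic⇒eigenvector char0 k≤m m+k≤n b polytabloid polytabloid-homogeneous polytabloid-harmonic σ) ⟩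
      w Ω₀ * (eigenvalue n k≤m b * Z polytabloid (proj₁ σ))
        ≈⟨ trans (x*yz≈y*xz _ _ _) (*-congˡ (sym (π-formula σ))) ⟩
      eigenvalue n k≤m b * π n m m≤n (youngSymmetrizer n k) σ ∎

-- Characteristic zero of the complex numbers, and the conclusion.

open import Defs
open import Data.Nat.Base using (_+_; _*_)
open OverHeytingField ℂ-field using (ι; generic-multiplicity; youngSymmetrizer-eigenvector)

ι-real-nonnegative : ∀ n i → 0ℚ ℚ.≤ seq (re (ι n)) i
ι-real-nonnegative zero    i = ℚ.≤-refl
ι-real-nonnegative (suc n) i = ℚ.+-mono-≤ {0ℚ} {1ℚ} (ℚ.nonNegative⁻¹ 1ℚ) (ι-real-nonnegative n i)

-- The real part of n + 1 is a sequence that is at least 1 at every index, so 1 serves as the gap.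
ℂ-characteristic-0 : ∀ n → ι (suc n) Complex.# Complex.0#
ℂ-characteristic-0 n = Complex.re# (Real.apart 1ℚ (ℚ.positive⁻¹ 1ℚ) (0 , λ i _ → bound i))
  where
  bound : ∀ i → 1ℚ ℚ.≤ ℚ.∣ seq (re (ι (suc n))) i ℚ.- 0ℚ ∣
  bound i = ≡.subst (1ℚ ℚ.≤_) (≡.sym (≡.trans (≡.cong ℚ.∣_∣ (ℚ.+-identityʳ _)) (ℚ.0≤p⇒∣p∣≡p (ι-real-nonnegative (suc n) i))))
    (≡.subst (ℚ._≤ seq (re (ι (suc n))) i) (ℚ.+-identityʳ 1ℚ) (ℚ.+-monoʳ-≤ 1ℚ (ι-real-nonnegative n i)))

theorem1 : (n m k : ℕ) → 1 ≤ n → (m≤⌊n/2⌋ : m ≤ ⌊ n /2⌋) → (k≤m : k ≤ m) →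
    ((b : Fin (suc m) → ℂ) →
    IsEigenvector (mSubsets n m) (B n m b) (eigenvalue n k≤m b)
    (π n m (m≤⌊n/2⌋⇒m≤n m≤⌊n/2⌋) (youngSymmetrizer n k)))
    × (∃[ f ] f * (k ! * (n ∸ k + 1) !) ≡ n ! * (n ∸ 2 * k + 1)
    × Generically (suc m) (λ b →
    HasMultiplicity (mSubsets n m) (B n m b) (eigenvalue n k≤m b) f))
theorem1 n m k _ m≤⌊n/2⌋ k≤m =
    youngSymmetrizer-eigenvector ℂ-characteristic-0 2m≤n (m≤⌊n/2⌋⇒m≤n m≤⌊n/2⌋) k≤m
  , tally k (walks n)
  , walks-count n k (ℕ.≤-trans (ℕ.+-mono-≤ k≤m k≤m) 2m≤n)
  , generic-multiplicity ℂ-characteristic-0 2m≤n k≤m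
  where
  2m≤n : m + m ≤ n
  2m≤n = ℕ.≤-trans (ℕ.+-mono-≤ m≤⌊n/2⌋ (ℕ.≤-trans m≤⌊n/2⌋ (ℕ.⌊n/2⌋≤⌈n/2⌉ n))) (ℕ.≤-reflexive (ℕ.⌊n/2⌋+⌈n/2⌉≡n n))
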